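{- Let $(W,S)$ be a finite Coxeter system and $\theta$ an involutive automorphism of $(W,S)$. Then $\mathrm{Poin}(W;t)=\mathrm{Poin}(\iota(\theta);t)\,\mathrm{Poin}(\mathrm{Fix}(\theta);t)$ if and only if $m(s,\theta(s))\in\{1,2\}$ for all $s\in S$, i.e. if and only if $s$ commutes with $\theta(s)$ for every $s\in S$.
   Context: An automorphism of $(W,S)$ is a group automorphism of $W$ mapping $S$ onto $S$; involutive means $\theta^2=\mathrm{id}$; $m(s,s')$ is the order of $ss'$. Twisted identities $\iota(\theta)=\{\theta(w^{ -1})w\mid w\in W\}$. For $w\in W$, $s\in S$: $w\star s=ws$ if $\theta(s)ws=w$, else $w\star s=\theta(s)ws$; every twisted identity equals $e\star s_1\star\cdots\star s_k$ (left to right from the identity $e$) for some $s_i\in S$, and $\rho(w)$ is the minimal such $k$. $\mathrm{Fix}(\theta)=\{w\in W\mid\theta(w)=w\}$ is a Coxeter group with canonical Coxeter generators $\{w_J\mid J=\{s,\theta(s)\},\ s\in S\}$, where $w_J$ is the longest element of the parabolic subgroup $W_J$; $\ell_\theta$ denotes length with respect to these generators. Poincaré polynomials: $\mathrm{Poin}(W;t)=\sum_{w\in W}t^{\ell(w)}$, $\mathrm{Poin}(\iota(\theta);t)=\sum_{w\in\iota(\theta)}t^{\rho(w)}$, $\mathrm{Poin}(\mathrm{Fix}(\theta);t)=\sum_{f\in\mathrm{Fix}(\theta)}t^{\ell_\theta(f)}$. -}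

module Defs where

open import Level using (0ℓ)
open import Data.Nat using (ℕ; zero; suc; _+_; _*_; _∸_; _≤_; _<_; _≡ᵇ_; _≤ᵇ_)
open import Data.Fin using (Fin; _≟_)
open import Data.Bool using (Bool; true; false; _∧_; _∨_; not)
open import Data.List using (List; []; _∷_; allFin; upTo; foldr)
open import Data.Bool.ListAction using (any; all)
open import Data.Product using (Σ; ∃; _×_; _,_)
open import Data.Sum using (_⊎_)
open import Relation.Nullary using (¬_)
open import Relation.Nullary.Decidable using (⌊_⌋)
open import Relation.Binary.PropositionalEquality using (_≡_)
open import Algebra.Bundles using (Group)

record FinGroup (N : ℕ) : Set where
  infixl 7 _·_
  field
    _·_       : Fin N → Fin N → Fin N
    e         : Fin N
    inv       : Fin N → Fin N
    assoc     : ∀ x y z → (x · y) · z ≡ x · (y · z)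
    identityˡ : ∀ x → e · x ≡ x
    identityʳ : ∀ x → x · e ≡ x
    inverseˡ  : ∀ x → inv x · x ≡ e
    inverseʳ  : ∀ x → x · inv x ≡ e

  pow : Fin N → ℕ → Fin N
  pow x zero    = e
  pow x (suc k) = x · pow x k

  IsOrder : Fin N → ℕ → Set
  IsOrder x m = (1 ≤ m) × (pow x m ≡ e) × (∀ k → 1 ≤ k → k < m → ¬ (pow x k ≡ e))

module _ (H : Group 0ℓ 0ℓ) where
  open Group H
  powH : Carrier → ℕ → Carrier
  powH x zero    = ε
  powH x (suc k) = x ∙ powH x k

-- Finite Coxeter systems (W,S).  W is a finite group on Fin N,
-- S = { s i | i : Fin r } (s injective), and W has the Coxeter
-- presentation ⟨ S | (s s')^m(s,s') ⟩ where m(s,s') is the order of s s',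
-- expressed by the universal property of the presentation.

record CoxeterSystem : Set₁ where
  field
    N      : ℕ
    W      : FinGroup N
  open FinGroup W public
  field
    r      : ℕ
    s      : Fin r → Fin N
    s-inj  : ∀ i j → s i ≡ s j → i ≡ j
    s-invol   : ∀ i → s i · s i ≡ e
    s-nontriv : ∀ i → ¬ (s i ≡ e)
    generates : ∀ w → ∃ λ (ws : List (Fin r)) → w ≡ foldr (λ i x → s i · x) e ws
    presentation :
      (H : Group 0ℓ 0ℓ) (f : Fin r → Group.Carrier H) →
      (∀ i j m → IsOrder (s i · s j) m →
         Group._≈_ H (powH H (Group._∙_ H (f i) (f j)) m) (Group.ε H)) →
      Σ (Fin N → Group.Carrier H) λ φ →
        (∀ x y → Group._≈_ H (φ (x · y)) (Group._∙_ H (φ x) (φ y))) ×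
        (∀ i → Group._≈_ H (φ (s i)) (f i))

module _ (C : CoxeterSystem) where
  open CoxeterSystem C

  record IsInvolutiveAut (θ : Fin N → Fin N) : Set where
    field
      hom        : ∀ x y → θ (x · y) ≡ θ x · θ y
      injective  : ∀ x y → θ x ≡ θ y → x ≡ y
      surjective : ∀ y → ∃ λ x → θ x ≡ y
      S-into     : ∀ i → ∃ λ j → θ (s i) ≡ s j
      S-onto     : ∀ j → ∃ λ i → θ (s i) ≡ s j
      involutive : ∀ w → θ (θ w) ≡ w

anyFin : ∀ {n} → (Fin n → Bool) → Bool
anyFin {n} p = any p (allFin n)

allFin? : ∀ {n} → (Fin n → Bool) → Bool
allFin? {n} p = all p (allFin n)

countᵇ : ∀ {A : Set} → (A → Bool) → List A → ℕ
countᵇ p []       = 0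
countᵇ p (x ∷ xs) with p x
... | true  = suc (countᵇ p xs)
... | false = countᵇ p xs

Poly : Set
Poly = ℕ → ℕ

sumUpTo : ℕ → (ℕ → ℕ) → ℕ
sumUpTo zero    f = f 0
sumUpTo (suc k) f = sumUpTo k f + f (suc k)

_⊛_ : Poly → Poly → Poly
(p ⊛ q) k = sumUpTo k (λ i → p i * q (k ∸ i))

module Dist {N : ℕ} (step : Fin N → Fin N → Bool) (x0 : Fin N) where
  reach : ℕ → Fin N → Bool
  reach zero    y = ⌊ y ≟ x0 ⌋
  reach (suc k) y = reach k y ∨ anyFin (λ x → reach k x ∧ step x y)

  -- the minimal number of moves from x0 to y (for y reachable; the
  -- breadth-first search stabilises after fewer than N rounds)
  dist : Fin N → ℕ
  dist y = countᵇ (λ k → not (reach k y)) (upTo N)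

  poin : (Fin N → Bool) → Poly
  poin P k = countᵇ (λ y → P y ∧ (dist y ≡ᵇ k)) (allFin N)

module _ (C : CoxeterSystem) (θ : Fin (CoxeterSystem.N C) → Fin (CoxeterSystem.N C)) where
  open CoxeterSystem C

  stepW : Fin N → Fin N → Bool
  stepW x y = anyFin (λ i → ⌊ y ≟ x · s i ⌋)

  ℓ : Fin N → ℕ
  ℓ = Dist.dist stepW e

  PoinW : Poly
  PoinW = Dist.poin stepW e (λ _ → true)

  _⋆_ : Fin N → Fin N → Fin N
  w ⋆ t with θ t · w · t ≟ w
  ... | Relation.Nullary.yes _ = w · t
  ... | Relation.Nullary.no  _ = θ t · w · t

  inι : Fin N → Bool
  inι y = anyFin (λ w → ⌊ θ (inv w) · w ≟ y ⌋)

  stepι : Fin N → Fin N → Bool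
  stepι x y = anyFin (λ i → ⌊ y ≟ x ⋆ s i ⌋)

  Poinι : Poly
  Poinι = Dist.poin stepι e inι

  inFix : Fin N → Bool
  inFix y = ⌊ θ y ≟ y ⌋

  stepJ : Fin r → Fin N → Fin N → Bool
  stepJ i x y = ⌊ y ≟ x · s i ⌋ ∨ ⌊ y ≟ x · θ (s i) ⌋

  inWJ : Fin r → Fin N → Bool
  inWJ i = Dist.reach (stepJ i) e N

  isLongest : Fin r → Fin N → Bool
  isLongest i g = inWJ i g ∧ allFin? (λ h → not (inWJ i h) ∨ (ℓ h ≤ᵇ ℓ g))

  isFixGen : Fin N → Bool
  isFixGen g = anyFin (λ i → isLongest i g)

  stepF : Fin N → Fin N → Bool
  stepF x y = anyFin (λ g → isFixGen g ∧ ⌊ y ≟ x · g ⌋)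

  PoinFix : Poly
  PoinFix = Dist.poin stepF e inFix

{-# OPTIONS --safe #-}
module Submission where

-- The group W acts on ι(θ) by x ↦ θ(w⁻¹) x w, with stabiliser Fix(θ) at e.  If every s commutes with θ(s), the free
-- module on ι(θ) carries an action of the Hecke algebra with parameter t in which m_x T_s is t m_x, m_{xs} or
-- t m_{xs} + (t - 1) m_x according as s fixes, raises or lowers x.  The vector m_e Σ_w T_w is an eigenvector of every
-- T_s, hence a multiple c(t) Σ_x m_x, and the functional m_x ↦ t^ρ(x) gives Poin(W) = c(t) Poin(ι(θ)).  The
-- coefficient of m_e in m_e T_w vanishes unless w ∈ Fix(θ), when it is t^ℓ_θ(w), so c(t) = Poin(Fix(θ)).  The braid
-- relations reduce to the minimal element x of each orbit of a rank two parabolic subgroup, and the hypothesis is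
-- used to show that x⁻¹ θ(-) x cannot swap the two generators and fix a reflection between them.  All this is
-- carried out for natural numbers t, one large enough t being sufficient to compare coefficients.
-- Conversely, each pair of non-commuting s, θ(s) contributes one term too many in degree one to the product.

open import Defs
open import Level using (0ℓ)
open import Data.Nat using (ℕ; zero; suc; _+_; _*_; _∸_; _^_; _≤_; _<_; z≤n; s≤s; _≡ᵇ_; _≤ᵇ_; _≤?_; _<?_)
import Data.Nat as ℕ
import Data.Nat.Properties as ℕ
open import Data.Nat.DivMod using (_/_; _%_; m≡m%n+[m/n]*n; m%n<n)
open import Data.Nat.Induction using (<-wellFounded)
open import Data.Nat.Solver using (module +-*-Solver)
open +-*-Solver using (solve; _:+_; _:*_; _:=_; con)
open import Induction.WellFounded using (Acc; acc)
open import Data.Fin using (Fin; zero; suc; toℕ; _≟_; join; splitAt)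
import Data.Fin.Properties as Fₚ
open import Data.Fin.Patterns using (0F; 1F; 2F; 3F; 4F)
open import Data.Bool using (Bool; true; false; _∧_; _∨_; not; _xor_; if_then_else_)
import Data.Bool as Bool
import Data.Bool.Properties as Bₚ
open import Data.Vec using (Vec; []; _∷_; lookup)
open import Data.List using (List; []; _∷_; _++_; length; foldr; map; allFin; upTo; tabulate; applyUpTo)
import Data.List.Properties as Lₚ
open import Data.Product using (∃; _×_; _,_; proj₁; proj₂)
open import Data.Sum using (_⊎_; inj₁; inj₂)
open import Data.Sum.Properties using (inj₁-injective; inj₂-injective)
open import Data.Unit using (⊤; tt)
open import Data.Empty using (⊥; ⊥-elim)
open import Function using (_∘_; id; case_of_)
open import Relation.Nullary using (¬_; Dec; yes; no)
open import Relation.Nullary.Decidable using (⌊_⌋; _×-dec_)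
open import Relation.Binary.PropositionalEquality
open import Relation.Binary.Definitions using (Tri; tri<; tri≈; tri>)
open import Algebra.Bundles using (Group)
open import Algebra.Properties.Semiring.Sum ℕ.+-*-semiring using (sum; sum-cong-≗; ∑-distrib-+; *-distribˡ-sum; *-distribʳ-sum; sum-permute; ∑-comm)
open import Data.Fin.Permutation using (Permutation; permutation)

-- The Coxeter presentation enters once, through a homomorphism into a semidirect product whose
-- second coordinate is the cocycle `η`. Exchange, descents and parabolic cosets are all read off
-- from `η`. Natural numbers have neither differences nor inverses. Vectors of the Hecke module are
-- therefore replaced by functionals `Fin N → ℕ`, the parameter is q = t - 1 so that every
-- coefficient is a natural number, and inverting T_s becomes cancellation of a nonzero factor. The
-- orbit of a rank two parabolic subgroup may close up before the order m(s,s') is reached. The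
-- braid relation is found first at the orbit's own length, which divides m(s,s'), and is then
-- iterated. The weight t^ρ(x) is accessible because ℓ(x) = 2ρ(x) on ι(θ): a generator that fixes x
-- is never a descent of x. This is special to twisted identities and fails for general x with θ(x)
-- = x⁻¹.

⌊⌋-true : ∀ {n} {a b : Fin n} → a ≡ b → ⌊ a ≟ b ⌋ ≡ true
⌊⌋-true {a = a} {b} p with a ≟ b
... | yes _ = refl
... | no ¬p = ⊥-elim (¬p p)

⌊⌋-false : ∀ {n} {a b : Fin n} → ¬ a ≡ b → ⌊ a ≟ b ⌋ ≡ false
⌊⌋-false {a = a} {b} ¬p with a ≟ b
... | yes p = ⊥-elim (¬p p)
... | no _ = refl

⌊⌋-true⁻ : ∀ {n} {a b : Fin n} → ⌊ a ≟ b ⌋ ≡ true → a ≡ b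
⌊⌋-true⁻ {a = a} {b} q with a ≟ b
⌊⌋-true⁻ q  | yes p = p
⌊⌋-true⁻ () | no _

⌊⌋-cong : ∀ {n m} {a b : Fin n} {c d : Fin m} → (a ≡ b → c ≡ d) → (c ≡ d → a ≡ b) →
          ⌊ a ≟ b ⌋ ≡ ⌊ c ≟ d ⌋
⌊⌋-cong {a = a} {b} f g with a ≟ b
... | yes p = sym (⌊⌋-true (f p))
... | no ¬p = sym (⌊⌋-false (¬p ∘ g))

if-true : ∀ {A : Set} {b} {x y : A} → b ≡ true → (if b then x else y) ≡ x
if-true refl = refl

if-false : ∀ {A : Set} {b} {x y : A} → b ≡ false → (if b then x else y) ≡ y
if-false refl = refl

true≢false : ∀ {b : Bool} → b ≡ true → b ≡ false → ⊥
true≢false refl ()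

not-true : ∀ {b : Bool} → ¬ b ≡ true → b ≡ false
not-true {true}  h = ⊥-elim (h refl)
not-true {false} _ = refl

not-false : ∀ {b : Bool} → ¬ b ≡ false → b ≡ true
not-false {true}  _ = refl
not-false {false} h = ⊥-elim (h refl)

xor-cancelˡ : ∀ {a b} → a ≡ a xor b → b ≡ false
xor-cancelˡ {true}  {false} _ = refl
xor-cancelˡ {false} {false} _ = refl

bool-cases : ∀ z {A : Bool → Set} → A z → A (not z) → ∀ b → A b
bool-cases false p p′ false = p
bool-cases false p p′ true  = p′
bool-cases true  p p′ false = p′
bool-cases true  p p′ true  = p

-- Group word solver

-- Words in the variables V i and the involutions I i are compared through their reduced forms.
module GroupSolver {N : ℕ} (W : FinGroup N) where
  open FinGroup W

  Involution : Set
  Involution = ∃ λ a → a · a ≡ e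

  inv-unique : ∀ {a b} → a · b ≡ e → inv a ≡ b
  inv-unique {a} {b} h = trans (sym (identityʳ _)) (trans (cong (inv a ·_) (sym h))
    (trans (sym (assoc _ _ _)) (trans (cong (_· b) (inverseˡ a)) (identityˡ b))))

  inv-inv : ∀ a → inv (inv a) ≡ a
  inv-inv a = inv-unique (inverseˡ a)

  inv-e : inv e ≡ e
  inv-e = inv-unique (identityˡ e)

  inv-· : ∀ a b → inv (a · b) ≡ inv b · inv a
  inv-· a b = inv-unique (trans (assoc _ _ _) (trans (cong (a ·_) (trans (sym (assoc _ _ _))
    (trans (cong (_· inv a) (inverseʳ b)) (identityˡ _)))) (inverseʳ a)))

  infixl 7 _∙_
  data Expr (n m : ℕ) : Set where
    V   : Fin n → Expr n m
    I   : Fin m → Expr n m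
    ε   : Expr n m
    _∙_ : Expr n m → Expr n m → Expr n m
    _⁻¹ : Expr n m → Expr n m

  data Letter (n m : ℕ) : Set where
    pos neg : Fin n → Letter n m
    ivl     : Fin m → Letter n m

  module _ {n m : ℕ} where
    push : Letter n m → List (Letter n m) → List (Letter n m)
    push l [] = l ∷ []
    push (pos i) (neg j ∷ ls) = if ⌊ i ≟ j ⌋ then ls else pos i ∷ neg j ∷ ls
    push (neg i) (pos j ∷ ls) = if ⌊ i ≟ j ⌋ then ls else neg i ∷ pos j ∷ ls
    push (ivl i) (ivl j ∷ ls) = if ⌊ i ≟ j ⌋ then ls else ivl i ∷ ivl j ∷ ls
    push l (k ∷ ls) = l ∷ k ∷ ls

    nf nf⁻¹ : Expr n m → List (Letter n m) → List (Letter n m)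
    nf (V i) = push (pos i)
    nf (I i) = push (ivl i)
    nf ε ls = ls
    nf (a ∙ b) ls = nf a (nf b ls)
    nf (a ⁻¹) = nf⁻¹ a
    nf⁻¹ (V i) = push (neg i)
    nf⁻¹ (I i) = push (ivl i)
    nf⁻¹ ε ls = ls
    nf⁻¹ (a ∙ b) ls = nf⁻¹ b (nf⁻¹ a ls)
    nf⁻¹ (a ⁻¹) = nf a

    module _ (ρ : Vec (Fin N) n) (σ : Vec Involution m) where
      ⟦_⟧ : Expr n m → Fin N
      ⟦ V i ⟧ = lookup ρ i
      ⟦ I i ⟧ = proj₁ (lookup σ i)
      ⟦ ε ⟧ = e
      ⟦ a ∙ b ⟧ = ⟦ a ⟧ · ⟦ b ⟧
      ⟦ a ⁻¹ ⟧ = inv ⟦ a ⟧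

      ⟦_⟧ₗ : Letter n m → Fin N
      ⟦ pos i ⟧ₗ = lookup ρ i
      ⟦ neg i ⟧ₗ = inv (lookup ρ i)
      ⟦ ivl i ⟧ₗ = proj₁ (lookup σ i)

      ⟦_⟧ₛ : List (Letter n m) → Fin N
      ⟦ [] ⟧ₛ = e
      ⟦ l ∷ ls ⟧ₛ = ⟦ l ⟧ₗ · ⟦ ls ⟧ₛ

      cancel : ∀ {a b} x → a · b ≡ e → x ≡ a · (b · x)
      cancel x h = sym (trans (sym (assoc _ _ _)) (trans (cong (_· x) h) (identityˡ x)))

      push-correct : ∀ l ls → ⟦ push l ls ⟧ₛ ≡ ⟦ l ⟧ₗ · ⟦ ls ⟧ₛ
      push-correct l [] = refl
      push-correct (pos i) (pos j ∷ ls) = refl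
      push-correct (pos i) (neg j ∷ ls) with i ≟ j
      ... | yes refl = cancel _ (inverseʳ _)
      ... | no _ = refl
      push-correct (pos i) (ivl j ∷ ls) = refl
      push-correct (neg i) (pos j ∷ ls) with i ≟ j
      ... | yes refl = cancel _ (inverseˡ _)
      ... | no _ = refl
      push-correct (neg i) (neg j ∷ ls) = refl
      push-correct (neg i) (ivl j ∷ ls) = refl
      push-correct (ivl i) (pos j ∷ ls) = refl
      push-correct (ivl i) (neg j ∷ ls) = refl
      push-correct (ivl i) (ivl j ∷ ls) with i ≟ j
      ... | yes refl = cancel _ (proj₂ (lookup σ i))
      ... | no _ = refl

      nf-correct   : ∀ a ls → ⟦ nf a ls ⟧ₛ ≡ ⟦ a ⟧ · ⟦ ls ⟧ₛ
      nf⁻¹-correct : ∀ a ls → ⟦ nf⁻¹ a ls ⟧ₛ ≡ inv ⟦ a ⟧ · ⟦ ls ⟧ₛ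
      nf-correct (V i) ls = push-correct (pos i) ls
      nf-correct (I i) ls = push-correct (ivl i) ls
      nf-correct ε ls = sym (identityˡ _)
      nf-correct (a ∙ b) ls = trans (nf-correct a _) (trans (cong (⟦ a ⟧ ·_) (nf-correct b ls)) (sym (assoc _ _ _)))
      nf-correct (a ⁻¹) ls = nf⁻¹-correct a ls
      nf⁻¹-correct (V i) ls = push-correct (neg i) ls
      nf⁻¹-correct (I i) ls = trans (push-correct (ivl i) ls) (cong (_· ⟦ ls ⟧ₛ) (sym (inv-unique (proj₂ (lookup σ i)))))
      nf⁻¹-correct ε ls = sym (trans (cong (_· ⟦ ls ⟧ₛ) inv-e) (identityˡ _))
      nf⁻¹-correct (a ∙ b) ls = trans (nf⁻¹-correct b _) (trans (cong (inv ⟦ b ⟧ ·_) (nf⁻¹-correct a ls))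
        (trans (sym (assoc _ _ _)) (cong (_· ⟦ ls ⟧ₛ) (sym (inv-· _ _)))))
      nf⁻¹-correct (a ⁻¹) ls = trans (nf-correct a ls) (cong (_· ⟦ ls ⟧ₛ) (sym (inv-inv _)))

      grp : ∀ a b → nf a [] ≡ nf b [] → ⟦ a ⟧ ≡ ⟦ b ⟧
      grp a b h = trans (sym (identityʳ _)) (trans (sym (nf-correct a []))
        (trans (cong ⟦_⟧ₛ h) (trans (nf-correct b []) (identityʳ _))))

  X : ∀ {n m} → Expr (1 + n) m
  X = V 0F
  Y : ∀ {n m} → Expr (2 + n) m
  Y = V 1F
  Z : ∀ {n m} → Expr (3 + n) m
  Z = V 2F
  P : ∀ {n m} → Expr n (1 + m)
  P = I 0F
  Q : ∀ {n m} → Expr n (2 + m)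
  Q = I 1F

  conj≡⇒ : ∀ {a t b} → a · t · inv a ≡ b → t ≡ inv a · b · a
  conj≡⇒ {a} {t} refl = grp (a ∷ t ∷ []) [] Y (X ⁻¹ ∙ (X ∙ Y ∙ X ⁻¹) ∙ X) refl

  conj≡⇐ : ∀ {a t b} → t ≡ inv a · b · a → a · t · inv a ≡ b
  conj≡⇐ {a} {b = b} refl = grp (a ∷ b ∷ []) [] (X ∙ (X ⁻¹ ∙ Y ∙ X) ∙ X ⁻¹) Y refl

  ·-cancelˡ : ∀ a {x y} → a · x ≡ a · y → x ≡ y
  ·-cancelˡ a {x} {y} h = trans (grp (a ∷ x ∷ []) [] Y (X ⁻¹ ∙ (X ∙ Y)) refl)
    (trans (cong (inv a ·_) h) (grp (a ∷ y ∷ []) [] (X ⁻¹ ∙ (X ∙ Y)) Y refl))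

  ·-cancelʳ : ∀ a {x y} → x · a ≡ y · a → x ≡ y
  ·-cancelʳ a {x} {y} h = trans (grp (a ∷ x ∷ []) [] Y (Y ∙ X ∙ X ⁻¹) refl)
    (trans (cong (_· inv a) h) (grp (a ∷ y ∷ []) [] (Y ∙ X ∙ X ⁻¹) Y refl))

  pow-+ : ∀ p k l → pow p (k + l) ≡ pow p k · pow p l
  pow-+ p zero l = sym (identityˡ _)
  pow-+ p (suc k) l = trans (cong (p ·_) (pow-+ p k l)) (sym (assoc _ _ _))

  pow-sucʳ : ∀ p k → pow p (suc k) ≡ pow p k · p
  pow-sucʳ p k = trans (cong (pow p) (ℕ.+-comm 1 k)) (trans (pow-+ p k 1) (cong (pow p k ·_) (identityʳ p)))

-- The reflection cocycle

module Cocycle (C : CoxeterSystem) where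
  open CoxeterSystem C
  open GroupSolver W

  sᴵ : Fin r → Involution
  sᴵ i = s i , s-invol i

  -- The semidirect product of W with the Boolean functions on W, where W acts by conjugation. For a
  -- homomorphism from W that is the identity on the first coordinate, the second coordinate is a
  -- cocycle. Functions live on all of W, which avoids deciding which elements are reflections.
  wreath : Group 0ℓ 0ℓ
  wreath = record
    { Carrier = Fin N × (Fin N → Bool)
    ; _≈_ = λ x y → proj₁ x ≡ proj₁ y × (∀ t → proj₂ x t ≡ proj₂ y t)
    ; _∙_ = λ x y → proj₁ x · proj₁ y , λ t → proj₂ x (proj₁ y · t · inv (proj₁ y)) xor proj₂ y t
    ; ε = e , λ _ → false
    ; _⁻¹ = λ x → inv (proj₁ x) , λ t → proj₂ x (inv (proj₁ x) · t · proj₁ x)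
    ; isGroup = record
      { isMonoid = record
        { isSemigroup = record
          { isMagma = record
            { isEquivalence = record
              { refl = refl , λ _ → refl
              ; sym = λ (p , q) → sym p , λ t → sym (q t)
              ; trans = λ (p , q) (p′ , q′) → trans p p′ , λ t → trans (q t) (q′ t) }
            ; ∙-cong = λ { {x , n} {y , n′} {u , m} {v , m′} (p , q) (p′ , q′) → cong₂ _·_ p p′ ,
                λ t → cong₂ _xor_ (trans (q _) (cong (λ z → n′ (z · t · inv z)) p′)) (q′ t) } }
          ; assoc = λ (x , n) (y , m) (z , l) → assoc x y z , λ t →
              trans (Bₚ.xor-assoc (n _) _ _) (cong (λ u → n u xor (m (z · t · inv z) xor l t))
                (grp (y ∷ z ∷ t ∷ []) [] (X ∙ (Y ∙ Z ∙ Y ⁻¹) ∙ X ⁻¹) ((X ∙ Y) ∙ Z ∙ (X ∙ Y) ⁻¹) refl)) }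
        ; identity = (λ (x , n) → identityˡ x , λ t → refl)
                   , (λ (x , n) → identityʳ x , λ t → trans (Bₚ.xor-identityʳ _)
                       (cong n (grp (t ∷ []) [] (ε ∙ X ∙ ε ⁻¹) X refl))) }
      ; inverse = (λ (x , n) → inverseˡ x , λ t → trans (cong (λ u → n u xor n t)
                     (grp (x ∷ t ∷ []) [] (X ⁻¹ ∙ (X ∙ Y ∙ X ⁻¹) ∙ X) Y refl)) (Bₚ.xor-same (n t)))
                , (λ (x , n) → inverseʳ x , λ t → trans (cong (λ u → n u xor n (inv x · t · x))
                     (grp (x ∷ t ∷ []) [] (X ⁻¹ ∙ Y ∙ X ⁻¹ ⁻¹) (X ⁻¹ ∙ Y ∙ X) refl)) (Bₚ.xor-same (n (inv x · t · x))))
      ; ⁻¹-cong = λ { {x , n} {y , m} (refl , q) → refl , λ t → q _ } } }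

  xorUpTo : (ℕ → Bool) → ℕ → Bool
  xorUpTo g zero = false
  xorUpTo g (suc k) = g k xor xorUpTo g k

  xorUpTo-periodic : ∀ g m → (∀ l → g (l + m) ≡ g l) → ∀ k → xorUpTo g (k + m) ≡ xorUpTo g k xor xorUpTo g m
  xorUpTo-periodic g m h zero = refl
  xorUpTo-periodic g m h (suc k) = trans (cong₂ _xor_ (h k) (xorUpTo-periodic g m h k)) (sym (Bₚ.xor-assoc (g k) _ _))

  f : Fin r → Fin N × (Fin N → Bool)
  f i = s i , λ t → ⌊ t ≟ s i ⌋

  module _ (i j : Fin r) where
    private
      p = s i · s j
      u = Group._∙_ wreath (f i) (f j)

    rotation-inverse : ∀ k → s j · pow p k · s j ≡ inv (pow p k)
    rotation-inverse zero = grp [] (sᴵ j ∷ []) (P ∙ ε ∙ P) (ε ⁻¹) refl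
    rotation-inverse (suc k) = trans
      (grp (pow p k ∷ []) (sᴵ i ∷ sᴵ j ∷ []) (Q ∙ ((P ∙ Q) ∙ X) ∙ Q) ((Q ∙ P) ∙ (Q ∙ X ∙ Q)) refl)
      (trans (cong ((s j · s i) ·_) (rotation-inverse k))
      (trans (grp (pow p k ∷ []) (sᴵ i ∷ sᴵ j ∷ []) ((Q ∙ P) ∙ X ⁻¹) ((X ∙ (P ∙ Q)) ⁻¹) refl)
             (cong inv (sym (pow-sucʳ p k)))))

    powH-word : ∀ k → proj₁ (powH wreath u k) ≡ pow p k
    powH-word zero = refl
    powH-word (suc k) = cong (p ·_) (powH-word k)

    -- The reflections met along the word (s i s j)^k are the s j p^l with l < 2k.
    powH-parity : ∀ t k → proj₂ (powH wreath u k) t ≡ xorUpTo (λ l → ⌊ t ≟ s j · pow p l ⌋) (k + k)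
    powH-parity t zero = refl
    powH-parity t (suc k) = begin
      (⌊ s j · (Pk · t · inv Pk) · inv (s j) ≟ s i ⌋ xor ⌊ Pk · t · inv Pk ≟ s j ⌋) xor proj₂ (powH wreath u k) t
        ≡⟨ cong₂ _xor_ (cong₂ _xor_ odd even) (powH-parity t k) ⟩
      (g (suc (k + k)) xor g (k + k)) xor xorUpTo g (k + k) ≡⟨ Bₚ.xor-assoc (g (suc (k + k))) _ _ ⟩
      xorUpTo g (suc (suc (k + k))) ≡⟨ cong (λ n → xorUpTo g (suc n)) (sym (ℕ.+-suc k k)) ⟩
      xorUpTo g (suc k + suc k) ∎
      where
      open ≡-Reasoning
      g : ℕ → Bool
      g l = ⌊ t ≟ s j · pow p l ⌋
      Pk = proj₁ (powH wreath u k)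
      Pk≡ = powH-word k
      rot : inv Pk ≡ s j · Pk · s j
      rot = trans (cong inv Pk≡) (trans (sym (rotation-inverse k)) (cong (λ z → s j · z · s j) (sym Pk≡)))
      even-word : inv Pk · s j · Pk ≡ s j · pow p (k + k)
      even-word = trans (cong (λ z → z · s j · Pk) rot)
        (trans (grp (Pk ∷ []) (sᴵ j ∷ []) (P ∙ X ∙ P ∙ P ∙ X) (P ∙ (X ∙ X)) refl)
        (cong (s j ·_) (trans (cong₂ _·_ Pk≡ Pk≡) (sym (pow-+ p k k)))))
      odd-word : inv Pk · (inv (s j) · s i · s j) · Pk ≡ s j · pow p (suc (k + k))
      odd-word = trans (cong (λ z → z · (inv (s j) · s i · s j) · Pk) rot)
        (trans (grp (Pk ∷ []) (sᴵ j ∷ sᴵ i ∷ []) (P ∙ X ∙ P ∙ (P ⁻¹ ∙ Q ∙ P) ∙ X) (P ∙ (X ∙ ((Q ∙ P) ∙ X))) refl)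
        (cong (s j ·_) (trans (cong₂ (λ a b → a · (p · b)) Pk≡ Pk≡)
          (trans (sym (pow-+ p k (suc k))) (cong (pow p) (ℕ.+-suc k k))))))
      even : ⌊ Pk · t · inv Pk ≟ s j ⌋ ≡ g (k + k)
      even = ⌊⌋-cong (λ h → trans (conj≡⇒ h) even-word) (λ h → conj≡⇐ (trans h (sym even-word)))
      odd : ⌊ s j · (Pk · t · inv Pk) · inv (s j) ≟ s i ⌋ ≡ g (suc (k + k))
      odd = ⌊⌋-cong (λ h → trans (conj≡⇒ (conj≡⇒ h)) odd-word)
                    (λ h → conj≡⇐ (conj≡⇐ (trans h (sym odd-word))))

    -- The reflections met along the word are `s j · pow p l` for l below 2m. Since p^m = e, this
    -- list runs through the same m entries twice, so every parity cancels.
    wreath-relation : ∀ m → IsOrder p m → Group._≈_ wreath (powH wreath u m) (Group.ε wreath)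
    wreath-relation m (_ , pm , _) = trans (powH-word m) pm , λ t → trans (powH-parity t m)
      (trans (xorUpTo-periodic (λ l → ⌊ t ≟ s j · pow p l ⌋) m
        (λ l → cong (λ z → ⌊ t ≟ s j · z ⌋) (trans (pow-+ p l m) (trans (cong (pow p l ·_) pm) (identityʳ _)))) m)
      (Bₚ.xor-same (xorUpTo (λ l → ⌊ t ≟ s j · pow p l ⌋) m)))

  private
    φ = proj₁ (presentation wreath f wreath-relation)
    φ-hom = proj₁ (proj₂ (presentation wreath f wreath-relation))
    φ-s = proj₂ (proj₂ (presentation wreath f wreath-relation))

    φ-e : proj₁ (φ e) ≡ e
    φ-e = ·-cancelˡ (proj₁ (φ e)) (trans (sym (proj₁ (φ-hom e e))) (trans (cong (proj₁ ∘ φ) (identityˡ e)) (sym (identityʳ _))))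

    -- The first coordinate is a homomorphism that fixes every generator; this is what makes the
    -- second coordinate a cocycle on W.
    φ-word : ∀ w → proj₁ (φ w) ≡ w
    φ-word w = subst (λ z → proj₁ (φ z) ≡ z) (sym (proj₂ (generates w))) (go (proj₁ (generates w)))
      where
      go : ∀ ws → proj₁ (φ (foldr (λ i x → s i · x) e ws)) ≡ foldr (λ i x → s i · x) e ws
      go [] = φ-e
      go (i ∷ ws) = trans (proj₁ (φ-hom _ _)) (cong₂ _·_ (proj₁ (φ-s i)) (go ws))

  -- For a reflection t, η w t is true exactly when t is a right inversion of w.
  abstract
    η : Fin N → Fin N → Bool
    η w t = proj₂ (φ w) t

    η-· : ∀ a b t → η (a · b) t ≡ η a (b · t · inv b) xor η b t
    η-· a b t = trans (proj₂ (φ-hom a b) t) (cong (λ z → η a (z · t · inv z) xor η b t) (φ-word b))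

    η-s : ∀ i t → η (s i) t ≡ ⌊ t ≟ s i ⌋
    η-s i t = proj₂ (φ-s i) t

-- Boolean search and breadth-first distance

∧-true⁻ : ∀ {a b} → a ∧ b ≡ true → a ≡ true × b ≡ true
∧-true⁻ {true} h = refl , h

∧-true⁺ : ∀ {a b} → a ≡ true → b ≡ true → a ∧ b ≡ true
∧-true⁺ refl refl = refl

∨-true⁻ : ∀ {a b} → a ∨ b ≡ true → a ≡ true ⊎ b ≡ true
∨-true⁻ {true}  _ = inj₁ refl
∨-true⁻ {false} h = inj₂ h

∨-true⁺ʳ : ∀ {a b} → b ≡ true → a ∨ b ≡ true
∨-true⁺ʳ {a} refl = Bₚ.∨-zeroʳ a

∨-true⁺ˡ : ∀ {a b} → a ≡ true → a ∨ b ≡ true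
∨-true⁺ˡ refl = refl

anyFin⁻ : ∀ {n} (p : Fin n → Bool) → anyFin p ≡ true → ∃ λ i → p i ≡ true
anyFin⁻ {n} p = go n id
  where
  go : ∀ m (f : Fin m → Fin n) → foldr _∨_ false (map p (tabulate f)) ≡ true → ∃ λ i → p i ≡ true
  go (suc m) f h with ∨-true⁻ {p (f zero)} h
  ... | inj₁ q = f zero , q
  ... | inj₂ q = go m (f ∘ suc) q

anyFin⁺ : ∀ {n} (p : Fin n → Bool) i → p i ≡ true → anyFin p ≡ true
anyFin⁺ {n} p = go n id
  where
  go : ∀ m (f : Fin m → Fin n) i → p (f i) ≡ true → foldr _∨_ false (map p (tabulate f)) ≡ true
  go (suc m) f zero h = ∨-true⁺ˡ h
  go (suc m) f (suc i) h = ∨-true⁺ʳ {p (f zero)} (go m (f ∘ suc) i h)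

allFin?⁻ : ∀ {n} (p : Fin n → Bool) → allFin? p ≡ true → ∀ i → p i ≡ true
allFin?⁻ {n} p = go n id
  where
  go : ∀ m (f : Fin m → Fin n) → foldr _∧_ true (map p (tabulate f)) ≡ true → ∀ i → p (f i) ≡ true
  go (suc m) f h zero = proj₁ (∧-true⁻ h)
  go (suc m) f h (suc i) = go m (f ∘ suc) (proj₂ (∧-true⁻ {p (f zero)} h)) i

allFin?⁺ : ∀ {n} (p : Fin n → Bool) → (∀ i → p i ≡ true) → allFin? p ≡ true
allFin?⁺ {n} p h = go n id
  where
  go : ∀ m (f : Fin m → Fin n) → foldr _∧_ true (map p (tabulate f)) ≡ true
  go zero f = refl
  go (suc m) f = ∧-true⁺ (h (f zero)) (go m (f ∘ suc))

-- Links `dist`, a count of the rounds that miss a point, with the first round that reaches it: by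
-- monotonicity the missing rounds form an initial segment.
countᵇ-initial : ∀ (p : ℕ → Bool) N k → k ≤ N → (∀ j → j < k → p j ≡ true) → (∀ j → k ≤ j → p j ≡ false) →
                 countᵇ p (upTo N) ≡ k
countᵇ-initial p N k = go N k id
  where
  go : ∀ N k (f : ℕ → ℕ) → k ≤ N → (∀ j → j < k → p (f j) ≡ true) → (∀ j → k ≤ j → p (f j) ≡ false) →
       countᵇ p (applyUpTo f N) ≡ k
  go zero zero f _ _ _ = refl
  go (suc N) zero f _ t u with p (f 0) | u 0 z≤n
  ... | false | _ = go N zero (f ∘ suc) z≤n (λ j ()) (λ j _ → u (suc j) z≤n)
  go (suc N) (suc k) f (s≤s h) t u with p (f 0) | t 0 (s≤s z≤n)
  ... | true | _ = cong suc (go N k (f ∘ suc) h (λ j q → t (suc j) (s≤s q)) (λ j q → u (suc j) (s≤s q)))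

module DistProperties {N : ℕ} (step : Fin N → Fin N → Bool) (x0 : Fin N) where
  open Dist step x0

  reach-start : ∀ {y} → reach 0 y ≡ true → y ≡ x0
  reach-start = ⌊⌋-true⁻

  reach-suc : ∀ k {y} → reach k y ≡ true → reach (suc k) y ≡ true
  reach-suc k = ∨-true⁺ˡ

  reach-mono : ∀ {k l y} → k ≤ l → reach k y ≡ true → reach l y ≡ true
  reach-mono {k} {l} {y} k≤l h = subst (λ n → reach n y ≡ true) (ℕ.m∸n+n≡m k≤l) (go (l ∸ k))
    where
    go : ∀ d → reach (d + k) y ≡ true
    go zero = h
    go (suc d) = reach-suc (d + k) (go d)

  reach-step : ∀ k {x y} → reach k x ≡ true → step x y ≡ true → reach (suc k) y ≡ true
  reach-step k {x} {y} h q = ∨-true⁺ʳ {reach k y} (anyFin⁺ _ x (∧-true⁺ h q))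

  reach-suc⁻ : ∀ k {y} → reach (suc k) y ≡ true →
               reach k y ≡ true ⊎ ∃ λ x → reach k x ≡ true × step x y ≡ true
  reach-suc⁻ k {y} h with ∨-true⁻ {reach k y} h
  ... | inj₁ q = inj₁ q
  ... | inj₂ q = inj₂ (let (x , q′) = anyFin⁻ (λ x → reach k x ∧ step x y) q in x , ∧-true⁻ q′)

  reach-induction : (A : ℕ → Fin N → Set) → A 0 x0 → (∀ k y → A k y → A (suc k) y) →
                    (∀ k x y → A k x → step x y ≡ true → A (suc k) y) → ∀ k {y} → reach k y ≡ true → A k y
  reach-induction A base mono next zero h = subst (A 0) (sym (reach-start h)) base
  reach-induction A base mono next (suc k) {y} h with reach-suc⁻ k h
  ... | inj₁ q = mono k y (reach-induction A base mono next k q)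
  ... | inj₂ (x , q , st) = next k x y (reach-induction A base mono next k q) st

  Least : Fin N → ℕ → Set
  Least y k = reach k y ≡ true × (∀ j → j < k → reach j y ≡ false)

  least : ∀ k {y} → reach k y ≡ true → ∃ (Least y)
  least zero h = zero , h , λ j ()
  least (suc k) {y} h with reach k y in eq
  ... | true = least k eq
  ... | false = suc k , ∨-true⁺ʳ {reach k y} {anyFin (λ x → reach k x ∧ step x y)} h
              , λ j j<k → not-true (λ q → true≢false (reach-mono (ℕ.≤-pred j<k) q) eq)

  least-≤ : ∀ {y k j} → Least y k → reach j y ≡ true → k ≤ j
  least-≤ {k = k} {j} (_ , u) h with k ≤? j
  ... | yes p = p
  ... | no ¬p = ⊥-elim (true≢false h (u j (ℕ.≰⇒> ¬p)))

  least-unique : ∀ {y k j} → Least y k → Least y j → k ≡ j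
  least-unique p q = ℕ.≤-antisym (least-≤ p (proj₁ q)) (least-≤ q (proj₁ p))

  least-pred : ∀ {y k} → Least y (suc k) → ∃ λ x → Least x k × step x y ≡ true
  least-pred {y} {k} (h , u) with reach-suc⁻ k h
  ... | inj₁ q = ⊥-elim (true≢false q (u k (ℕ.n<1+n k)))
  ... | inj₂ (x , q , st) = x , (q , λ j j<k → not-true (λ q′ → true≢false (reach-step j q′ st) (u (suc j) (s≤s j<k)))) , st

  least-chain : ∀ {y k} d → Least y (d + k) → ∃ λ x → Least x k
  least-chain zero h = _ , h
  least-chain (suc d) h = least-chain d (proj₁ (proj₂ (least-pred h)))

  -- Pigeonhole: a shortest path to y has a vertex at each of the levels 0, ..., k, and vertices of
  -- different levels differ. Hence N rounds of the search suffice.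
  least-< : ∀ {y k} → Least y k → k < N
  least-< {y} {k} h = Fₚ.injective⇒≤ {f = proj₁ ∘ level} λ {i} {j} eq →
      Fₚ.toℕ-injective (least-unique (proj₂ (level i)) (subst (λ x → Least x (toℕ j)) (sym eq) (proj₂ (level j))))
    where
    level : (i : Fin (suc k)) → ∃ λ x → Least x (toℕ i)
    level i = least-chain (k ∸ toℕ i) (subst (Least y) (sym (ℕ.m∸n+n≡m (ℕ.≤-pred (Fₚ.toℕ<n i)))) h)

  dist-least : ∀ {y k} → Least y k → dist y ≡ k
  dist-least {y} {k} h = countᵇ-initial _ N k (ℕ.<⇒≤ (least-< h)) (λ j j<k → cong not (proj₂ h j j<k))
                           (λ j k≤j → cong not (reach-mono k≤j (proj₁ h)))

  reach⇒least : ∀ k {y} → reach k y ≡ true → Least y (dist y)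
  reach⇒least k {y} h = subst (Least y) (sym (dist-least (proj₂ (least k h)))) (proj₂ (least k h))

  reach⇒reach-N : ∀ k {y} → reach k y ≡ true → reach N y ≡ true
  reach⇒reach-N k h = reach-mono (ℕ.<⇒≤ (least-< (reach⇒least k h))) (proj₁ (reach⇒least k h))

-- Finite sums and Kronecker deltas

sum-zero : ∀ {n} (f : Fin n → ℕ) → (∀ i → f i ≡ 0) → sum f ≡ 0
sum-zero {zero} f h = refl
sum-zero {suc n} f h = cong₂ _+_ (h zero) (sum-zero (f ∘ suc) (h ∘ suc))

sum-single : ∀ {n} (f : Fin n → ℕ) y → (∀ x → ¬ x ≡ y → f x ≡ 0) → sum f ≡ f y
sum-single f zero h = trans (cong (f zero +_) (sum-zero (f ∘ suc) (λ i → h (suc i) (λ ())))) (ℕ.+-identityʳ _)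
sum-single f (suc y) h = trans (cong (_+ sum (f ∘ suc)) (h zero (λ ())))
  (sum-single (f ∘ suc) y (λ x ne → h (suc x) (ne ∘ Fₚ.suc-injective)))

δ : ∀ {n} → Fin n → Fin n → ℕ
δ x y = if ⌊ x ≟ y ⌋ then 1 else 0

δ-same : ∀ {n} {x y : Fin n} → x ≡ y → δ x y ≡ 1
δ-same h = if-true (⌊⌋-true h)

δ-distinct : ∀ {n} {x y : Fin n} → ¬ x ≡ y → δ x y ≡ 0
δ-distinct h = if-false (⌊⌋-false h)

-- Counting and polynomial evaluation

≡ᵇ-true : ∀ {m n} → m ≡ n → (m ≡ᵇ n) ≡ true
≡ᵇ-true {zero} refl = refl
≡ᵇ-true {suc m} refl = ≡ᵇ-true {m} refl

≡ᵇ-true⁻ : ∀ {m n} → (m ≡ᵇ n) ≡ true → m ≡ n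
≡ᵇ-true⁻ {m} {n} h = ℕ.≡ᵇ⇒≡ m n (subst Bool.T (sym h) tt)

countᵇ-sum : ∀ {n} (p : Fin n → Bool) → countᵇ p (allFin n) ≡ sum (λ i → if p i then 1 else 0)
countᵇ-sum {n} p = go n id
  where
  go : ∀ m (f : Fin m → Fin n) → countᵇ p (tabulate f) ≡ sum (λ i → if p (f i) then 1 else 0)
  go zero f = refl
  go (suc m) f with p (f zero)
  ... | true = cong suc (go m (f ∘ suc))
  ... | false = go m (f ∘ suc)

countᵇ-≤ : ∀ {A : Set} (p : A → Bool) xs → countᵇ p xs ≤ length xs
countᵇ-≤ p [] = z≤n
countᵇ-≤ p (x ∷ xs) with p x
... | true = s≤s (countᵇ-≤ p xs)
... | false = ℕ.≤-trans (countᵇ-≤ p xs) (ℕ.n≤1+n _)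

module _ {A : Set} (p : A → Bool) where
  -- The rank of `x` among the counted entries. It turns distinct elements of a given degree into
  -- distinct elements of `Fin` of a coefficient, which bounds coefficients from below.
  countᵇ-index : ∀ {m} (f : Fin m → A) x → p (f x) ≡ true → Fin (countᵇ p (tabulate f))
  countᵇ-index f zero h with p (f zero)
  ... | true = zero
  countᵇ-index f (suc x) h with p (f zero)
  ... | true = suc (countᵇ-index (f ∘ suc) x h)
  ... | false = countᵇ-index (f ∘ suc) x h

  countᵇ-index-injective : ∀ {m} (f : Fin m → A) x y (hx : p (f x) ≡ true) (hy : p (f y) ≡ true) →
                           countᵇ-index f x hx ≡ countᵇ-index f y hy → x ≡ y
  countᵇ-index-injective f zero zero hx hy eq = refl
  countᵇ-index-injective f zero (suc y) hx hy eq with p (f zero)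
  countᵇ-index-injective f zero (suc y) hx hy () | true
  countᵇ-index-injective f (suc x) zero hx hy eq with p (f zero)
  countᵇ-index-injective f (suc x) zero hx hy () | true
  countᵇ-index-injective f (suc x) (suc y) hx hy eq with p (f zero)
  ... | true = cong suc (countᵇ-index-injective (f ∘ suc) x y hx hy (Fₚ.suc-injective eq))
  ... | false = cong suc (countᵇ-index-injective (f ∘ suc) x y hx hy eq)

sum-mono : ∀ {n} (f g : Fin n → ℕ) → (∀ i → f i ≤ g i) → sum f ≤ sum g
sum-mono {zero} f g h = z≤n
sum-mono {suc n} f g h = ℕ.+-mono-≤ (h zero) (sum-mono (f ∘ suc) (g ∘ suc) (h ∘ suc))

sum-one : ∀ n → sum {n} (λ _ → 1) ≡ n
sum-one zero = refl
sum-one (suc n) = cong suc (sum-one n)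

term≤sum : ∀ {n} (f : Fin n → ℕ) i → f i ≤ sum f
term≤sum f zero = ℕ.m≤m+n _ _
term≤sum f (suc i) = ℕ.≤-trans (term≤sum (f ∘ suc) i) (ℕ.m≤n+m _ _)

countᵇ-image-≤ : ∀ {n m} (p : Fin n → Bool) (f : Fin m → Fin n) → (∀ y → p y ≡ true → ∃ λ i → y ≡ f i) →
                 countᵇ p (allFin n) ≤ m
countᵇ-image-≤ {n} {m} p f h = begin
  countᵇ p (allFin n) ≡⟨ countᵇ-sum p ⟩
  sum (λ y → if p y then 1 else 0)
    ≤⟨ sum-mono (λ y → if p y then 1 else 0) (λ y → sum (λ i → δ (f i) y)) (λ y → bound y (p y) refl) ⟩
  sum (λ y → sum (λ i → δ (f i) y)) ≡⟨ ∑-comm (λ y i → δ (f i) y) ⟩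
  sum (λ i → sum (λ y → δ (f i) y))
    ≡⟨ sum-cong-≗ (λ i → trans (sum-single (δ (f i)) (f i) (λ y ne → δ-distinct (ne ∘ sym))) (δ-same {x = f i} refl)) ⟩
  sum {m} (λ _ → 1) ≡⟨ sum-one m ⟩
  m ∎
  where
  open ℕ.≤-Reasoning
  bound : ∀ y b → p y ≡ b → (if p y then 1 else 0) ≤ sum (λ i → δ (f i) y)
  bound y false q = subst (λ b → (if b then 1 else 0) ≤ sum (λ i → δ (f i) y)) (sym q) z≤n
  bound y true q = let (i , y≡) = h y q in subst (λ b → (if b then 1 else 0) ≤ sum (λ i → δ (f i) y)) (sym q)
    (ℕ.≤-trans (ℕ.≤-reflexive (sym (δ-same (sym y≡)))) (term≤sum (λ i → δ (f i) y) i))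

sumUpTo-cong : ∀ n {f g : ℕ → ℕ} → (∀ k → k ≤ n → f k ≡ g k) → sumUpTo n f ≡ sumUpTo n g
sumUpTo-cong zero h = h 0 z≤n
sumUpTo-cong (suc n) h = cong₂ _+_ (sumUpTo-cong n (λ k k≤n → h k (ℕ.m≤n⇒m≤1+n k≤n))) (h (suc n) ℕ.≤-refl)

sumUpTo-tail : ∀ D n (f : ℕ → ℕ) → D ≤ n → (∀ k → D < k → f k ≡ 0) → sumUpTo n f ≡ sumUpTo D f
sumUpTo-tail D n f D≤n h = trans (cong (λ m → sumUpTo m f) (sym (ℕ.m∸n+n≡m D≤n))) (go (n ∸ D))
  where
  go : ∀ d → sumUpTo (d + D) f ≡ sumUpTo D f
  go zero = refl
  go (suc d) = trans (cong₂ _+_ (go d) (h (suc (d + D)) (s≤s (ℕ.m≤n+m D d)))) (ℕ.+-identityʳ _)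

sumUpTo-+ : ∀ n (f g : ℕ → ℕ) → sumUpTo n (λ k → f k + g k) ≡ sumUpTo n f + sumUpTo n g
sumUpTo-+ zero f g = refl
sumUpTo-+ (suc n) f g = trans (cong (_+ (f (suc n) + g (suc n))) (sumUpTo-+ n f g))
    (solve 4 (λ a b c d → (a :+ b) :+ (c :+ d) := (a :+ c) :+ (b :+ d)) refl (sumUpTo n f) (sumUpTo n g) (f (suc n)) (g (suc n)))

sumUpTo-*ˡ : ∀ n c (f : ℕ → ℕ) → sumUpTo n (λ k → c * f k) ≡ c * sumUpTo n f
sumUpTo-*ˡ zero c f = refl
sumUpTo-*ˡ (suc n) c f = trans (cong (_+ c * f (suc n)) (sumUpTo-*ˡ n c f)) (sym (ℕ.*-distribˡ-+ c _ _))

sumUpTo-*ʳ : ∀ n c (f : ℕ → ℕ) → sumUpTo n (λ k → f k * c) ≡ sumUpTo n f * c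
sumUpTo-*ʳ n c f = trans (sumUpTo-cong n (λ k _ → ℕ.*-comm (f k) c)) (trans (sumUpTo-*ˡ n c f) (ℕ.*-comm c _))

sumUpTo-zero : ∀ n (f : ℕ → ℕ) → (∀ k → k ≤ n → f k ≡ 0) → sumUpTo n f ≡ 0
sumUpTo-zero zero f h = h 0 z≤n
sumUpTo-zero (suc n) f h = cong₂ _+_ (sumUpTo-zero n f (λ k k≤n → h k (ℕ.m≤n⇒m≤1+n k≤n))) (h (suc n) ℕ.≤-refl)

sumUpTo-single : ∀ n d (f : ℕ → ℕ) → d ≤ n → (∀ k → ¬ k ≡ d → f k ≡ 0) → sumUpTo n f ≡ f d
sumUpTo-single n zero f _ h = sumUpTo-tail 0 n f z≤n (λ k 0<k → h k (λ k≡0 → ℕ.<⇒≢ 0<k (sym k≡0)))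
sumUpTo-single n (suc d) f d<n h = trans (sumUpTo-tail (suc d) n f d<n (λ k d<k → h k (λ k≡ → ℕ.<⇒≢ d<k (sym k≡))))
  (cong (_+ f (suc d)) (sumUpTo-zero d f (λ k k≤d → h k (λ k≡ → ℕ.<⇒≢ (s≤s k≤d) k≡))))

sumUpTo-sum : ∀ n {m} (a : Fin m → ℕ → ℕ) → sumUpTo n (λ k → sum (λ y → a y k)) ≡ sum (λ y → sumUpTo n (a y))
sumUpTo-sum zero a = refl
sumUpTo-sum (suc n) a = trans (cong (_+ sum (λ y → a y (suc n))) (sumUpTo-sum n a))
  (sym (∑-distrib-+ (λ y → sumUpTo n (a y)) (λ y → a y (suc n))))

term≤sumUpTo : ∀ n (f : ℕ → ℕ) k → k ≤ n → f k ≤ sumUpTo n f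
term≤sumUpTo zero f zero z≤n = ℕ.≤-refl
term≤sumUpTo (suc n) f k k≤n with k ℕ.≟ suc n
... | yes refl = ℕ.m≤n+m _ _
... | no ne = ℕ.≤-trans (term≤sumUpTo n f k (ℕ.≤-pred (ℕ.≤∧≢⇒< k≤n ne))) (ℕ.m≤m+n _ _)

-- A `Poly` is an unbounded coefficient sequence, so evaluation carries a degree bound `D`; the
-- value is meaningful when the coefficients beyond `D` vanish.
eval : ℕ → Poly → ℕ → ℕ
eval D p t = sumUpTo D (λ k → p k * t ^ k)

-- Both sides sum f i j over the pairs with i + j ≤ n, grouped by i + j on the left and by i on the
-- right.
triangular-sum : ∀ n (f : ℕ → ℕ → ℕ) →
  sumUpTo n (λ k → sumUpTo k (λ i → f i (k ∸ i))) ≡ sumUpTo n (λ i → sumUpTo (n ∸ i) (f i))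
triangular-sum zero f = refl
triangular-sum (suc n) f = begin
  sumUpTo n (λ k → sumUpTo k (λ i → f i (k ∸ i))) + (sumUpTo n (λ i → f i (suc n ∸ i)) + f (suc n) (n ∸ n))
    ≡⟨ cong (_+ (sumUpTo n (λ i → f i (suc n ∸ i)) + f (suc n) (n ∸ n))) (triangular-sum n f) ⟩
  sumUpTo n (λ i → sumUpTo (n ∸ i) (f i)) + (sumUpTo n (λ i → f i (suc n ∸ i)) + f (suc n) (n ∸ n))
    ≡⟨ sym (ℕ.+-assoc (sumUpTo n (λ i → sumUpTo (n ∸ i) (f i))) (sumUpTo n (λ i → f i (suc n ∸ i))) (f (suc n) (n ∸ n))) ⟩
  sumUpTo n (λ i → sumUpTo (n ∸ i) (f i)) + sumUpTo n (λ i → f i (suc n ∸ i)) + f (suc n) (n ∸ n)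
    ≡⟨ cong₂ _+_ (trans (sym (sumUpTo-+ n (λ i → sumUpTo (n ∸ i) (f i)) (λ i → f i (suc n ∸ i))))
         (sumUpTo-cong n (λ i i≤n → row i (ℕ.+-∸-assoc 1 i≤n)))) last ⟩
  sumUpTo n (λ i → sumUpTo (suc n ∸ i) (f i)) + sumUpTo (n ∸ n) (f (suc n)) ∎
  where
  open ≡-Reasoning
  row : ∀ i → suc n ∸ i ≡ suc (n ∸ i) → sumUpTo (n ∸ i) (f i) + f i (suc n ∸ i) ≡ sumUpTo (suc n ∸ i) (f i)
  row i h = trans (cong (λ m → sumUpTo (n ∸ i) (f i) + f i m) h) (cong (λ m → sumUpTo m (f i)) (sym h))
  last : f (suc n) (n ∸ n) ≡ sumUpTo (n ∸ n) (f (suc n))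
  last = trans (cong (f (suc n)) (ℕ.n∸n≡0 n)) (cong (λ m → sumUpTo m (f (suc n))) (sym (ℕ.n∸n≡0 n)))

eval-⊛ : ∀ D (p q : Poly) t → (∀ k → D < k → p k ≡ 0) → (∀ k → D < k → q k ≡ 0) →
         eval (D + D) (p ⊛ q) t ≡ eval D p t * eval D q t
eval-⊛ D p q t hp hq = begin
  sumUpTo (D + D) (λ k → sumUpTo k (λ i → p i * q (k ∸ i)) * t ^ k)
    ≡⟨ sumUpTo-cong (D + D) (λ k _ → trans (sym (sumUpTo-*ʳ k (t ^ k) (λ i → p i * q (k ∸ i))))
         (sumUpTo-cong k (λ i i≤k → split i k i≤k))) ⟩
  sumUpTo (D + D) (λ k → sumUpTo k (λ i → (p i * t ^ i) * (q (k ∸ i) * t ^ (k ∸ i))))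
    ≡⟨ triangular-sum (D + D) (λ i j → (p i * t ^ i) * (q j * t ^ j)) ⟩
  sumUpTo (D + D) (λ i → sumUpTo (D + D ∸ i) (λ j → (p i * t ^ i) * (q j * t ^ j)))
    ≡⟨ sumUpTo-cong (D + D) (λ i _ → trans (sumUpTo-*ˡ (D + D ∸ i) (p i * t ^ i) (λ j → q j * t ^ j)) (complete i)) ⟩
  sumUpTo (D + D) (λ i → (p i * t ^ i) * eval D q t) ≡⟨ sumUpTo-*ʳ (D + D) (eval D q t) (λ i → p i * t ^ i) ⟩
  sumUpTo (D + D) (λ i → p i * t ^ i) * eval D q t
    ≡⟨ cong (_* eval D q t) (sumUpTo-tail D (D + D) _ (ℕ.m≤m+n D D) (λ k D<k → cong (_* t ^ k) (hp k D<k))) ⟩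
  eval D p t * eval D q t ∎
  where
  open ≡-Reasoning
  split : ∀ i k → i ≤ k → (p i * q (k ∸ i)) * t ^ k ≡ (p i * t ^ i) * (q (k ∸ i) * t ^ (k ∸ i))
  split i k i≤k = trans (cong ((p i * q (k ∸ i)) *_) (trans (cong (t ^_) (sym (ℕ.m+[n∸m]≡n i≤k))) (ℕ.^-distribˡ-+-* t i (k ∸ i))))
      (solve 4 (λ a b c d → (a :* b) :* (c :* d) := (a :* c) :* (b :* d)) refl (p i) (q (k ∸ i)) (t ^ i) (t ^ (k ∸ i)))
  -- For i ≤ D the truncated inner sum still reaches degree D and so contains all of q; for larger i
  -- the factor `p i` is zero.
  complete : ∀ i → (p i * t ^ i) * sumUpTo (D + D ∸ i) (λ j → q j * t ^ j) ≡ (p i * t ^ i) * eval D q t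
  complete i with i ≤? D
  ... | yes i≤D = cong ((p i * t ^ i) *_) (sumUpTo-tail D (D + D ∸ i) _
          (ℕ.≤-trans (ℕ.m≤n+m D (D ∸ i)) (ℕ.≤-reflexive (trans (ℕ.+-comm (D ∸ i) D) (sym (ℕ.+-∸-assoc D i≤D)))))
          (λ k D<k → cong (_* t ^ k) (hq k D<k)))
  ... | no i≰D = trans (cong (λ z → (z * t ^ i) * sumUpTo (D + D ∸ i) (λ j → q j * t ^ j)) pi)
          (sym (cong (λ z → (z * t ^ i) * eval D q t) pi))
    where pi = hp i (ℕ.≰⇒> i≰D)

eval-< : ∀ n (p : Poly) t → (∀ k → k ≤ n → p k < t) → eval n p t < t ^ suc n
eval-< zero p t h = subst₂ _<_ (sym (ℕ.*-identityʳ _)) (sym (ℕ.*-identityʳ _)) (h 0 z≤n)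
eval-< (suc n) p t h = ℕ.<-≤-trans (ℕ.+-monoˡ-< (p (suc n) * t ^ suc n) (eval-< n p t (λ k k≤n → h k (ℕ.m≤n⇒m≤1+n k≤n))))
  (ℕ.*-monoˡ-≤ (t ^ suc n) (h (suc n) ℕ.≤-refl))

leading-digit : ∀ {a a′ r r′ m} → r < m → r′ < m → r + a * m ≡ r′ + a′ * m → a ≡ a′
leading-digit {a} {a′} {r} {r′} {m} r<m r′<m h = ℕ.≤-antisym (ℕ.≮⇒≥ (below r<m r′<m h)) (ℕ.≮⇒≥ (below r′<m r<m (sym h)))
  where
  below : ∀ {a a′ r r′} → r < m → r′ < m → r + a * m ≡ r′ + a′ * m → ¬ a′ < a
  below {a} {a′} {r} {r′} _ r′<m h a′<a = ℕ.<-irrefl (sym h) (ℕ.<-≤-trans (ℕ.+-monoˡ-< (a′ * m) r′<m)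
    (ℕ.≤-trans (ℕ.*-monoˡ-≤ m a′<a) (ℕ.m≤n+m (a * m) r)))

-- Coefficients smaller than t are digits in base t, and digits are determined by the number,
-- starting from the leading one.
eval-injective : ∀ n (p q : Poly) t → (∀ k → k ≤ n → p k < t) → (∀ k → k ≤ n → q k < t) → eval n p t ≡ eval n q t →
                 ∀ k → k ≤ n → p k ≡ q k
eval-injective zero p q t hp hq h zero z≤n = trans (sym (ℕ.*-identityʳ _)) (trans h (ℕ.*-identityʳ _))
eval-injective (suc n) p q t hp hq h k k≤n = by (k ℕ.≟ suc n)
  where
  weaken : ∀ {P : ℕ → Set} → (∀ k → k ≤ suc n → P k) → ∀ k → k ≤ n → P k
  weaken f k k≤n = f k (ℕ.m≤n⇒m≤1+n k≤n)
  top : p (suc n) ≡ q (suc n)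
  top = leading-digit (eval-< n p t (weaken hp)) (eval-< n q t (weaken hq)) h
  by : Dec (k ≡ suc n) → p k ≡ q k
  by (yes refl) = top
  by (no ne) = eval-injective n p q t (weaken hp) (weaken hq)
    (ℕ.+-cancelʳ-≡ (p (suc n) * t ^ suc n) _ _ (trans h (cong (λ z → eval n q t + z * t ^ suc n) (sym top))))
    k (ℕ.≤-pred (ℕ.≤∧≢⇒< k≤n ne))

module DistPolynomial {N : ℕ} (step : Fin N → Fin N → Bool) (x0 : Fin N) where
  open Dist step x0

  dist-≤N : ∀ y → dist y ≤ N
  dist-≤N y = subst (dist y ≤_) (Lₚ.length-upTo N) (countᵇ-≤ (λ k → not (reach k y)) (upTo N))

  poin-vanishes : ∀ P k → N < k → poin P k ≡ 0
  poin-vanishes P k N<k = trans (countᵇ-sum (λ y → P y ∧ (dist y ≡ᵇ k))) (sum-zero _ (λ y →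
    if-false (not-true (λ h → ℕ.<⇒≢ (ℕ.≤-<-trans (dist-≤N y) N<k) (≡ᵇ-true⁻ (proj₂ (∧-true⁻ {P y} h)))))))

  eval-poin : ∀ P t → eval N (poin P) t ≡ sum (λ y → if P y then t ^ dist y else 0)
  eval-poin P t = begin
    sumUpTo N (λ k → poin P k * t ^ k)
      ≡⟨ sumUpTo-cong N (λ k _ → trans (cong (_* t ^ k) (countᵇ-sum (λ y → P y ∧ (dist y ≡ᵇ k))))
           (*-distribʳ-sum (t ^ k) (λ y → if P y ∧ (dist y ≡ᵇ k) then 1 else 0))) ⟩
    sumUpTo N (λ k → sum (λ y → (if P y ∧ (dist y ≡ᵇ k) then 1 else 0) * t ^ k))
      ≡⟨ sumUpTo-sum N (λ y k → (if P y ∧ (dist y ≡ᵇ k) then 1 else 0) * t ^ k) ⟩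
    sum (λ y → sumUpTo N (λ k → (if P y ∧ (dist y ≡ᵇ k) then 1 else 0) * t ^ k))
      ≡⟨ sum-cong-≗ (λ y → column y (P y) (dist y) (dist-≤N y)) ⟩
    sum (λ y → if P y then t ^ dist y else 0) ∎
    where
    open ≡-Reasoning
    column : ∀ y b d → d ≤ N → sumUpTo N (λ k → (if b ∧ (d ≡ᵇ k) then 1 else 0) * t ^ k) ≡ (if b then t ^ d else 0)
    column y false d _ = sumUpTo-zero N _ (λ _ _ → refl)
    column y true d d≤N = trans (sumUpTo-single N d _ d≤N (λ k ne →
        cong (λ b → (if b then 1 else 0) * t ^ k) (not-true (λ h → ne (sym (≡ᵇ-true⁻ h))))))
      (trans (cong (λ b → (if b then 1 else 0) * t ^ d) (≡ᵇ-true {d} refl)) (ℕ.+-identityʳ _))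

-- Length, exchange and descents in W

module Twisted (C : CoxeterSystem) (θ : Fin (CoxeterSystem.N C) → Fin (CoxeterSystem.N C))
               (aut : IsInvolutiveAut C θ) where
  open ≡-Reasoning
  open CoxeterSystem C public
  open GroupSolver W public
  open Cocycle C public using (η; η-·; η-s; sᴵ; rotation-inverse)
  open IsInvolutiveAut aut public renaming (injective to θ-injective)

  private
    module DW = DistProperties (stepW C θ) e
    reachW = Dist.reach (stepW C θ) e

  word-induction : (A : Fin N → Set) → A e → (∀ i x → A x → A (s i · x)) → ∀ w → A w
  word-induction A base step w = subst A (sym (proj₂ (generates w))) (go (proj₁ (generates w)))
    where
    go : ∀ ws → A (foldr (λ i x → s i · x) e ws)
    go [] = base
    go (i ∷ ws) = step i _ (go ws)

  inv-s : ∀ i → inv (s i) ≡ s i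
  inv-s i = inv-unique (s-invol i)

  abstract
    -- An opaque copy of `ℓ`: later arguments use only the properties proved in this block, and
    -- `len≡` leads back to the definition.
    len : Fin N → ℕ
    len = ℓ C θ

    len≡ : ∀ w → len w ≡ ℓ C θ w
    len≡ w = refl

    stepW⁺ : ∀ x i → stepW C θ x (x · s i) ≡ true
    stepW⁺ x i = anyFin⁺ (λ j → ⌊ x · s i ≟ x · s j ⌋) i (⌊⌋-true refl)

    -- Words in `generates` grow on the left while `stepW` multiplies on the right, so the induction
    -- runs over the inverse.
    all-reachable : ∀ w → ∃ λ k → reachW k w ≡ true
    all-reachable w = subst (λ z → ∃ λ k → reachW k z ≡ true) (inv-inv w)
      (word-induction (λ z → ∃ λ k → reachW k (inv z) ≡ true)
        (0 , ⌊⌋-true inv-e)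
        (λ i x (k , h) → suc k , DW.reach-step k {inv x} {inv (s i · x)} h
          (subst (λ z → stepW C θ (inv x) z ≡ true) (trans (cong (inv x ·_) (sym (inv-s i))) (sym (inv-· (s i) x)))
            (stepW⁺ (inv x) i)))
        (inv w))

    len-least : ∀ w → DW.Least w (len w)
    len-least w = DW.reach⇒least (proj₁ (all-reachable w)) (proj₂ (all-reachable w))

    len-e : len e ≡ 0
    len-e = DW.dist-least {e} {0} (⌊⌋-true refl , λ j ())

    len-0 : ∀ {w} → len w ≡ 0 → w ≡ e
    len-0 {w} h = DW.reach-start {w} (subst (λ k → reachW k w ≡ true) h (proj₁ (len-least w)))

    len-·s : ∀ w i → len (w · s i) ≤ suc (len w)
    len-·s w i = DW.least-≤ {w · s i} {len (w · s i)} {suc (len w)} (len-least (w · s i)) (DW.reach-step (len w) {w} {w · s i} (proj₁ (len-least w)) (stepW⁺ w i))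

    len-pred : ∀ w {k} → len w ≡ suc k → ∃ λ i → ∃ λ y → w ≡ y · s i × len y ≡ k
    len-pred w {k} h =
      let (y , ly , st) = DW.least-pred {w} {k} (subst (DW.Least w) h (len-least w))
          (i , q) = anyFin⁻ (λ i → ⌊ w ≟ y · s i ⌋) st
      in i , y , ⌊⌋-true⁻ q , DW.dist-least {y} {k} ly

    len-<N : ∀ w → len w < N
    len-<N w = DW.least-< {w} {len w} (len-least w)

  η-e : ∀ t → η e t ≡ false
  η-e t = xor-cancelˡ (trans (cong (λ z → η z t) (sym (identityˡ e)))
    (trans (η-· e e t) (cong (λ z → η e z xor η e t) (grp (t ∷ []) [] (ε ∙ X ∙ ε ⁻¹) X refl))))

  xor-false : ∀ {a b} → a xor b ≡ false → a ≡ b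
  xor-false {true}  {true}  _ = refl
  xor-false {false} {false} _ = refl

  η-inv : ∀ a t → η (inv a) (a · t · inv a) ≡ η a t
  η-inv a t = xor-false (trans (sym (η-· (inv a) a t)) (trans (cong (λ z → η z t) (inverseˡ a)) (η-e t)))

  η-·s : ∀ w i t → η (w · s i) t ≡ η w (s i · t · s i) xor ⌊ t ≟ s i ⌋
  η-·s w i t = trans (η-· w (s i) t) (cong₂ (λ z b → η w (s i · t · z) xor b) (inv-s i) (η-s i t))

  η-·s-self : ∀ w i → η (w · s i) (s i) ≡ not (η w (s i))
  η-·s-self w i = trans (η-·s w i (s i)) (trans (cong₂ _xor_ (cong (η w)
    (grp [] (sᴵ i ∷ []) (P ∙ P ∙ P) P refl)) (⌊⌋-true refl)) (trans (Bₚ.xor-comm (η w (s i)) true) refl))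

  η-s· : ∀ i w t → η (s i · w) t ≡ ⌊ w · t · inv w ≟ s i ⌋ xor η w t
  η-s· i w t = trans (η-· (s i) w t) (cong (_xor η w t) (η-s i _))

  -- Every reflection is an inversion of itself: the contributions of `a` and `inv a` cancel, and
  -- the middle letter contributes once.
  η-conj-self : ∀ a i → η (a · s i · inv a) (a · s i · inv a) ≡ true
  η-conj-self a i = begin
    η (a · s i · inv a) t ≡⟨ η-· (a · s i) (inv a) t ⟩
    η (a · s i) (inv a · t · inv (inv a)) xor η (inv a) t
      ≡⟨ cong₂ _xor_ (cong (η (a · s i)) (grp (a ∷ s i ∷ []) [] (X ⁻¹ ∙ (X ∙ Y ∙ X ⁻¹) ∙ X ⁻¹ ⁻¹) Y refl)) (η-inv a (s i)) ⟩
    η (a · s i) (s i) xor η a (s i) ≡⟨ cong (_xor η a (s i)) (η-·s-self a i) ⟩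
    not (η a (s i)) xor η a (s i) ≡⟨ Bₚ.xor-inverseˡ (η a (s i)) ⟩
    true ∎
    where
    t = a · s i · inv a

  -- Strong exchange, by induction along a shortest word. If t is the last letter, it is deleted.
  -- Otherwise t is moved across the last letter, where its conjugate is an inversion of the shorter
  -- word.
  exchange : ∀ w t → η w t ≡ true → len (w · t) < len w
  exchange w t h = go (len w) w t refl h
    where
    go : ∀ k w t → len w ≡ k → η w t ≡ true → len (w · t) < k
    go zero w t lw h = ⊥-elim (true≢false h (trans (cong (λ z → η z t) (len-0 lw)) (η-e t)))
    go (suc k) w t lw h with len-pred w lw
    ... | i , y , refl , ly with t ≟ s i
    ... | yes refl = subst (_< suc k) (sym (trans (cong len (grp (y ∷ []) (sᴵ i ∷ []) (X ∙ P ∙ P) X refl)) ly)) (ℕ.n<1+n k)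
    ... | no t≢s = s≤s (ℕ.≤-trans (subst (λ z → len z ≤ suc (len (y · (s i · t · s i))))
            (grp (y ∷ t ∷ []) (sᴵ i ∷ []) (X ∙ (P ∙ Y ∙ P) ∙ P) (X ∙ P ∙ Y) refl) (len-·s (y · (s i · t · s i)) i))
          (go k y (s i · t · s i) ly
            (trans (sym (trans (η-·s y i t) (trans (cong (η y (s i · t · s i) xor_) (⌊⌋-false t≢s)) (Bₚ.xor-identityʳ _)))) h)))

  len-s-self : ∀ w i → w · s i · s i ≡ w
  len-s-self w i = grp (w ∷ []) (sᴵ i ∷ []) (X ∙ P ∙ P) X refl

  descent : ∀ w i → η w (s i) ≡ true → len w ≡ suc (len (w · s i))
  descent w i h = ℕ.≤-antisym (subst (λ z → len z ≤ suc (len (w · s i))) (len-s-self w i) (len-·s (w · s i) i)) (exchange w (s i) h)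

  ascent : ∀ w i → η w (s i) ≡ false → len (w · s i) ≡ suc (len w)
  ascent w i h = ℕ.≤-antisym (len-·s w i)
    (subst (λ z → len z < len (w · s i)) (len-s-self w i) (exchange (w · s i) (s i) (trans (η-·s-self w i) (cong not h))))

  has-descent : ∀ w → ¬ w ≡ e → ∃ λ i → η w (s i) ≡ true
  has-descent w w≢e with len w in eq
  ... | zero = ⊥-elim (w≢e (len-0 eq))
  ... | suc k with len-pred w eq
  ... | i , y , refl , ly = i , not-false (λ h → ℕ.<⇒≢ (s≤s (ℕ.n≤1+n k)) (sym (begin
    suc (suc k)               ≡⟨ cong suc (sym eq) ⟩
    suc (len (y · s i))       ≡⟨ sym (ascent (y · s i) i h) ⟩
    len (y · s i · s i)       ≡⟨ cong len (len-s-self y i) ⟩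
    len y                     ≡⟨ ly ⟩
    k                         ≡⟨⟩
    k ∎)))

  θ-e : θ e ≡ e
  θ-e = ·-cancelˡ (θ e) (trans (sym (hom e e)) (trans (cong θ (identityˡ e)) (sym (identityʳ _))))

  θ-inv : ∀ a → θ (inv a) ≡ inv (θ a)
  θ-inv a = sym (inv-unique (trans (sym (hom a (inv a))) (trans (cong θ (inverseʳ a)) θ-e)))

  θ-conj : ∀ a b → θ (a · b · inv a) ≡ θ a · θ b · inv (θ a)
  θ-conj a b = trans (hom _ _) (cong₂ _·_ (hom a b) (θ-inv a))

  θi : Fin r → Fin r
  θi i = proj₁ (S-into i)

  s-θi : ∀ i → s (θi i) ≡ θ (s i)
  s-θi i = sym (proj₂ (S-into i))

  θsᴵ : Fin r → Involution
  θsᴵ i = θ (s i) , trans (sym (hom (s i) (s i))) (trans (cong θ (s-invol i)) θ-e)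

  η-θ : ∀ a t → η (θ a) (θ t) ≡ η a t
  η-θ = word-induction (λ a → ∀ t → η (θ a) (θ t) ≡ η a t)
    (λ t → trans (cong (λ z → η z (θ t)) θ-e) (trans (η-e (θ t)) (sym (η-e t))))
    (λ i x ih t → begin
      η (θ (s i · x)) (θ t) ≡⟨ cong (λ z → η z (θ t)) (trans (hom (s i) x) (cong (_· θ x) (sym (s-θi i)))) ⟩
      η (s (θi i) · θ x) (θ t) ≡⟨ η-s· (θi i) (θ x) (θ t) ⟩
      ⌊ θ x · θ t · inv (θ x) ≟ s (θi i) ⌋ xor η (θ x) (θ t)
        ≡⟨ cong₂ _xor_ (⌊⌋-cong
             (λ h → θ-injective _ _ (trans (θ-conj x t) (trans h (s-θi i))))
             (λ h → trans (sym (θ-conj x t)) (trans (cong θ h) (sym (s-θi i))))) (ih t) ⟩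
      ⌊ x · t · inv x ≟ s i ⌋ xor η x t ≡⟨ sym (η-s· i x t) ⟩
      η (s i · x) t ∎)

  -- One induction that yields subadditivity of the length and its invariance under inversion and
  -- under θ, by taking for `g` a translation, `inv` or `θ`.
  len-bound : (g : Fin N → Fin N) → (∀ y i → len (g (y · s i)) ≤ suc (len (g y))) → ∀ w → len (g w) ≤ len (g e) + len w
  len-bound g h w = go (len w) w refl
    where
    go : ∀ k w → len w ≡ k → len (g w) ≤ len (g e) + k
    go zero w lw = ℕ.≤-reflexive (trans (cong (len ∘ g) (len-0 lw)) (sym (ℕ.+-identityʳ _)))
    go (suc k) w lw with len-pred w lw
    ... | i , y , refl , ly = ℕ.≤-trans (h y i) (subst (suc (len (g y)) ≤_) (sym (ℕ.+-suc (len (g e)) k)) (s≤s (go k y ly)))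

  len-s : ∀ i → len (s i) ≤ 1
  len-s i = subst₂ (λ a b → len a ≤ suc b) (identityˡ (s i)) len-e (len-·s e i)

  len-· : ∀ v w → len (v · w) ≤ len v + len w
  len-· v w = subst (λ z → len (v · w) ≤ len z + len w) (identityʳ v)
    (len-bound (v ·_) (λ y i → subst (λ z → len z ≤ suc (len (v · y))) (assoc _ _ _) (len-·s (v · y) i)) w)

  len-s· : ∀ i w → len (s i · w) ≤ suc (len w)
  len-s· i w = ℕ.≤-trans (len-· (s i) w) (ℕ.+-monoˡ-≤ (len w) (len-s i))

  len-inv-≤ : ∀ w → len (inv w) ≤ len w
  len-inv-≤ w = subst (λ n → len (inv w) ≤ n + len w) (trans (cong len inv-e) len-e)
    (len-bound inv (λ y i → subst (λ z → len z ≤ suc (len (inv y))) (sym (trans (inv-· y (s i)) (cong (_· inv y) (inv-s i)))) (len-s· i (inv y))) w)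

  len-inv : ∀ w → len (inv w) ≡ len w
  len-inv w = ℕ.≤-antisym (len-inv-≤ w) (subst (λ z → len z ≤ len (inv w)) (inv-inv w) (len-inv-≤ (inv w)))

  len-θ-≤ : ∀ w → len (θ w) ≤ len w
  len-θ-≤ w = subst (λ n → len (θ w) ≤ n + len w) (trans (cong len θ-e) len-e)
    (len-bound θ (λ y i → subst (λ z → len z ≤ suc (len (θ y))) (sym (trans (hom y (s i)) (cong (θ y ·_) (sym (s-θi i))))) (len-·s (θ y) (θi i))) w)

  len-θ : ∀ w → len (θ w) ≡ len w
  len-θ w = ℕ.≤-antisym (len-θ-≤ w) (subst (λ z → len z ≤ len (θ w)) (involutive w) (len-θ-≤ (θ w)))

  inv-s· : ∀ k w → inv (s k · w) ≡ inv w · s k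
  inv-s· k w = trans (inv-· (s k) w) (cong (inv w ·_) (inv-s k))

  ascentˡ : ∀ k w → η (inv w) (s k) ≡ false → len (s k · w) ≡ suc (len w)
  ascentˡ k w h = trans (sym (len-inv (s k · w))) (trans (cong len (inv-s· k w)) (trans (ascent (inv w) k h) (cong suc (len-inv w))))

  descentˡ : ∀ k w → η (inv w) (s k) ≡ true → len w ≡ suc (len (s k · w))
  descentˡ k w h = trans (sym (len-inv w)) (trans (descent (inv w) k h) (cong suc (trans (cong len (sym (inv-s· k w))) (len-inv (s k · w)))))

  module _ (x : Fin N) (k i : Fin r) (bal : η (inv x) (s k) ≡ η x (s i)) (ne : ¬ s k · x ≡ x · s i) where
    private
      -- As `s k · x` differs from `x · s i`, multiplying by `s i` on the right does not change
      -- whether `s k` is a left descent. The effects of the two multiplications on the length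
      -- therefore add up to two.
      balanced : η (inv (x · s i)) (s k) ≡ η x (s i)
      balanced = trans (cong (λ z → η z (s k)) (trans (inv-· x (s i)) (cong (_· inv x) (inv-s i))))
        (trans (η-s· i (inv x) (s k)) (cong₂ _xor_ (⌊⌋-false (λ h → ne (trans
          (grp (x ∷ s k ∷ []) [] (Y ∙ X) (X ∙ (X ⁻¹ ∙ Y ∙ X ⁻¹ ⁻¹)) refl) (cong (x ·_) h)))) bal))

    two-sided-ascent : η x (s i) ≡ false → len (s k · x · s i) ≡ 2 + len x
    two-sided-ascent h = trans (cong len (assoc _ _ _))
      (trans (ascentˡ k (x · s i) (trans balanced h)) (cong suc (ascent x i h)))

    two-sided-descent : η x (s i) ≡ true → len x ≡ 2 + len (s k · x · s i)
    two-sided-descent h = trans (descent x i h)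
      (cong suc (trans (descentˡ k (x · s i) (trans balanced h)) (cong (suc ∘ len) (sym (assoc _ _ _)))))

  -- The twisted action of W on ι(θ)

  act : Fin N → Fin r → Fin N
  act x i = θ (s i) · x · s i

  ι : Fin N → Set
  ι x = ∃ λ w → x ≡ θ (inv w) · w

  ι-e : ι e
  ι-e = e , sym (trans (identityʳ _) (trans (cong θ inv-e) θ-e))

  ι-act : ∀ {x} i → ι x → ι (act x i)
  ι-act i (w , refl) = w · s i , trans
      (grp (θ (inv w) ∷ w ∷ []) (θsᴵ i ∷ sᴵ i ∷ []) (P ∙ (X ∙ Y) ∙ Q) ((P ∙ X) ∙ (Y ∙ Q)) refl)
      (cong (_· (w · s i)) (sym (trans (cong θ (trans (inv-· w (s i)) (cong (_· inv w) (inv-s i)))) (hom _ _))))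

  ι-twisted : ∀ {x} → ι x → θ x ≡ inv x
  ι-twisted (w , refl) = trans (hom _ _) (trans (cong (_· θ w) (involutive (inv w)))
    (trans (grp (w ∷ θ w ∷ []) [] (X ⁻¹ ∙ Y) ((Y ⁻¹ ∙ X) ⁻¹) refl) (cong (λ z → inv (z · w)) (sym (θ-inv w)))))

  -- Since θ(x) = x⁻¹, the left inversions of x are the θ-images of its right inversions, so
  -- `θ (s i)` on the left and `s i` on the right move the length in the same direction.
  ι-balanced : ∀ {x} i → ι x → η (inv x) (s (θi i)) ≡ η x (s i)
  ι-balanced {x} i ix = trans (cong₂ η (sym (ι-twisted ix)) (s-θi i)) (η-θ x (s i))

  -- Write x = θ(w⁻¹)w. If s fixes x, the reflection w s w⁻¹ is θ-fixed, so the factors θ(w⁻¹) and w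
  -- contribute equally and cancel. The condition θ(x) = x⁻¹ alone would be too weak: for trivial θ,
  -- the element x = s is fixed by s and has s as a descent.
  ι-fixed-ascent : ∀ {x} i → ι x → act x i ≡ x → η x (s i) ≡ false
  ι-fixed-ascent i (w , refl) h = begin
    η (θ (inv w) · w) (s i) ≡⟨ η-· (θ (inv w)) w (s i) ⟩
    η (θ (inv w)) t xor η w (s i)
      ≡⟨ cong (_xor η w (s i)) (trans (cong (η (θ (inv w))) (sym θt)) (trans (η-θ (inv w) t) (η-inv w (s i)))) ⟩
    η w (s i) xor η w (s i) ≡⟨ Bₚ.xor-same (η w (s i)) ⟩
    false ∎
    where
    t = w · s i · inv w
    θt : θ t ≡ t
    θt = trans (θ-conj w (s i)) (trans
      (grp (θ w ∷ w ∷ []) (θsᴵ i ∷ sᴵ i ∷ []) (X ∙ P ∙ X ⁻¹) (X ∙ (P ∙ (X ⁻¹ ∙ Y) ∙ Q) ∙ Q ∙ Y ⁻¹) refl)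
      (trans (cong (λ z → θ w · z · s i · inv w) (trans (cong (λ z → θ (s i) · (z · w) · s i) (sym (θ-inv w))) (trans h (cong (_· w) (θ-inv w)))))
        (grp (θ w ∷ w ∷ s i ∷ []) [] (X ∙ (X ⁻¹ ∙ Y) ∙ Z ∙ Y ⁻¹) (Y ∙ Z ∙ Y ⁻¹) refl)))

  act-act : ∀ x i → act (act x i) i ≡ x
  act-act x i = grp (x ∷ []) (θsᴵ i ∷ sᴵ i ∷ []) (P ∙ (P ∙ X ∙ Q) ∙ Q) X refl

  act-commutes⇒fixed : ∀ {x i} → s (θi i) · x ≡ x · s i → act x i ≡ x
  act-commutes⇒fixed {x} {i} h = trans (cong (λ z → z · x · s i) (sym (s-θi i))) (trans (cong (_· s i) h) (len-s-self x i))

  η-act : ∀ x i → ¬ act x i ≡ x → η (act x i) (s i) ≡ not (η x (s i))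
  η-act x i ne = trans (η-·s-self (θ (s i) · x) i) (cong not (trans (cong (λ z → η (z · x) (s i)) (sym (s-θi i)))
    (trans (η-s· (θi i) x (s i)) (cong (_xor η x (s i)) (⌊⌋-false (λ h → ne (act-commutes⇒fixed (trans (cong (_· x) (sym h))
      (grp (x ∷ s i ∷ []) [] (X ∙ Y ∙ X ⁻¹ ∙ X) (X ∙ Y) refl)))))))))

  act≡ : ∀ x i → act x i ≡ s (θi i) · x · s i
  act≡ x i = cong (λ z → z · x · s i) (sym (s-θi i))

  len-act-ascent : ∀ {x} i → ι x → ¬ act x i ≡ x → η x (s i) ≡ false → len (act x i) ≡ 2 + len x
  len-act-ascent {x} i ix ne h = trans (cong len (act≡ x i))
    (two-sided-ascent x (θi i) i (ι-balanced i ix) (ne ∘ act-commutes⇒fixed) h)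

  len-act-descent : ∀ {x} i → ι x → ¬ act x i ≡ x → η x (s i) ≡ true → len x ≡ 2 + len (act x i)
  len-act-descent {x} i ix ne h = trans (two-sided-descent x (θi i) i (ι-balanced i ix) (ne ∘ act-commutes⇒fixed) h)
    (cong (λ z → 2 + len z) (sym (act≡ x i)))

  -- Reflections fixed by θ

  Reflection : Fin N → Set
  Reflection t = ∃ λ w → ∃ λ i → t ≡ w · s i · inv w

  reflection-involutive : ∀ {t} → Reflection t → t · t ≡ e
  reflection-involutive (w , i , refl) = grp (w ∷ []) (sᴵ i ∷ []) ((X ∙ P ∙ X ⁻¹) ∙ (X ∙ P ∙ X ⁻¹)) ε refl

  reflection-conj : ∀ {t} a → Reflection t → Reflection (a · t · inv a)
  reflection-conj a (w , i , refl) = a · w , i , grp (a ∷ w ∷ []) (sᴵ i ∷ []) (X ∙ (Y ∙ P ∙ Y ⁻¹) ∙ X ⁻¹) ((X ∙ Y) ∙ P ∙ (X ∙ Y) ⁻¹) refl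

  reflection-conj-s : ∀ {t} i → Reflection t → Reflection (s i · t · s i)
  reflection-conj-s {t} i h = subst (λ z → Reflection (s i · t · z)) (inv-s i) (reflection-conj (s i) h)

  -- With t = w s_k w⁻¹ and a = w⁻¹ s_i w, commutation gives s_k a s_k = a. The contributions of w
  -- and w⁻¹ to `η t (s i)` then cancel, and what is left is the test a = s_k.
  commuting-descent : ∀ {t} i → Reflection t → η t (s i) ≡ true → t · s i ≡ s i · t → t ≡ s i
  commuting-descent i (w , k , refl) h comm = trans
      (cong (λ z → w · z · inv w) (sym (⌊⌋-true⁻ a≡c)))
      (grp (w ∷ s i ∷ []) [] (X ∙ (X ⁻¹ ∙ Y ∙ X) ∙ X ⁻¹) Y refl)
    where
    a = inv w · s i · w
    aᶜ : s k · a · s k ≡ a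
    aᶜ = trans (grp (w ∷ s i ∷ []) (sᴵ k ∷ []) (P ∙ (X ⁻¹ ∙ Y ∙ X) ∙ P) (X ⁻¹ ∙ ((X ∙ P ∙ X ⁻¹) ∙ Y) ∙ (X ∙ P)) refl)
      (trans (cong (λ z → inv w · z · (w · s k)) comm)
        (grp (w ∷ s i ∷ []) (sᴵ k ∷ []) (X ⁻¹ ∙ (Y ∙ (X ∙ P ∙ X ⁻¹)) ∙ (X ∙ P)) (X ⁻¹ ∙ Y ∙ X) refl))
    η-inverse-part : η (inv w) (s i) ≡ η w a
    η-inverse-part = trans (cong (η (inv w)) (grp (w ∷ s i ∷ []) [] Y (X ∙ (X ⁻¹ ∙ Y ∙ X) ∙ X ⁻¹) refl)) (η-inv w a)
    expand : η (w · s k · inv w) (s i) ≡ (η w a xor ⌊ a ≟ s k ⌋) xor η w a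
    expand = trans (η-· (w · s k) (inv w) (s i)) (cong₂ _xor_
      (trans (cong (η (w · s k)) (grp (w ∷ s i ∷ []) [] (X ⁻¹ ∙ Y ∙ X ⁻¹ ⁻¹) (X ⁻¹ ∙ Y ∙ X) refl))
        (trans (η-·s w k a) (cong (λ z → η w z xor ⌊ a ≟ s k ⌋) aᶜ))) η-inverse-part)
    xor-sandwich : ∀ p q → (p xor q) xor p ≡ q
    xor-sandwich true true = refl
    xor-sandwich true false = refl
    xor-sandwich false q = Bₚ.xor-identityʳ q
    a≡c : ⌊ a ≟ s k ⌋ ≡ true
    a≡c = trans (sym (xor-sandwich (η w a) _)) (trans (sym expand) h)

  -- An involution has the same left and right descents, so conjugation by `s k` changes its length
  -- by two unless the two elements commute.
  simple-conj-same-length : ∀ {τ} k → τ · τ ≡ e → len (s k · τ · s k) ≡ len τ → s k · τ · s k ≡ τ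
  simple-conj-same-length {τ} k ττ same with s k · τ ≟ τ · s k
  ... | yes p = trans (cong (_· s k) p) (len-s-self τ k)
  ... | no ¬p with η τ (s k) in eq
  ... | false = ⊥-elim (ℕ.m≢1+n+m (len τ) {1} (trans (sym same)
        (two-sided-ascent τ k k (cong (λ z → η z (s k)) (inv-unique ττ)) ¬p eq)))
  ... | true = ⊥-elim (ℕ.m≢1+n+m (len (s k · τ · s k)) {1} (trans same
        (two-sided-descent τ k k (cong (λ z → η z (s k)) (inv-unique ττ)) ¬p eq)))

  FixedSimpleConjugate : Fin N → Set
  FixedSimpleConjugate t = ∃ λ f → ∃ λ k → θ f ≡ f × θ (s k) ≡ s k × t ≡ f · s k · inv f

  -- Conjugating by f turns t into a θ-fixed simple reflection c; then θ τ and τ are conjugate under c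
  -- and have the same length, hence are equal.
  θ-conj-by-fixed : ∀ {t τ} → FixedSimpleConjugate t → τ · τ ≡ e → θ τ ≡ t · τ · t → θ τ ≡ τ
  θ-conj-by-fixed {_} {τ} (f , k , θf , θc , refl) ττ h = begin
    θ τ ≡⟨ h ⟩
    (f · s k · inv f) · τ · (f · s k · inv f)
      ≡⟨ grp (f ∷ τ ∷ []) (sᴵ k ∷ []) ((X ∙ P ∙ X ⁻¹) ∙ Y ∙ (X ∙ P ∙ X ⁻¹)) (X ∙ (P ∙ (X ⁻¹ ∙ Y ∙ X) ∙ P) ∙ X ⁻¹) refl ⟩
    f · (s k · τ′ · s k) · inv f
      ≡⟨ cong (λ z → f · z · inv f) (simple-conj-same-length k τ′τ′ (trans (cong len (sym θτ′)) (len-θ τ′))) ⟩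
    f · τ′ · inv f ≡⟨ grp (f ∷ τ ∷ []) [] (X ∙ (X ⁻¹ ∙ Y ∙ X) ∙ X ⁻¹) Y refl ⟩
    τ ∎
    where
    τ′ = inv f · τ · f
    τ′τ′ : τ′ · τ′ ≡ e
    τ′τ′ = grp (f ∷ []) ((τ , ττ) ∷ []) ((X ⁻¹ ∙ P ∙ X) ∙ (X ⁻¹ ∙ P ∙ X)) ε refl
    θτ′ : θ τ′ ≡ s k · τ′ · s k
    θτ′ = trans (hom _ _) (trans (cong₂ _·_ (trans (hom _ _) (cong₂ _·_ (trans (θ-inv f) (cong inv θf)) h)) θf)
      (grp (f ∷ τ ∷ []) (sᴵ k ∷ []) (X ⁻¹ ∙ ((X ∙ P ∙ X ⁻¹) ∙ Y ∙ (X ∙ P ∙ X ⁻¹)) ∙ X) (P ∙ (X ⁻¹ ∙ Y ∙ X) ∙ P) refl))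

  conjugate-back : ∀ {t} a b → a · a ≡ e → b · b ≡ e → θ (a · b) ≡ a · b → FixedSimpleConjugate (b · a · t · a · b) → FixedSimpleConjugate t
  conjugate-back {t} a b aa bb θab (f , k , θf , θc , h) = a · b · f , k , trans (hom _ _) (cong₂ _·_ θab θf) , θc , (begin
    t ≡⟨ grp (t ∷ []) ((a , aa) ∷ (b , bb) ∷ []) X ((P ∙ Q) ∙ (Q ∙ P ∙ X ∙ P ∙ Q) ∙ (Q ∙ P)) refl ⟩
    (a · b) · (b · a · t · a · b) · (b · a) ≡⟨ cong (λ z → a · b · z · (b · a)) h ⟩
    (a · b) · (f · s k · inv f) · (b · a)
      ≡⟨ grp (f ∷ []) ((a , aa) ∷ (b , bb) ∷ sᴵ k ∷ []) ((P ∙ Q) ∙ (X ∙ I 2F ∙ X ⁻¹) ∙ (Q ∙ P)) ((P ∙ Q ∙ X) ∙ I 2F ∙ (P ∙ Q ∙ X) ⁻¹) refl ⟩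
    (a · b · f) · s k · inv (a · b · f) ∎)

  reflection≢e : ∀ {t} → Reflection t → ¬ t ≡ e
  reflection≢e (w , i , refl) h = true≢false (η-conj-self w i) (trans (cong (λ z → η z t) h) (η-e t))
    where t = w · s i · inv w

  CommutesAt : Fin r → Set
  CommutesAt i = s i · θ (s i) ≡ θ (s i) · s i

  Commuting : Set
  Commuting = ∀ i → CommutesAt i

  module _ (commute : Commuting) where

    -- Conjugating by s or by s θ(s) shortens t.  The only obstruction is t θ(s) t = s, which is excluded by
    -- θ-conj-by-fixed for the shorter fixed reflection s t s.
    fixed-reflection : ∀ {t} → Reflection t → θ t ≡ t → FixedSimpleConjugate t
    fixed-reflection {t} = go t (<-wellFounded _)
      where
      go : ∀ t → Acc _<_ (len t) → Reflection t → θ t ≡ t → FixedSimpleConjugate t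
      go t (acc rec) R θt with has-descent t (reflection≢e R)
      ... | i , d with t ≟ s i
      ... | yes t≡s = e , i , θ-e , trans (cong θ (sym t≡s)) (trans θt t≡s)
                    , trans t≡s (grp [] (sᴵ i ∷ []) P (ε ∙ P ∙ ε ⁻¹) refl)
      ... | no t≢s = cases
        where
        a = s i
        b = θ (s i)
        aa = s-invol i
        bb = proj₂ (θsᴵ i)
        tt′ = reflection-involutive R
        t₁ = a · t · a
        -- If `a` commuted with `t`, `commuting-descent` would give t = a, which is excluded here;
        -- hence the conjugate is shorter by two.
        shorter : len t₁ < len t
        shorter = ℕ.<-≤-trans (s≤s (ℕ.n≤1+n _)) (ℕ.≤-reflexive (sym (two-sided-descent t i i
          (cong (λ z → η z (s i)) (inv-unique tt′)) (λ h → t≢s (commuting-descent i R d (sym h))) d)))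
        R₁ : Reflection t₁
        R₁ = reflection-conj-s i R
        d-b : η t b ≡ true
        d-b = trans (cong (λ z → η z b) (sym θt)) (trans (η-θ t a) d)
        j = θi i
        b≡ = s-θi i
        aba : a · b · a ≡ b
        aba = trans (cong (_· a) (commute i)) (grp [] ((a , aa) ∷ (b , bb) ∷ []) (Q ∙ P ∙ P) Q refl)
        -- The hypothesis makes `t₁` θ-fixed and makes it conjugate `a` to `b = θ a`, so
        -- `θ-conj-by-fixed` applies with τ = a.
        swapped⇒≡ : t · b · t ≡ a → b ≡ a
        swapped⇒≡ h = θ-conj-by-fixed (go t₁ (rec shorter) R₁ θt₁) aa (sym t₁at₁)
          where
          tat : t · a · t ≡ b
          tat = trans (cong (λ z → t · z · t) (sym h)) (grp [] ((t , tt′) ∷ (b , bb) ∷ []) (P ∙ (P ∙ Q ∙ P) ∙ P) Q refl)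
          t₁at₁ : t₁ · a · t₁ ≡ b
          t₁at₁ = trans (grp [] ((t , tt′) ∷ (a , aa) ∷ []) ((Q ∙ P ∙ Q) ∙ Q ∙ (Q ∙ P ∙ Q)) (Q ∙ (P ∙ Q ∙ P) ∙ Q) refl)
            (trans (cong (λ z → a · z · a) tat) aba)
          θt₁ : θ t₁ ≡ t₁
          θt₁ = begin
            θ (a · t · a) ≡⟨ trans (hom _ _) (cong (_· b) (trans (hom _ _) (cong (b ·_) θt))) ⟩
            b · t · b ≡⟨ grp [] ((t , tt′) ∷ (b , bb) ∷ []) (Q ∙ P ∙ Q) (Q ∙ (P ∙ Q ∙ P) ∙ P) refl ⟩
            b · (t · b · t) · t ≡⟨ cong (λ z → b · z · t) h ⟩
            b · a · t ≡⟨ cong (_· t) (sym (commute i)) ⟩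
            a · b · t ≡⟨ cong (λ z → a · z · t) (sym tat) ⟩
            a · (t · a · t) · t ≡⟨ grp [] ((t , tt′) ∷ (a , aa) ∷ []) (Q ∙ (P ∙ Q ∙ P) ∙ P) (Q ∙ P ∙ Q) refl ⟩
            a · t · a ∎
        -- Conjugation by `a` fixes `b`, so `b` stays a descent unless one of the two added letters
        -- `a` meets it; the two assumptions exclude exactly these coincidences.
        descent-at-b : ¬ b ≡ a → ¬ t · b · t ≡ a → η t₁ (s j) ≡ true
        descent-at-b b≢a tbt≢a = trans (η-·s (a · t) i (s j)) (trans (cong₂ _xor_
            (trans (cong (η (a · t)) (trans (cong (λ z → a · z · a) b≡) aba))
              (trans (η-s· i t b) (cong₂ _xor_ (⌊⌋-false (λ h → tbt≢a (trans (cong (t · b ·_) (sym (inv-unique tt′))) h))) d-b)))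
            (⌊⌋-false (λ h → b≢a (trans (sym b≡) h)))) refl)
        t₂ = b · a · t · a · b
        θab : θ (a · b) ≡ a · b
        θab = trans (hom _ _) (trans (cong (b ·_) (involutive a)) (sym (commute i)))
        θt₂ : θ t₂ ≡ t₂
        θt₂ = trans (cong θ (trans (grp (a ∷ b ∷ t ∷ []) [] (Y ∙ X ∙ Z ∙ X ∙ Y) (Y ∙ X ∙ Z ∙ (X ∙ Y)) refl) (cong (λ z → z · t · (a · b)) (sym (commute i)))))
          (trans (hom _ _) (trans (cong₂ _·_ (trans (hom _ _) (cong₂ _·_ θab θt)) θab)
          (trans (cong (λ z → z · t · (a · b)) (commute i)) (grp (a ∷ b ∷ t ∷ []) [] (Y ∙ X ∙ Z ∙ (X ∙ Y)) (Y ∙ X ∙ Z ∙ X ∙ Y) refl))))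
        R₂ : Reflection t₂
        R₂ = subst Reflection (trans (cong (λ z → z · t₁ · z) b≡) (grp (a ∷ b ∷ t ∷ []) [] (Y ∙ (X ∙ Z ∙ X) ∙ Y) (Y ∙ X ∙ Z ∙ X ∙ Y) refl))
          (reflection-conj-s j R₁)
        t₂≡ : s j · (t₁ · s j) ≡ t₂
        t₂≡ = trans (cong (λ z → z · (t₁ · z)) b≡) (grp (a ∷ b ∷ t ∷ []) [] (Y ∙ ((X ∙ Z ∙ X) ∙ Y)) (Y ∙ X ∙ Z ∙ X ∙ Y) refl)
        len-t₂ : η t₁ (s j) ≡ true → len t₂ < len t
        len-t₂ h = ℕ.≤-<-trans (subst (λ z → len z ≤ len t₁) t₂≡
          (ℕ.≤-trans (len-s· j (t₁ · s j)) (ℕ.≤-reflexive (sym (descent t₁ j h))))) shorter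
        cases : FixedSimpleConjugate t
        cases with b ≟ a
        ... | yes b≡a = conjugate-back a e aa (identityˡ e) (trans (hom a e) (cong₂ _·_ b≡a θ-e))
              (subst FixedSimpleConjugate (grp (a ∷ t ∷ []) [] (X ∙ Y ∙ X) (ε ∙ X ∙ Y ∙ X ∙ ε) refl)
                (go t₁ (rec shorter) R₁
                  (trans (hom _ _) (cong₂ _·_ (trans (hom _ _) (cong₂ _·_ b≡a θt)) b≡a))))
        ... | no b≢a with t · b · t ≟ a
        ... | yes h = ⊥-elim (b≢a (swapped⇒≡ h))
        ... | no h = conjugate-back a b aa bb θab
              (go t₂ (rec (len-t₂ (descent-at-b b≢a h))) R₂ θt₂)

  -- Parabolic subgroups on at most two generators

  -- The parabolic subgroup generated by s (c false) and s (c true), which may coincide.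
  module Parabolic (c : Bool → Fin r) where

    -- The head of the list is the last letter of the product, so consing is right multiplication
    -- and right descents are met at the head.
    evJ : List Bool → Fin N
    evJ [] = e
    evJ (b ∷ bs) = evJ bs · s (c b)

    InJ : Fin N → Set
    InJ d = ∃ λ bs → d ≡ evJ bs

    evJ-++ : ∀ bs cs → evJ (bs ++ cs) ≡ evJ cs · evJ bs
    evJ-++ [] cs = sym (identityʳ _)
    evJ-++ (b ∷ bs) cs = trans (cong (_· s (c b)) (evJ-++ bs cs)) (assoc _ _ _)

    InJ-e : InJ e
    InJ-e = [] , refl

    InJ-s : ∀ b → InJ (s (c b))
    InJ-s b = b ∷ [] , sym (identityˡ _)

    InJ-· : ∀ {d d′} → InJ d → InJ d′ → InJ (d · d′)
    InJ-· (bs , refl) (cs , refl) = cs ++ bs , sym (evJ-++ cs bs)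

    InJ-inv : ∀ {d} → InJ d → InJ (inv d)
    InJ-inv (bs , refl) = go bs
      where
      go : ∀ bs → InJ (inv (evJ bs))
      go [] = subst InJ (sym inv-e) InJ-e
      go (b ∷ bs) = subst InJ (sym (trans (inv-· _ _) (cong (_· inv (evJ bs)) (inv-s (c b))))) (InJ-· (InJ-s b) (go bs))

    data TJ : Fin N → Set where
      base : ∀ b → TJ (s (c b))
      conj : ∀ b {t} → TJ t → TJ (s (c b) · t · s (c b))

    TJ-reflection : ∀ {t} → TJ t → Reflection t
    TJ-reflection (base b) = e , c b , grp [] (sᴵ (c b) ∷ []) P (ε ∙ P ∙ ε ⁻¹) refl
    TJ-reflection (conj b h) = reflection-conj-s (c b) (TJ-reflection h)

    TJ⇒InJ : ∀ {t} → TJ t → InJ t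
    TJ⇒InJ (base b) = InJ-s b
    TJ⇒InJ (conj b h) = InJ-· (InJ-· (InJ-s b) (TJ⇒InJ h)) (InJ-s b)

    TJ-conj : ∀ {d t} → InJ d → TJ t → TJ (d · t · inv d)
    TJ-conj {t = t} (bs , refl) = go bs t
      where
      go : ∀ bs t → TJ t → TJ (evJ bs · t · inv (evJ bs))
      go [] t h = subst TJ (grp (t ∷ []) [] X (ε ∙ X ∙ ε ⁻¹) refl) h
      go (b ∷ bs) t h = subst TJ (grp (evJ bs ∷ t ∷ []) (sᴵ (c b) ∷ []) (X ∙ (P ∙ Y ∙ P) ∙ X ⁻¹) ((X ∙ P) ∙ Y ∙ (X ∙ P) ⁻¹) refl)
                          (go bs _ (conj b h))

    inversion-TJ : ∀ {d t} → InJ d → η d t ≡ true → TJ t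
    inversion-TJ {t = t} (bs , refl) = go bs t
      where
      go : ∀ bs t → η (evJ bs) t ≡ true → TJ t
      go [] t h = ⊥-elim (true≢false h (η-e t))
      go (b ∷ bs) t h with t ≟ s (c b) | trans (sym (η-·s (evJ bs) (c b) t)) h
      ... | yes refl | _ = base b
      ... | no _ | h′ = subst TJ (grp (t ∷ []) (sᴵ (c b) ∷ []) (P ∙ (P ∙ X ∙ P) ∙ P) X refl)
                          (conj b (go bs _ (trans (sym (Bₚ.xor-identityʳ _)) h′)))

    -- Exchange inside the parabolic subgroup: one letter of the given word is deleted. Inductions
    -- can then run on the length of words in the two letters, without comparison with `len`.
    exchangeJ : ∀ bs t → η (evJ bs) t ≡ true → ∃ λ cs → evJ cs ≡ evJ bs · t × length bs ≡ suc (length cs)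
    exchangeJ [] t h = ⊥-elim (true≢false h (η-e t))
    exchangeJ (b ∷ bs) t h with t ≟ s (c b) | trans (sym (η-·s (evJ bs) (c b) t)) h
    ... | yes refl | _ = bs , sym (len-s-self (evJ bs) (c b)) , refl
    ... | no _ | h′ with exchangeJ bs (s (c b) · t · s (c b)) (trans (sym (Bₚ.xor-identityʳ _)) h′)
    ... | cs , eq , l = b ∷ cs , trans (cong (_· s (c b)) eq)
            (grp (evJ bs ∷ t ∷ []) (sᴵ (c b) ∷ []) (X ∙ (P ∙ Y ∙ P) ∙ P) (X ∙ P ∙ Y) refl) , cong suc l

    -- The word need not be reduced. Either its last letter is a descent, or that letter cancels
    -- against one deleted by exchange and a word with two letters fewer has the same value.
    descentJ : ∀ bs → evJ bs ≡ e ⊎ ∃ λ b → η (evJ bs) (s (c b)) ≡ true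
    descentJ bs = go bs (<-wellFounded (length bs))
      where
      go : ∀ bs → Acc _<_ (length bs) → evJ bs ≡ e ⊎ ∃ λ b → η (evJ bs) (s (c b)) ≡ true
      go [] _ = inj₁ refl
      go (b ∷ bs) (acc rec) with η (evJ bs) (s (c b)) in eq
      ... | false = inj₂ (b , trans (η-·s-self (evJ bs) (c b)) (cong not eq))
      ... | true with exchangeJ bs (s (c b)) eq
      ... | cs , eq′ , l = subst (λ z → z ≡ e ⊎ ∃ λ b → η z (s (c b)) ≡ true) eq′
              (go cs (rec (ℕ.≤-trans (ℕ.≤-reflexive (sym l)) (ℕ.n≤1+n _))))

    InJ-descent : ∀ {d} → InJ d → ¬ d ≡ e → ∃ λ b → η d (s (c b)) ≡ true
    InJ-descent (bs , refl) ne with descentJ bs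
    ... | inj₁ h = ⊥-elim (ne h)
    ... | inj₂ h = h

    JMin : Fin N → Set
    JMin x = ∀ b → η x (s (c b)) ≡ false

    InJ-JMin : ∀ {d} → InJ d → JMin d → d ≡ e
    InJ-JMin {d} h m with d ≟ e
    ... | yes p = p
    ... | no ¬p = let (b , q) = InJ-descent h ¬p in ⊥-elim (true≢false q (m b))

    -- Otherwise one could keep descending from x inside its coset: every element of the coset
    -- which has no inversion in TJ is equal to x.
    JMin-TJ : ∀ {x t} → JMin x → TJ t → η x t ≡ false
    JMin-TJ {x} {t} m T = not-true (λ h → go e InJ-e (<-wellFounded _) h)
      where
      go : ∀ d → InJ d → Acc _<_ (len (x · d)) → ¬ η x t ≡ true
      go d D (acc rec) h = true≢false h (trans (cong (λ z → η z t) x≡u) (pure t T))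
        where
        u = x · d
        pure : ∀ t′ → TJ t′ → η u t′ ≡ false
        pure t′ T′ = not-true (λ h′ → go (d · t′) (InJ-· D (TJ⇒InJ T′))
          (rec (subst (λ z → len z < len u) (assoc x d t′) (exchange u t′ h′))) h)
        d⁻¹-min : JMin (inv d)
        d⁻¹-min b = begin
          η (inv d) (s (c b)) ≡⟨ cong (_xor η (inv d) (s (c b))) (sym (pure _ (TJ-conj (InJ-inv D) (base b)))) ⟩
          η u (inv d · s (c b) · inv (inv d)) xor η (inv d) (s (c b)) ≡⟨ sym (η-· u (inv d) (s (c b))) ⟩
          η (u · inv d) (s (c b)) ≡⟨ cong (λ z → η z (s (c b))) (grp (x ∷ d ∷ []) [] (X ∙ Y ∙ Y ⁻¹) X refl) ⟩
          η x (s (c b)) ≡⟨ m b ⟩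
          false ∎
        x≡u : x ≡ u
        x≡u = trans (grp (x ∷ d ∷ []) [] X (X ∙ Y ∙ Y ⁻¹) refl)
                (trans (cong (u ·_) (InJ-JMin (InJ-inv D) d⁻¹-min)) (identityʳ u))

    η-JMin· : ∀ {x d t} → JMin x → InJ d → TJ t → η (x · d) t ≡ η d t
    η-JMin· {x} {d} {t} m D T = trans (η-· x d t) (cong (_xor η d t) (JMin-TJ m (TJ-conj D T)))

    JMin-coset-unique : ∀ {x d} → JMin x → InJ d → JMin (x · d) → d ≡ e
    JMin-coset-unique m D m′ = InJ-JMin D (λ b → trans (sym (η-JMin· m D (base b))) (m′ b))

    η-inv-ι : ∀ {x} t → ι x → η (inv x) (θ t) ≡ η x t
    η-inv-ι {x} t ix = trans (cong (λ z → η z (θ t)) (sym (ι-twisted ix))) (η-θ x t)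

    JMin-inv : ∀ {x t} → ι x → JMin x → TJ t → η (inv x) (θ t) ≡ false
    JMin-inv {x} {t} ix m T = trans (η-inv-ι t ix) (JMin-TJ m T)

    η-inv-θ· : ∀ {x d t} → ι x → JMin x → InJ d → TJ t → η (inv (θ d · x)) (θ t) ≡ η (inv d) t
    η-inv-θ· {x} {d} {t} ix m D T = begin
      η (inv (θ d · x)) (θ t) ≡⟨ cong (λ z → η z (θ t)) (trans (inv-· (θ d) x) (cong (inv x ·_) (sym (θ-inv d)))) ⟩
      η (inv x · θ (inv d)) (θ t) ≡⟨ η-· (inv x) (θ (inv d)) (θ t) ⟩
      η (inv x) (θ (inv d) · θ t · inv (θ (inv d))) xor η (θ (inv d)) (θ t)
        ≡⟨ cong₂ _xor_ (trans (cong (η (inv x)) (sym (θ-conj (inv d) t))) (JMin-inv ix m (TJ-conj (InJ-inv D) T))) (η-θ (inv d) t) ⟩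
      η (inv d) t ∎

    -- A J-descent of τ is an inversion of x τ = θ(s) x. As x has no inversion in J, the only one
    -- that the left factor θ(s) can create is x⁻¹ θ(s) x = τ, so τ is that descent.
    twisted-simple : ∀ {x τ} b → ι x → JMin x → TJ τ → θ (s (c b)) · x ≡ x · τ → ∃ λ b′ → τ ≡ s (c b′)
    twisted-simple {x} {τ} b ix m T h with InJ-descent (TJ⇒InJ T) (reflection≢e (TJ-reflection T))
    ... | b′ , d = b′ , ·-cancelˡ x (trans (sym h) (trans (cong (_· x) (sym (⌊⌋-true⁻ eq)))
                      (grp (x ∷ s (c b′) ∷ []) [] (X ∙ Y ∙ X ⁻¹ ∙ X) (X ∙ Y) refl)))
      where
      eq : ⌊ x · s (c b′) · inv x ≟ θ (s (c b)) ⌋ ≡ true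
      eq = begin
        ⌊ x · s (c b′) · inv x ≟ θ (s (c b)) ⌋ ≡⟨ cong (λ z → ⌊ x · s (c b′) · inv x ≟ z ⌋) (sym (s-θi (c b))) ⟩
        ⌊ x · s (c b′) · inv x ≟ s (θi (c b)) ⌋ ≡⟨ sym (Bₚ.xor-identityʳ _) ⟩
        ⌊ x · s (c b′) · inv x ≟ s (θi (c b)) ⌋ xor false
          ≡⟨ cong (⌊ x · s (c b′) · inv x ≟ s (θi (c b)) ⌋ xor_) (sym (m b′)) ⟩
        ⌊ x · s (c b′) · inv x ≟ s (θi (c b)) ⌋ xor η x (s (c b′)) ≡⟨ sym (η-s· (θi (c b)) x (s (c b′))) ⟩
        η (s (θi (c b)) · x) (s (c b′)) ≡⟨ cong (λ z → η z (s (c b′))) (trans (cong (_· x) (s-θi (c b))) h) ⟩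
        η (x · τ) (s (c b′)) ≡⟨ η-JMin· m (TJ⇒InJ T) (base b′) ⟩
        η τ (s (c b′)) ≡⟨ d ⟩
        true ∎

    -- Applying θ and using θ(x) = x⁻¹ shows that x⁻¹ θ(-) x is an involution.
    twisted-flip : ∀ {x a b} → ι x → θ a · x ≡ x · b → θ b · x ≡ x · a
    twisted-flip {x} {a} {b} ix h = begin
      θ b · x ≡⟨ grp (θ b ∷ x ∷ []) [] (X ∙ Y) (Y ∙ (Y ⁻¹ ∙ X) ∙ Y) refl ⟩
      x · (inv x · θ b) · x
        ≡⟨ cong (λ z → x · z · x) (trans (cong (_· θ b) (sym (ι-twisted ix))) (trans (sym (hom x b)) (trans (cong θ (sym h))
             (trans (hom (θ a) x) (cong₂ _·_ (involutive a) (ι-twisted ix)))))) ⟩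
      x · (a · inv x) · x ≡⟨ grp (a ∷ x ∷ []) [] (Y ∙ (X ∙ Y ⁻¹) ∙ Y) (Y ∙ X) refl ⟩
      x · a ∎

    -- Uniqueness of the minimal element of a double coset of θ(W_J) and W_J; in ι(θ), minimality on
    -- the right gives minimality on the left. The two factors are independent so that the induction
    -- can shorten the right one: a descent of it, moved across y, is the θ-image of a reflection τ
    -- of J and is absorbed into `d`.
    JMin-orbit-unique : ∀ {x y} → ι x → ι y → JMin x → JMin y → ∀ bs d → InJ d → x · evJ bs ≡ θ d · y → x ≡ y
    JMin-orbit-unique {x} {y} ix iy mx my bs = go bs (<-wellFounded (length bs))
      where
      go : ∀ bs → Acc _<_ (length bs) → ∀ d → InJ d → x · evJ bs ≡ θ d · y → x ≡ y
      go bs (acc rec) d D h with descentJ bs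
      ... | inj₁ bs≡e = trans x≡ (trans (cong (λ z → θ z · y) d≡e) (trans (cong (_· y) θ-e) (identityˡ y)))
        where
        x≡ : x ≡ θ d · y
        x≡ = trans (sym (identityʳ x)) (trans (cong (x ·_) (sym bs≡e)) h)
        d≡e : d ≡ e
        d≡e = trans (sym (inv-inv d)) (trans (cong inv (InJ-JMin (InJ-inv D) (λ b →
          trans (sym (η-inv-θ· iy my D (base b))) (trans (cong (λ z → η (inv z) (θ (s (c b)))) (sym x≡)) (JMin-inv ix mx (base b)))))) inv-e)
      ... | inj₂ (b , db) with exchangeJ bs (s (c b)) db
      ... | cs , cs≡ , l = go cs (rec (ℕ.≤-reflexive (sym l))) (d · τ) (InJ-· D (TJ⇒InJ T)) (begin
        x · evJ cs ≡⟨ trans (cong (x ·_) cs≡) (sym (assoc _ _ _)) ⟩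
        x · evJ bs · s (c b) ≡⟨ cong (_· s (c b)) h ⟩
        θ d · y · s (c b) ≡⟨ grp (θ d ∷ y ∷ s (c b) ∷ []) [] (X ∙ Y ∙ Z) (X ∙ (Y ∙ Z ∙ Y ⁻¹) ∙ Y) refl ⟩
        θ d · u · y ≡⟨ cong (λ z → z · y) (trans (cong (θ d ·_) (sym (involutive u))) (sym (hom d τ))) ⟩
        θ (d · τ) · y ∎)
        where
        u = y · s (c b) · inv y
        τ = θ u
        T : TJ τ
        T = inversion-TJ D (begin
          η d τ ≡⟨ sym (trans (cong (η (θ d)) (sym (involutive u))) (η-θ d τ)) ⟩
          η (θ d) u ≡⟨ sym (Bₚ.xor-identityʳ _) ⟩
          η (θ d) u xor false ≡⟨ cong (η (θ d) u xor_) (sym (my b)) ⟩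
          η (θ d) u xor η y (s (c b)) ≡⟨ sym (η-· (θ d) y (s (c b))) ⟩
          η (θ d · y) (s (c b)) ≡⟨ cong (λ z → η z (s (c b))) (sym h) ⟩
          η (x · evJ bs) (s (c b)) ≡⟨ η-JMin· mx (bs , refl) (base b) ⟩
          η (evJ bs) (s (c b)) ≡⟨ db ⟩
          true ∎)

    twisted-conj : Fin N → Fin N → Fin N
    twisted-conj x y = inv x · θ y · x

    twisted-conj-via : ∀ {x y z} → θ y · x ≡ x · z → twisted-conj x y ≡ z
    twisted-conj-via {x} {y} {z} h = trans (assoc _ _ _) (trans (cong (inv x ·_) h) (grp (x ∷ z ∷ []) [] (X ⁻¹ ∙ (X ∙ Y)) Y refl))

    twisted-conj-· : ∀ x y z → twisted-conj x (y · z) ≡ twisted-conj x y · twisted-conj x z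
    twisted-conj-· x y z = trans (cong (λ u → inv x · u · x) (hom y z))
      (grp (x ∷ θ y ∷ θ z ∷ []) [] (X ⁻¹ ∙ (Y ∙ Z) ∙ X) ((X ⁻¹ ∙ Y ∙ X) ∙ (X ⁻¹ ∙ Z ∙ X)) refl)

    twisted-conj-involutive : ∀ x {y} → y · y ≡ e → twisted-conj x y · twisted-conj x y ≡ e
    twisted-conj-involutive x {y} h = trans (sym (twisted-conj-· x y y)) (trans (cong (twisted-conj x) h)
      (trans (cong (λ z → inv x · z · x) θ-e) (grp (x ∷ []) [] (X ⁻¹ ∙ ε ∙ X) ε refl)))

    module Swap {x : Fin N} (ix : ι x) (b : Bool) (swap : θ (s (c b)) · x ≡ x · s (c (not b))) where
      private
        a a′ : Fin N
        a = s (c b)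
        a′ = s (c (not b))
        σ : Fin N → Fin N
        σ = twisted-conj x

      σa : σ a ≡ a′
      σa = twisted-conj-via swap

      σa′ : σ a′ ≡ a
      σa′ = twisted-conj-via (twisted-flip ix swap)

      -- If σ swaps the generators, then σ(y) = a′ y a = a y a′ for every reflection y of J, stated
      -- here without inverses. For a reflection t fixed by σ this says that t itself conjugates a
      -- to a′.
      Swapped : Fin N → Fin N → Fin N → Set
      Swapped p q y = y · p ≡ q · σ y × y · q ≡ p · σ y

      involution-flip : ∀ {y p q} → y · y ≡ e → p · p ≡ e → q · q ≡ e → y · p ≡ q · σ y → p · y ≡ σ y · q
      involution-flip {y} {p} {q} yy pp qq h =
        trans (grp [] ((p , pp) ∷ (y , yy) ∷ []) (P ∙ Q) ((Q ∙ P) ⁻¹) refl) (trans (cong inv h)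
          (grp [] ((q , qq) ∷ (σ y , twisted-conj-involutive x yy) ∷ []) ((P ∙ Q) ⁻¹) (Q ∙ P) refl))

      swapped-base : ∀ p q → p · p ≡ e → q · q ≡ e → σ p ≡ q → Swapped p q p
      swapped-base p q pp qq σp = trans pp (trans (sym qq) (cong (q ·_) (sym σp))) , cong (p ·_) (sym σp)

      swapped-conj : ∀ {y} p q → y · y ≡ e → p · p ≡ e → q · q ≡ e → σ p ≡ q → Swapped p q y → Swapped p q (p · y · p)
      swapped-conj {y} p q yy pp qq σp (h₁ , h₂) =
          trans (grp (y ∷ []) ((p , pp) ∷ []) ((P ∙ X ∙ P) ∙ P) (P ∙ X) refl)
            (trans (involution-flip yy pp qq h₁) (trans (grp (σ y ∷ []) ((q , qq) ∷ []) (X ∙ P) (P ∙ (P ∙ X ∙ P)) refl) (cong (q ·_) (sym σpyp))))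
        , trans (cong (_· q) (assoc p y p)) (trans (cong (λ z → p · z · q) h₁)
            (trans (grp (p ∷ q ∷ σ y ∷ []) [] (X ∙ (Y ∙ Z) ∙ Y) (X ∙ (Y ∙ Z ∙ Y)) refl) (cong (p ·_) (sym σpyp))))
        where
        σpyp : σ (p · y · p) ≡ q · σ y · q
        σpyp = trans (twisted-conj-· x (p · y) p) (cong₂ _·_ (trans (twisted-conj-· x p y) (cong (_· σ y) σp)) σp)

      flip× : ∀ {p q y} → Swapped p q y → Swapped q p y
      flip× (h₁ , h₂) = h₂ , h₁

      letter : ∀ b′ → b′ ≡ b ⊎ b′ ≡ not b
      letter b′ with b′ Bₚ.≟ b
      ... | yes p = inj₁ p
      ... | no ne = inj₂ (Bₚ.¬-not ne)

      swapped : ∀ {y} → TJ y → Swapped a a′ y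
      swapped (base b′) = case letter b′ of λ where
        (inj₁ refl) → swapped-base a a′ (s-invol _) (s-invol _) σa
        (inj₂ refl) → flip× (swapped-base a′ a (s-invol _) (s-invol _) σa′)
      swapped (conj b′ Ty) = case letter b′ of λ where
        (inj₁ refl) → swapped-conj a a′ (reflection-involutive (TJ-reflection Ty)) (s-invol _) (s-invol _) σa (swapped Ty)
        (inj₂ refl) → flip× (swapped-conj a′ a (reflection-involutive (TJ-reflection Ty)) (s-invol _) (s-invol _) σa′ (flip× (swapped Ty)))

      module _ (commute : Commuting) {t : Fin N} (T : TJ t) (fix : θ t · x ≡ x · t) where
        private
          v = proj₁ ix
          σt : σ t ≡ t
          σt = twisted-conj-via fix
          tt′ = reflection-involutive (TJ-reflection T)

          tat : t · a · t ≡ a′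
          tat = trans (cong (_· t) (trans (proj₁ (swapped T)) (cong (a′ ·_) σt)))
            (grp (a′ ∷ []) ((t , tt′) ∷ []) (X ∙ P ∙ P) X refl)

          -- Writing x = θ(v⁻¹)v, conjugation by v carries σ to θ itself.
          θ-conj-v : ∀ y → θ (v · y · inv v) ≡ v · σ y · inv v
          θ-conj-v y = trans (θ-conj v y) (trans
            (grp (θ v ∷ θ y ∷ v ∷ []) [] (X ∙ Y ∙ X ⁻¹) (Z ∙ ((X ⁻¹ ∙ Z) ⁻¹ ∙ Y ∙ (X ⁻¹ ∙ Z)) ∙ Z ⁻¹) refl)
            (cong (λ z → v · (inv z · θ y · z) · inv v) (sym (trans (proj₂ ix) (cong (_· v) (θ-inv v))))))

          θ-swap : θ (v · a · inv v) ≡ v · a′ · inv v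
          θ-swap = trans (θ-conj-v a) (cong (λ z → v · z · inv v) σa)

          θ-conj-t : θ (v · a · inv v) ≡ (v · t · inv v) · (v · a · inv v) · (v · t · inv v)
          θ-conj-t = trans θ-swap (trans (cong (λ z → v · z · inv v) (sym tat))
            (grp (v ∷ t ∷ a ∷ []) [] (X ∙ (Y ∙ Z ∙ Y) ∙ X ⁻¹) ((X ∙ Y ∙ X ⁻¹) ∙ (X ∙ Z ∙ X ⁻¹) ∙ (X ∙ Y ∙ X ⁻¹)) refl))

        -- After conjugation by v, the image of t is a θ-fixed reflection and conjugates the image
        -- of a to its θ-image, which is the situation of `θ-conj-by-fixed`.
        no-swap : a′ ≡ a
        no-swap = ·-cancelˡ v (·-cancelʳ (inv v) (trans (sym θ-swap)
          (θ-conj-by-fixed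
            (fixed-reflection commute (reflection-conj v (TJ-reflection T)) (trans (θ-conj-v t) (cong (λ z → v · z · inv v) σt)))
            (reflection-involutive (v , c b , refl)) θ-conj-t)))

    -- If t is fixed by the twisted conjugation σ = x⁻¹ θ(-) x then σ permutes J.  Were σ to swap J,
    -- then t would conjugate one element of J to the other and θ-conj-by-fixed would apply.
    fixed-inversion : Commuting → ∀ {x t} → ι x → JMin x → TJ t → θ t · x ≡ x · t → ∃ λ b → act x (c b) ≡ x
    fixed-inversion commute {x} {t} ix m T fix = b , (case letter of λ where
        (inj₁ h) → fixes h
        (inj₂ h) → fixes (trans h (Swap.no-swap ix b (trans θa·x (cong (x ·_) h)) commute T fix)))
      where
      descent-t = InJ-descent (TJ⇒InJ T) (reflection≢e (TJ-reflection T))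
      b = proj₁ descent-t
      a = s (c b)
      t⁻¹ : inv t ≡ t
      t⁻¹ = inv-unique (reflection-involutive (TJ-reflection T))
      τ = inv x · θ a · inv (inv x)
      -- As a is a descent of t, θ(a) is a left inversion of θ(t)x = xt. It cannot come from x,
      -- which has no left inversion in θ(J), so it comes from t and its conjugate τ is an inversion
      -- of t.
      Tτ : TJ τ
      Tτ = inversion-TJ (TJ⇒InJ T) (begin
        η t τ ≡⟨ sym (Bₚ.xor-identityʳ _) ⟩
        η t τ xor false ≡⟨ cong (η t τ xor_) (sym (JMin-inv ix m (base b))) ⟩
        η t τ xor η (inv x) (θ a) ≡⟨ sym (η-· t (inv x) (θ a)) ⟩
        η (t · inv x) (θ a)
          ≡⟨ cong (λ z → η z (θ a)) (trans (cong (_· inv x) (sym t⁻¹)) (trans (sym (inv-· x t)) (cong inv (sym fix)))) ⟩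
        η (inv (θ t · x)) (θ a) ≡⟨ η-inv-θ· ix m (TJ⇒InJ T) (base b) ⟩
        η (inv t) a ≡⟨ trans (cong (λ z → η z a) t⁻¹) (proj₂ descent-t) ⟩
        true ∎)
      θa·x : θ a · x ≡ x · τ
      θa·x = grp (θ a ∷ x ∷ []) [] (X ∙ Y) (Y ∙ (Y ⁻¹ ∙ X ∙ Y ⁻¹ ⁻¹)) refl
      fixes : τ ≡ a → act x (c b) ≡ x
      fixes h = trans (cong (_· a) (trans θa·x (cong (x ·_) h))) (len-s-self x (c b))
      simple = twisted-simple b ix m Tτ θa·x
      letter : τ ≡ a ⊎ τ ≡ s (c (not b))
      letter with proj₁ simple Bₚ.≟ b
      ... | yes p = inj₁ (trans (proj₂ simple) (cong (s ∘ c) p))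
      ... | no ne = inj₂ (trans (proj₂ simple) (cong (s ∘ c) (Bₚ.¬-not ne)))

  -- The Hecke module on twisted identities

  Up Down : Fin N → Fin r → Set
  Up x i = ¬ act x i ≡ x × η x (s i) ≡ false
  Down x i = ¬ act x i ≡ x × η x (s i) ≡ true

  kind : ∀ x i → act x i ≡ x ⊎ Up x i ⊎ Down x i
  kind x i with act x i ≟ x
  ... | yes p = inj₁ p
  ... | no ¬p = inj₂ (go (η x (s i)) refl)
    where
    go : ∀ b → η x (s i) ≡ b → Up x i ⊎ Down x i
    go false h = inj₁ (¬p , h)
    go true h = inj₂ (¬p , h)

  act-moves : ∀ {x i} → ¬ act x i ≡ x → ¬ act (act x i) i ≡ act x i
  act-moves {x} {i} ne h = ne (trans (sym h) (act-act x i))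

  Up⇒Down : ∀ {x i} → Up x i → Down (act x i) i
  Up⇒Down {x} {i} (ne , h) = act-moves ne , trans (η-act x i ne) (cong not h)

  Down⇒Up : ∀ {x i} → Down x i → Up (act x i) i
  Down⇒Up {x} {i} (ne , h) = act-moves ne , trans (η-act x i ne) (cong not h)

  θi-θi : ∀ i → θi (θi i) ≡ i
  θi-θi i = s-inj _ _ (trans (s-θi (θi i)) (trans (cong θ (s-θi i)) (involutive (s i))))

  θ-s-θi : ∀ i → θ (s (θi i)) ≡ s i
  θ-s-θi i = trans (cong θ (s-θi i)) (involutive (s i))

  act-e : ∀ i → act e i ≡ s (θi i) · s i
  act-e i = trans (cong (_· s i) (identityʳ _)) (cong (_· s i) (sym (s-θi i)))

  act-e-up : ∀ {i} → ¬ θi i ≡ i → Up e i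
  act-e-up {i} ne = (λ h → ne (s-inj _ _ (·-cancelʳ (s i) (trans (sym (act-e i)) (trans h (sym (s-invol i))))))) , η-e (s i)

  act-shorter : ∀ {x i} → ι x → Down x i → len (act x i) < len x
  act-shorter {x} {i} ix (ne , h) = subst (len (act x i) <_) (sym (len-act-descent i ix ne h)) (s≤s (ℕ.n≤1+n _))

  -- The operator T i is dual to right multiplication by the Hecke generator T_s on the module with basis ι:
  -- T i g x is the value of the functional g at m_x T_s, where the Hecke parameter is 1 + q.
  module Hecke (q : ℕ) where

    abstract
      T : Fin r → (Fin N → ℕ) → Fin N → ℕ
      T i g x = if ⌊ act x i ≟ x ⌋ then suc q * g x
                else if η x (s i) then suc q * g (act x i) + q * g x else g (act x i)

      T-fixed : ∀ {i x} g → act x i ≡ x → T i g x ≡ suc q * g x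
      T-fixed g h = if-true (⌊⌋-true h)

      T-up : ∀ {i x} g → Up x i → T i g x ≡ g (act x i)
      T-up g (ne , h) = trans (if-false (⌊⌋-false ne)) (if-false h)

      T-down : ∀ {i x} g → Down x i → T i g x ≡ suc q * g (act x i) + q * g x
      T-down g (ne , h) = trans (if-false (⌊⌋-false ne)) (if-true h)

    -- The coefficients do not depend on `g`; congruence, linearity and compatibility with sums then
    -- follow without a case distinction on `kind`.
    T-coefficients : ∀ x i → ∃ λ α → ∃ λ β → ∀ g → T i g x ≡ α * g (act x i) + β * g x
    T-coefficients x i with kind x i
    ... | inj₁ f = 0 , suc q , λ g → T-fixed g f
    ... | inj₂ (inj₁ u) = 1 , 0 , λ g → trans (T-up g u) (sym (trans (ℕ.+-identityʳ _) (ℕ.+-identityʳ _)))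
    ... | inj₂ (inj₂ d) = suc q , q , λ g → T-down g d

    T-cong : ∀ i {g h x} → g x ≡ h x → g (act x i) ≡ h (act x i) → T i g x ≡ T i h x
    T-cong i {g} {h} {x} p p′ = let (α , β , T≡) = T-coefficients x i in
      trans (T≡ g) (trans (cong₂ (λ a b → α * a + β * b) p′ p) (sym (T≡ h)))

    T-linear : ∀ i α β g h x → T i (λ y → α * g y + β * h y) x ≡ α * T i g x + β * T i h x
    T-linear i α β g h x = let (γ , κ , T≡) = T-coefficients x i in
      trans (T≡ _) (trans
        (solve 8 (λ t p a b u v u′ v′ → t :* (a :* u :+ b :* v) :+ p :* (a :* u′ :+ b :* v′) :=
                                  a :* (t :* u :+ p :* u′) :+ b :* (t :* v :+ p :* v′)) refl
          γ κ α β (g (act x i)) (h (act x i)) (g x) (h x))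
        (sym (cong₂ (λ u v → α * u + β * v) (T≡ g) (T≡ h))))

    T-quadratic : ∀ i g x → T i (T i g) x ≡ suc q * g x + q * T i g x
    T-quadratic i g x with kind x i
    ... | inj₁ f = trans (T-fixed _ f) (trans (cong (suc q *_) (T-fixed g f))
            (trans (solve 2 (λ p u → (con 1 :+ p) :* ((con 1 :+ p) :* u) := (con 1 :+ p) :* u :+ p :* ((con 1 :+ p) :* u)) refl q (g x))
              (cong (λ z → suc q * g x + q * z) (sym (T-fixed g f)))))
    ... | inj₂ (inj₁ u) = trans (T-up _ u) (trans (T-down g (Up⇒Down u))
            (cong₂ (λ a b → suc q * a + q * b) (cong g (act-act x i)) (sym (T-up g u))))
    ... | inj₂ (inj₂ d) = trans (T-down _ d)
            (cong (λ z → suc q * z + q * T i g x) (trans (T-up g (Down⇒Up d)) (cong g (act-act x i))))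

    -- Replaces the inverse of T_s: when x is moved, the coefficient of `g (act x i)` is 1 or
    -- `suc q` and can be cancelled.
    T-determines : ∀ i {g h x} → T i g x ≡ T i h x → g x ≡ h x → g (act x i) ≡ h (act x i)
    T-determines i {g} {h} {x} p p′ with kind x i
    ... | inj₁ f = subst (λ y → g y ≡ h y) (sym f) p′
    ... | inj₂ (inj₁ u) = trans (sym (T-up g u)) (trans p (T-up h u))
    ... | inj₂ (inj₂ d) = ℕ.*-cancelˡ-≡ _ _ (suc q) (ℕ.+-cancelʳ-≡ (q * g x) _ _
            (trans (sym (T-down g d)) (trans p (trans (T-down h d) (cong (λ z → suc q * h (act x i) + q * z) (sym p′))))))

  -- Alternating products of two Hecke operators

  module Rank2 (q : ℕ) (c : Bool → Fin r) where
    open Hecke q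
    open Parabolic c

    Alt : Bool → ℕ → (Fin N → ℕ) → Fin N → ℕ
    Alt b zero g = g
    Alt b (suc k) g = T (c b) (Alt (not b) k g)

    -- the letter in position k (counting from 0) of the alternating word starting with b
    letterAt : Bool → ℕ → Bool
    letterAt b zero = b
    letterAt b (suc k) = letterAt (not b) k

    letterAt-not : ∀ b k → letterAt (not b) k ≡ not (letterAt b k)
    letterAt-not b zero = refl
    letterAt-not b (suc k) = letterAt-not (not b) k

    Alt-+ : ∀ b n k g → Alt b (n + k) g ≡ Alt b n (Alt (letterAt b n) k g)
    Alt-+ b zero k g = refl
    Alt-+ b (suc n) k g = cong (T (c b)) (Alt-+ (not b) n k g)

    Alt-snoc : ∀ b k g → Alt b (suc k) g ≡ Alt b k (T (c (letterAt b k)) g)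
    Alt-snoc b k g = trans (cong (λ n → Alt b n g) (ℕ.+-comm 1 k)) (Alt-+ b k 1 g)

    Alt-cong : ∀ b k {g h} → (∀ x → g x ≡ h x) → ∀ x → Alt b k g x ≡ Alt b k h x
    Alt-cong b zero p x = p x
    Alt-cong b (suc k) p x = T-cong (c b) (Alt-cong (not b) k p x) (Alt-cong (not b) k p _)

    Alt-linear : ∀ b k α β g h x → Alt b k (λ y → α * g y + β * h y) x ≡ α * Alt b k g x + β * Alt b k h x
    Alt-linear b zero α β g h x = refl
    Alt-linear b (suc k) α β g h x = trans (T-cong (c b) (Alt-linear (not b) k α β g h x) (Alt-linear (not b) k α β g h _))
      (T-linear (c b) α β _ _ x)

    Braid : ℕ → Fin N → Set
    Braid n y = ∀ b g → Alt b n g y ≡ Alt (not b) n g y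

    braid-at : ∀ {n y} b → (∀ g → Alt b n g y ≡ Alt (not b) n g y) → Braid n y
    braid-at false h false = h
    braid-at false h true g = sym (h g)
    braid-at true h true = h
    braid-at true h false g = sym (h g)

    -- Write Δ and Δ′ for the two alternating words of length n, Δ starting with T_s, and let T_z be the last
    -- letter of Δ′.  Then T_s Δ′ = Δ T_z, and T_s Δ is computed from the quadratic relation.
    braid-act : ∀ n {y} b → Braid n y → Braid n (act y (c b))
    braid-act zero b h b′ g = refl
    braid-act (suc k) {y} b h = braid-at {suc k} b (λ g → T-determines (c b) (step g) (h b g))
      where
      step : ∀ g → T (c b) (Alt b (suc k) g) y ≡ T (c b) (Alt (not b) (suc k) g) y
      step g = begin
        T (c b) (T (c b) (Alt (not b) k g)) y ≡⟨ T-quadratic (c b) (Alt (not b) k g) y ⟩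
        suc q * Alt (not b) k g y + q * Alt b (suc k) g y
          ≡⟨ cong (λ z → suc q * Alt (not b) k g y + q * z) (trans (h b g) (cong (λ f → f y) (Alt-snoc (not b) k g))) ⟩
        suc q * Alt (not b) k g y + q * Alt (not b) k (T z g) y ≡⟨ sym (Alt-linear (not b) k (suc q) q g (T z g) y) ⟩
        Alt (not b) k (λ x → suc q * g x + q * T z g x) y ≡⟨ Alt-cong (not b) k (λ x → sym (T-quadratic z g x)) y ⟩
        Alt (not b) k (T z (T z g)) y ≡⟨ cong (λ f → f y) (sym (Alt-snoc (not b) k (T z g))) ⟩
        Alt (not b) (suc k) (T z g) y ≡⟨ sym (h b (T z g)) ⟩
        Alt b (suc k) (T z g) y ≡⟨ cong (λ f → f y) (sym (Alt-snoc b (suc k) g)) ⟩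
        Alt b (suc (suc k)) g y ∎
        where z = c (letterAt (not b) k)

    -- The elements satisfying `Braid n` are closed under the action by `braid-act`, so at such an
    -- element the operators only look at values on such elements.
    Alt-cong-on : ∀ n b k {g h} → (∀ y → Braid n y → g y ≡ h y) → ∀ y → Braid n y → Alt b k g y ≡ Alt b k h y
    Alt-cong-on n b zero p y By = p y By
    Alt-cong-on n b (suc k) p y By = T-cong (c b) (Alt-cong-on n (not b) k p y By) (Alt-cong-on n (not b) k p _ (braid-act n b By))

    -- Passes from the length of an orbit to its multiples: the two words are exchanged in blocks of
    -- length n, each block being applied at elements of the same orbit.
    braid-multiple : ∀ n l {y} → Braid n y → Braid (l * n) y
    braid-multiple n zero By b g = refl
    braid-multiple n (suc l) {y} By b g = begin
      Alt b (n + l * n) g y ≡⟨ cong (λ f → f y) (Alt-+ b n (l * n) g) ⟩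
      Alt b n (Alt (letterAt b n) (l * n) g) y ≡⟨ By b _ ⟩
      Alt (not b) n (Alt (letterAt b n) (l * n) g) y
        ≡⟨ Alt-cong-on n (not b) n (λ y′ By′ → trans (braid-multiple n l {y′} By′ (letterAt b n) g)
             (cong (λ b′ → Alt b′ (l * n) g y′) (sym (letterAt-not b n)))) y By ⟩
      Alt (not b) n (Alt (letterAt (not b) n) (l * n) g) y ≡⟨ cong (λ f → f y) (sym (Alt-+ (not b) n (l * n) g)) ⟩
      Alt (not b) (n + l * n) g y ∎

    walk : Bool → ℕ → Fin N → Fin N
    walk b zero x = x
    walk b (suc k) x = walk (not b) k (act x (c b))

    Ups : Bool → ℕ → Fin N → Set
    Ups b zero x = ⊤
    Ups b (suc k) x = Up x (c b) × Ups (not b) k (act x (c b))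

    walk-snoc : ∀ b k x → walk b (suc k) x ≡ act (walk b k x) (c (letterAt b k))
    walk-snoc b zero x = refl
    walk-snoc b (suc k) x = walk-snoc (not b) k (act x (c b))

    Ups-snoc : ∀ b k {x} → Ups b k x → Up (walk b k x) (c (letterAt b k)) → Ups b (suc k) x
    Ups-snoc b zero _ u = u , tt
    Ups-snoc b (suc k) (u , us) u′ = u , Ups-snoc (not b) k us u′

    Ups-≤ : ∀ b {k l x} → k ≤ l → Ups b l x → Ups b k x
    Ups-≤ b z≤n _ = tt
    Ups-≤ b (s≤s h) (u , us) = u , Ups-≤ (not b) h us

    Ups-last : ∀ b k {x} → Ups b (suc k) x → Up (walk b k x) (c (letterAt b k))
    Ups-last b zero (u , _) = u
    Ups-last b (suc k) (_ , us) = Ups-last (not b) k us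

    Alt-Ups : ∀ b k {x} g → Ups b k x → Alt b k g x ≡ g (walk b k x)
    Alt-Ups b zero g _ = refl
    Alt-Ups b (suc k) g (u , us) = trans (T-up _ u) (Alt-Ups (not b) k g us)

    ι-walk : ∀ b k {x} → ι x → ι (walk b k x)
    ι-walk b zero ix = ix
    ι-walk b (suc k) ix = ι-walk (not b) k (ι-act (c b) ix)

    len-walk : ∀ b k {x} → ι x → Ups b k x → len (walk b k x) ≡ k + k + len x
    len-walk b zero ix _ = refl
    len-walk b (suc k) {x} ix (u , us) = trans (len-walk (not b) k (ι-act (c b) ix) us)
      (trans (cong (k + k +_) (len-act-ascent (c b) ix (proj₁ u) (proj₂ u)))
        (solve 2 (λ k l → k :+ k :+ (con 2 :+ l) := con 1 :+ k :+ (con 1 :+ k) :+ l) refl k (len x)))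

    double-injective : ∀ k l {n} → k + k + n ≡ l + l + n → k ≡ l
    double-injective k l {n} h = ℕ.*-cancelˡ-≡ k l 2 (trans (solve 1 (λ k → con 2 :* k := k :+ k) refl k)
        (trans (ℕ.+-cancelʳ-≡ n _ _ h) (solve 1 (λ k → k :+ k := con 2 :* k) refl l)))

    walk-length-unique : ∀ b b′ k k′ {x} → ι x → Ups b k x → Ups b′ k′ x → walk b k x ≡ walk b′ k′ x → k ≡ k′
    walk-length-unique b b′ k k′ ix us us′ h = double-injective k k′
      (trans (sym (len-walk b k ix us)) (trans (cong len h) (len-walk b′ k′ ix us′)))

    Stop : Bool → ℕ → Fin N → Set
    Stop b k x = Ups b k x × (act (walk b k x) (c (letterAt b k)) ≡ walk b k x ⊎ Down (walk b k x) (c (letterAt b k)))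

    ascend : ∀ b {x} → ι x → ∃ λ k → Stop b k x
    ascend b {x} ix with climb N
      where
      climb : ∀ k → Ups b k x ⊎ ∃ λ k → Stop b k x
      climb zero = inj₁ tt
      climb (suc k) with climb k
      ... | inj₂ st = inj₂ st
      ... | inj₁ us with kind (walk b k x) (c (letterAt b k))
      ... | inj₁ f = inj₂ (k , us , inj₁ f)
      ... | inj₂ (inj₁ u) = inj₁ (Ups-snoc b k us u)
      ... | inj₂ (inj₂ d) = inj₂ (k , us , inj₂ d)
    ... | inj₂ st = st
    -- N consecutive ascents would add 2N to the length, but lengths stay below N.
    ... | inj₁ us = ⊥-elim (ℕ.<-irrefl refl (ℕ.≤-<-trans
            (subst (N ≤_) (sym (trans (len-walk b N ix us) (ℕ.+-assoc N N (len x)))) (ℕ.m≤m+n N (N + len x)))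
            (len-<N (walk b N x))))

    record Descent (y : Fin N) (z : Bool) : Set where
      constructor descends
      field
        bottom   : Fin N
        bottom-ι : ι bottom
        minimal  : JMin bottom
        first    : Bool
        steps    : ℕ
        ups      : Ups first (suc steps) bottom
        arrives  : walk first (suc steps) bottom ≡ y
        final    : letterAt first steps ≡ z

    -- Letters alternate of themselves: after a descent through one letter that letter is an ascent,
    -- so only the other one can be a descent, and if it is not, the element is J-minimal.
    descend : ∀ {y} z → ι y → Down y (c z) → Descent y z
    descend {y} z iy d = go y z (<-wellFounded (len y)) iy d
      where
      go : ∀ y z → Acc _<_ (len y) → ι y → Down y (c z) → Descent y z
      go y z (acc rec) iy d = extend (η y₁ (s (c (not z)))) refl
        where
        y₁ = act y (c z)
        iy₁ = ι-act (c z) iy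
        u = Down⇒Up d
        extend : ∀ b → η y₁ (s (c (not z))) ≡ b → Descent y z
        extend false h = descends y₁ iy₁ (bool-cases z (proj₂ u) h) z 0 (u , tt) (act-act y (c z)) refl
        extend true h = descends D.bottom D.bottom-ι D.minimal D.first (suc D.steps)
            (Ups-snoc D.first (suc D.steps) D.ups (subst₂ Up (sym D.arrives) (cong c (sym fin)) u))
            (trans (walk-snoc D.first (suc D.steps) D.bottom) (trans (cong₂ act D.arrives (cong c fin)) (act-act y (c z))))
            fin
          where
          D = go y₁ (not z) (rec (act-shorter iy d))
                iy₁ ((λ f → true≢false h (ι-fixed-ascent (c (not z)) iy₁ f)) , h)
          module D = Descent D
          fin : letterAt D.first (suc D.steps) ≡ z
          fin = trans (letterAt-not D.first D.steps) (trans (cong not D.final) (Bₚ.not-involutive z))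

    Linked : Fin N → Fin N → Set
    Linked x y = ∃ λ d → InJ d × θ d · y ≡ x · d

    linked-walk : ∀ b k x → Linked x (walk b k x)
    linked-walk b zero x = e , InJ-e , trans (cong (_· x) θ-e) (trans (identityˡ x) (sym (identityʳ x)))
    linked-walk b (suc k) x with linked-walk (not b) k (act x (c b))
    ... | d , D , h = s (c b) · d , InJ-· (InJ-s b) D , (begin
      θ (s (c b) · d) · y ≡⟨ trans (cong (_· y) (hom _ _)) (assoc _ _ _) ⟩
      θ (s (c b)) · (θ d · y) ≡⟨ cong (θ (s (c b)) ·_) h ⟩
      θ (s (c b)) · (act x (c b) · d)
        ≡⟨ grp (x ∷ d ∷ []) (θsᴵ (c b) ∷ sᴵ (c b) ∷ []) (P ∙ ((P ∙ X ∙ Q) ∙ Y)) (X ∙ (Q ∙ Y)) refl ⟩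
      x · (s (c b) · d) ∎)
      where
      y = walk (not b) k (act x (c b))

    linked-minima : ∀ {x x′ y} → ι x → ι x′ → JMin x → JMin x′ → Linked x y → Linked x′ y → x ≡ x′
    linked-minima {x} {x′} {y} ix ix′ m m′ (d , D , h) (d′ , D′ , h′) with InJ-· D (InJ-inv D′)
    ... | bs , dd′ = JMin-orbit-unique ix ix′ m m′ bs (d · inv d′) (bs , dd′) (begin
      x · evJ bs ≡⟨ trans (cong (x ·_) (sym dd′)) (sym (assoc _ _ _)) ⟩
      (x · d) · inv d′ ≡⟨ cong (_· inv d′) (sym h) ⟩
      θ d · y · inv d′ ≡⟨ grp (θ d ∷ y ∷ inv d′ ∷ []) [] (X ∙ Y ∙ Z) (X ∙ (Y ∙ Z)) refl ⟩
      θ d · (y · inv d′)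
        ≡⟨ cong (θ d ·_) (trans (grp (y ∷ d′ ∷ θ d′ ∷ []) [] (X ∙ Y ⁻¹) (Z ⁻¹ ∙ (Z ∙ X) ∙ Y ⁻¹) refl)
             (trans (cong (λ z → inv (θ d′) · z · inv d′) h′) (grp (x′ ∷ d′ ∷ θ d′ ∷ []) [] (Z ⁻¹ ∙ (X ∙ Y) ∙ Y ⁻¹) (Z ⁻¹ ∙ X) refl))) ⟩
      θ d · (inv (θ d′) · x′)
        ≡⟨ trans (sym (assoc _ _ _)) (cong (_· x′) (sym (trans (hom _ _) (cong (θ d ·_) (θ-inv d′))))) ⟩
      θ (d · inv d′) · x′ ∎)

    descend-to : ∀ {x y z} b k → ι x → JMin x → walk b k x ≡ y → Descent y z →
                 ∃ λ b′ → ∃ λ k′ → Ups b′ (suc k′) x × walk b′ (suc k′) x ≡ y × letterAt b′ k′ ≡ z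
    descend-to {x} {y} b k ix m w D = D.first , D.steps , subst (Ups D.first (suc D.steps)) eq D.ups
        , trans (cong (walk D.first (suc D.steps)) (sym eq)) D.arrives , D.final
      where
      module D = Descent D
      eq : D.bottom ≡ x
      eq = linked-minima D.bottom-ι ix D.minimal m
        (subst (Linked D.bottom) D.arrives (linked-walk D.first (suc D.steps) D.bottom)) (subst (Linked x) w (linked-walk b k x))

    -- Pulling the fixing generator back along the walk gives a reflection t of J with θ(t)x = xt,
    -- to which `fixed-inversion` applies.
    fixed-end : Commuting → ∀ {x} b k z → ι x → JMin x →
                act (walk b k x) (c z) ≡ walk b k x → ∃ λ b′ → act x (c b′) ≡ x
    fixed-end commute {x} b k z ix m f with linked-walk b k x
    ... | d , D , h = fixed-inversion commute ix m (TJ-conj D (base z)) (begin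
      θ (d · S · inv d) · x ≡⟨ cong₂ _·_ (θ-conj d S) x≡ ⟩
      (θ d · θ S · inv (θ d)) · (θ d · y · inv d)
        ≡⟨ grp (θ d ∷ y ∷ d ∷ []) (θsᴵ (c z) ∷ sᴵ (c z) ∷ []) ((X ∙ P ∙ X ⁻¹) ∙ (X ∙ Y ∙ Z ⁻¹)) (X ∙ (P ∙ Y ∙ Q) ∙ Q ∙ Z ⁻¹) refl ⟩
      θ d · act y (c z) · S · inv d ≡⟨ cong (λ u → θ d · u · S · inv d) f ⟩
      θ d · y · S · inv d ≡⟨ cong (λ u → u · S · inv d) h ⟩
      x · d · S · inv d ≡⟨ grp (x ∷ d ∷ S ∷ []) [] (X ∙ Y ∙ Z ∙ Y ⁻¹) (X ∙ (Y ∙ Z ∙ Y ⁻¹)) refl ⟩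
      x · (d · S · inv d) ∎)
      where
      S = s (c z)
      y = walk b k x
      x≡ : x ≡ θ d · y · inv d
      x≡ = trans (grp (x ∷ d ∷ []) [] X (X ∙ Y ∙ Y ⁻¹) refl) (cong (_· inv d) (sym h))

  -- Alternating words and the braid relation on ι(θ)

  actW : Fin N → Fin N → Fin N
  actW x w = θ (inv w) · x · w

  actW-· : ∀ x u v → actW x (u · v) ≡ actW (actW x u) v
  actW-· x u v = trans (cong (λ z → z · x · (u · v)) (trans (cong θ (inv-· u v)) (hom _ _)))
    (grp (θ (inv v) ∷ θ (inv u) ∷ x ∷ u ∷ v ∷ []) [] (X ∙ Y ∙ Z ∙ (V 3F ∙ V 4F)) (X ∙ (Y ∙ Z ∙ V 3F) ∙ V 4F) refl)

  actW-e : ∀ x → actW x e ≡ x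
  actW-e x = trans (identityʳ _) (trans (cong (_· x) (trans (cong θ inv-e) θ-e)) (identityˡ x))

  actW-s : ∀ x i → actW x (s i) ≡ act x i
  actW-s x i = cong (λ z → θ z · x · s i) (inv-s i)

  actW-injective : ∀ {x y} w → actW x w ≡ actW y w → x ≡ y
  actW-injective w h = ·-cancelˡ (θ (inv w)) (·-cancelʳ w h)

  actW-fixed-pow : ∀ {x p} → actW x p ≡ x → ∀ l → actW x (pow p l) ≡ x
  actW-fixed-pow h zero = actW-e _
  actW-fixed-pow {x} {p} h (suc l) = trans (actW-· x p (pow p l)) (trans (cong (λ z → actW z (pow p l)) h) (actW-fixed-pow h l))

  pow-* : ∀ p l n → pow p (l * n) ≡ pow (pow p n) l
  pow-* p zero n = refl
  pow-* p (suc l) n = trans (pow-+ p n (l * n)) (cong (pow p n ·_) (pow-* p l n))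

  module AlternatingWords (c : Bool → Fin r) where
    altWord : Bool → ℕ → Fin N
    altWord b zero = e
    altWord b (suc k) = s (c b) · altWord (not b) k

    altWord-rotation : ∀ k → altWord true k ≡ pow (s (c true) · s (c false)) k · altWord false k
    altWord-rotation zero = sym (identityˡ e)
    altWord-rotation (suc k) = begin
      b · altWord false k
        ≡⟨ grp (pow p k ∷ altWord false k ∷ []) (sᴵ (c true) ∷ sᴵ (c false) ∷ []) (P ∙ Y) ((P ∙ Q) ∙ (X ∙ X ⁻¹ ∙ (Q ∙ Y))) refl ⟩
      p · (pow p k · inv (pow p k) · (a · altWord false k))
        ≡⟨ cong (λ z → p · (pow p k · z · (a · altWord false k))) (sym (rotation-inverse (c true) (c false) k)) ⟩
      p · (pow p k · (a · pow p k · a) · (a · altWord false k))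
        ≡⟨ grp (pow p k ∷ altWord false k ∷ p ∷ []) (sᴵ (c false) ∷ []) (Z ∙ (X ∙ (P ∙ X ∙ P) ∙ (P ∙ Y))) ((Z ∙ X) ∙ (P ∙ (X ∙ Y))) refl ⟩
      pow p (suc k) · (a · (pow p k · altWord false k))
        ≡⟨ cong (λ z → pow p (suc k) · (a · z)) (sym (altWord-rotation k)) ⟩
      pow p (suc k) · altWord false (suc k) ∎
      where
      a = s (c false)
      b = s (c true)
      p = b · a

  module BraidRelation (commute : Commuting) (q : ℕ) (c : Bool → Fin r) where
    open Hecke q
    open Parabolic c
    open Rank2 q c
    open AlternatingWords c

    walk≡actW : ∀ b k x → walk b k x ≡ actW x (altWord b k)
    walk≡actW b zero x = sym (actW-e x)
    walk≡actW b (suc k) x = trans (walk≡actW (not b) k (act x (c b)))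
      (trans (cong (λ z → actW z (altWord (not b) k)) (sym (actW-s x (c b)))) (sym (actW-· x (s (c b)) _)))

    private p = s (c true) · s (c false)

    -- The two alternating words of length k differ by the k-th power of the rotation p. With the
    -- converse below, the two walks meet exactly at the exponents k for which p^k fixes x, that is,
    -- at the multiples of the least positive one.
    meets⇒fixed : ∀ k {x} → walk false k x ≡ walk true k x → actW x (pow p k) ≡ x
    meets⇒fixed k {x} h = actW-injective (altWord false k) (begin
      actW (actW x (pow p k)) (altWord false k) ≡⟨ sym (actW-· x _ _) ⟩
      actW x (pow p k · altWord false k)        ≡⟨ cong (actW x) (sym (altWord-rotation k)) ⟩
      actW x (altWord true k)                   ≡⟨ sym (walk≡actW true k x) ⟩
      walk true k x                             ≡⟨ sym h ⟩
      walk false k x                            ≡⟨ walk≡actW false k x ⟩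
      actW x (altWord false k)                  ∎)

    fixed⇒meets : ∀ k {x} → actW x (pow p k) ≡ x → walk false k x ≡ walk true k x
    fixed⇒meets k {x} h = sym (begin
      walk true k x                             ≡⟨ walk≡actW true k x ⟩
      actW x (altWord true k)                   ≡⟨ cong (actW x) (altWord-rotation k) ⟩
      actW x (pow p k · altWord false k)        ≡⟨ actW-· x _ _ ⟩
      actW (actW x (pow p k)) (altWord false k) ≡⟨ cong (λ z → actW z (altWord false k)) h ⟩
      actW x (altWord false k)                  ≡⟨ sym (walk≡actW false k x) ⟩
      walk false k x                            ∎)

    orient : ∀ b {k x} → walk b k x ≡ walk (not b) k x → walk false k x ≡ walk true k x
    orient false h = h
    orient true h = sym h

    orient⁻ : ∀ b {k x} → walk false k x ≡ walk true k x → walk b k x ≡ walk (not b) k x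
    orient⁻ false h = h
    orient⁻ true h = sym h

    -- The least positive length at which the two walks from x meet, together with the braid
    -- relation of that length. It is stored as `suc n` so that one can divide by it.
    record MinimalBraid (x : Fin N) : Set where
      field
        n     : ℕ
        braid : Braid (suc n) x
        meets : walk false (suc n) x ≡ walk true (suc n) x
        first : ∀ k → k < suc n → walk false k x ≡ walk true k x → k ≡ 0

    not≢ : ∀ b → ¬ not b ≡ b
    not≢ false ()
    not≢ true ()

    -- Descending from the top of a chain through the letter that did not lead there reaches x along the other chain.
    OtherSide : Bool → ℕ → Fin N → Set
    OtherSide b k x = ∃ λ k′ → k ≡ suc k′ × Ups (not b) (suc k′) x × walk (not b) (suc k′) x ≡ walk b k x

    other-side : ∀ b k {x} → ι x → JMin x → Ups b k x → Down (walk b k x) (c (letterAt b k)) → OtherSide b k x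
    other-side b k {x} ix m us d =
        let (b′ , k′ , us′ , w′ , l′) = descend-to b k ix m refl (descend (letterAt b k) (ι-walk b k ix) d)
        in choose b′ k′ us′ w′ l′ (walk-length-unique b b′ k (suc k′) ix us us′ (sym w′)) (b′ Bₚ.≟ b)
      where
      choose : ∀ b′ k′ → Ups b′ (suc k′) x → walk b′ (suc k′) x ≡ walk b k x → letterAt b′ k′ ≡ letterAt b k →
               k ≡ suc k′ → Dec (b′ ≡ b) → OtherSide b k x
      -- A chain of k steps starting with b ends with the letter opposite to `letterAt b k`, so the
      -- chain found by descending must start with the other letter.
      choose b′ k′ us′ w′ l′ k≡ (yes refl) = ⊥-elim (not≢ (letterAt b k)
        (trans (cong not (sym l′)) (trans (sym (letterAt-not b k′)) (cong (letterAt b) (sym k≡)))))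
      choose b′ k′ us′ w′ l′ k≡ (no ne) = k′ , k≡ , subst (λ b → Ups b (suc k′) x) (Bₚ.¬-not ne) us′
        , trans (cong (λ b → walk b (suc k′) x) (sym (Bₚ.¬-not ne))) w′

    both-fixed : ∀ {x} → (∀ b → act x (c b) ≡ x) → MinimalBraid x
    both-fixed {x} f = record
      { n = 0
      ; braid = λ b g → trans (T-fixed g (f b)) (sym (T-fixed g (f (not b))))
      ; meets = trans (f false) (sym (f true))
      ; first = λ { zero _ _ → refl ; (suc k) (s≤s ()) _ } }

    -- The chain through the other letter must end at an element fixed by its next letter, since
    -- `other-side` would make x rise through b. Both alternating products then climb the chain and
    -- pick up one factor t, at the bottom for one and at the top for the other.
    one-fixed : ∀ {x} b → ι x → JMin x → act x (c b) ≡ x → Up x (c (not b)) → MinimalBraid x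
    one-fixed {x} b ix m fb ub = go (ascend (not b) ix)
      where
      module _ (k : ℕ) (us : Ups (not b) k x) where
        braid : act (walk (not b) k x) (c (letterAt (not b) k)) ≡ walk (not b) k x → ∀ g → Alt b (suc k) g x ≡ Alt (not b) (suc k) g x
        braid f g = begin
          T (c b) (Alt (not b) k g) x ≡⟨ T-fixed _ fb ⟩
          suc q * Alt (not b) k g x ≡⟨ cong (suc q *_) (Alt-Ups (not b) k g us) ⟩
          suc q * g (walk (not b) k x) ≡⟨ sym (T-fixed g f) ⟩
          T (c (letterAt (not b) k)) g (walk (not b) k x) ≡⟨ sym (Alt-Ups (not b) k _ us) ⟩
          Alt (not b) k (T (c (letterAt (not b) k)) g) x ≡⟨ cong (λ h → h x) (sym (Alt-snoc (not b) k g)) ⟩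
          Alt (not b) (suc k) g x ∎
        first : ∀ j → j < suc k → walk false j x ≡ walk true j x → j ≡ 0
        first zero _ _ = refl
        first (suc j) (s≤s j<k) h = ⊥-elim (ℕ.1+n≢n (walk-length-unique (not b) (not b) (suc j) j ix
          (Ups-≤ (not b) j<k us) (Ups-≤ (not b) (ℕ.≤-trans (ℕ.n≤1+n j) j<k) us)
          (trans (sym (orient⁻ b {suc j} h)) (cong (walk (not b) j) fb))))
      go : (∃ λ k → Stop (not b) k x) → MinimalBraid x
      go (k , us , inj₁ f) = record
        { n = k
        ; braid = braid-at {suc k} b (braid k us f)
        ; meets = orient b {suc k} (trans (cong (walk (not b) k) fb) (sym (trans (walk-snoc (not b) k x) f)))
        ; first = first k us }
      go (k , us , inj₂ d) =
        let (k′ , _ , us′ , _) = other-side (not b) k ix m us d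
        in ⊥-elim (proj₁ (proj₁ us′) (subst (λ b → act x (c b) ≡ x) (sym (Bₚ.not-involutive b)) fb))

    -- By `fixed-end` the ascending chain cannot stop at a fixed element, so it stops at a descent,
    -- and `other-side` provides a second chain of equal length to the same top. Both products
    -- evaluate the functional there. An earlier meeting point would have its next letter both as an
    -- ascent and as a descent.
    both-up : ∀ {x} → ι x → JMin x → (∀ b → Up x (c b)) → MinimalBraid x
    both-up {x} ix m ups = go (ascend false ix)
      where
      module _ (k′ : ℕ) (us : Ups false (suc k′) x) (us′ : Ups true (suc k′) x) where
        first : ∀ j → j < suc k′ → walk false j x ≡ walk true j x → j ≡ 0
        first zero _ _ = refl
        first (suc j) j<k h = ⊥-elim (true≢false (proj₂ down) (proj₂ up))
          where
          up : Up (walk false (suc j) x) (c (letterAt true j))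
          up = Ups-last false (suc j) (Ups-≤ false j<k us)
          down : Down (walk false (suc j) x) (c (letterAt true j))
          down = subst (λ y → Down y (c (letterAt true j))) (trans (sym (walk-snoc true j x)) (sym h))
            (Up⇒Down (Ups-last true j (Ups-≤ true (ℕ.<⇒≤ j<k) us′)))
      top : ∀ k → Ups false k x → OtherSide false k x → MinimalBraid x
      top .(suc k′) us (k′ , refl , us′ , w′) = record
        { n = k′
        ; braid = braid-at {suc k′} false (λ g → trans (Alt-Ups false (suc k′) g us) (trans (cong g (sym w′)) (sym (Alt-Ups true (suc k′) g us′))))
        ; meets = sym w′
        ; first = first k′ us us′ }
      go : (∃ λ k → Stop false k x) → MinimalBraid x
      go (k , us , inj₁ f) = ⊥-elim (let (b , fb) = fixed-end commute false k _ ix m f in proj₁ (ups b) fb)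
      go (k , us , inj₂ d) = top k us (other-side false k ix m us d)

    minimal-braid : ∀ {x} → ι x → JMin x → MinimalBraid x
    minimal-braid {x} ix m = go (rises false) (rises true)
      where
      rises : ∀ b → act x (c b) ≡ x ⊎ Up x (c b)
      rises b with act x (c b) ≟ x
      ... | yes p = inj₁ p
      ... | no ¬p = inj₂ (¬p , m b)
      go : act x (c false) ≡ x ⊎ Up x (c false) → act x (c true) ≡ x ⊎ Up x (c true) → MinimalBraid x
      go (inj₁ f) (inj₁ f′) = both-fixed (bool-cases false f f′)
      go (inj₁ f) (inj₂ u) = one-fixed false ix m f u
      go (inj₂ u) (inj₁ f) = one-fixed true ix m f u
      go (inj₂ u) (inj₂ u′) = both-up ix m (bool-cases false u u′)

    -- The remainder of K modulo the minimal length is again a length at which the walks meet, hence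
    -- zero, and `braid-multiple` applies.
    braid-minimal : ∀ {x} K → ι x → JMin x → pow p K ≡ e → Braid K x
    braid-minimal {x} K ix m pK = subst (λ n → Braid n x) (sym K≡) (braid-multiple n′ (K / n′) M.braid)
      where
      module M = MinimalBraid (minimal-braid ix m)
      n′ = suc M.n
      multiple-fixes : actW x (pow p (K / n′ * n′)) ≡ x
      multiple-fixes = trans (cong (actW x) (pow-* p (K / n′) n′)) (actW-fixed-pow (meets⇒fixed n′ M.meets) (K / n′))
      remainder-fixes : actW x (pow p (K % n′)) ≡ x
      remainder-fixes = begin
        actW x (pow p (K % n′)) ≡⟨ cong (λ z → actW z (pow p (K % n′))) (sym multiple-fixes) ⟩
        actW (actW x (pow p (K / n′ * n′))) (pow p (K % n′)) ≡⟨ sym (actW-· x _ _) ⟩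
        actW x (pow p (K / n′ * n′) · pow p (K % n′))
          ≡⟨ cong (actW x) (trans (sym (pow-+ p (K / n′ * n′) (K % n′)))
               (trans (cong (pow p) (trans (ℕ.+-comm (K / n′ * n′) (K % n′)) (sym (m≡m%n+[m/n]*n K n′)))) pK)) ⟩
        actW x e ≡⟨ actW-e x ⟩
        x ∎
      K≡ : K ≡ K / n′ * n′
      K≡ = trans (m≡m%n+[m/n]*n K n′) (cong (_+ K / n′ * n′) (M.first (K % n′) (m%n<n K n′) (fixed⇒meets (K % n′) remainder-fixes)))

    -- Every element descends to a J-minimal one of its orbit, and `braid-act` carries the relation
    -- back up.
    braid-relation : ∀ {y} K → ι y → altWord false K ≡ altWord true K → Braid K y
    braid-relation {y} K iy h = go y (<-wellFounded (len y)) iy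
      where
      pK : pow p K ≡ e
      pK = ·-cancelʳ (altWord false K) (trans (sym (altWord-rotation K)) (trans (sym h) (sym (identityˡ _))))
      go : ∀ y → Acc _<_ (len y) → ι y → Braid K y
      go y (acc rec) iy = try (rise false (kind y (c false))) (rise true (kind y (c true)))
        where
        lower : ∀ b → Down y (c b) → Braid K y
        lower b d = subst (Braid K) (act-act y (c b)) (braid-act K b (go (act y (c b))
          (rec (act-shorter iy d)) (ι-act (c b) iy)))
        rise : ∀ b → act y (c b) ≡ y ⊎ Up y (c b) ⊎ Down y (c b) → η y (s (c b)) ≡ false ⊎ Down y (c b)
        rise b (inj₁ f) = inj₁ (ι-fixed-ascent (c b) iy f)
        rise b (inj₂ (inj₁ u)) = inj₁ (proj₂ u)
        rise b (inj₂ (inj₂ d)) = inj₂ d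
        try : η y (s (c false)) ≡ false ⊎ Down y (c false) → η y (s (c true)) ≡ false ⊎ Down y (c true) → Braid K y
        try (inj₂ d) _ = lower false d
        try (inj₁ _) (inj₂ d) = lower true d
        try (inj₁ h) (inj₁ h′) = braid-minimal K iy (bool-cases false h h′) pK

  -- Reduced words

  evL : List (Fin r) → Fin N
  evL = foldr (λ i x → s i · x) e

  Reduced : List (Fin r) → Set
  Reduced ws = len (evL ws) ≡ length ws

  len-evL : ∀ ws → len (evL ws) ≤ length ws
  len-evL [] = ℕ.≤-reflexive len-e
  len-evL (i ∷ ws) = ℕ.≤-trans (len-s· i (evL ws)) (s≤s (len-evL ws))

  reduced-tail : ∀ i ws → Reduced (i ∷ ws) → Reduced ws
  reduced-tail i ws h = ℕ.≤-antisym (len-evL ws) (ℕ.≤-pred (subst (_≤ suc (len (evL ws))) h (len-s· i (evL ws))))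

  reduced-head : ∀ i ws → Reduced (i ∷ ws) → η (inv (evL (i ∷ ws))) (s i) ≡ true
  reduced-head i ws h = not-false (λ h′ → ℕ.m≢1+n+m (length ws) {1} (begin
    length ws                      ≡⟨ sym (reduced-tail i ws h) ⟩
    len (evL ws)                   ≡⟨ cong len (grp (evL ws ∷ []) (sᴵ i ∷ []) X (P ∙ (P ∙ X)) refl) ⟩
    len (s i · evL (i ∷ ws))       ≡⟨ ascentˡ i (evL (i ∷ ws)) h′ ⟩
    suc (len (evL (i ∷ ws)))       ≡⟨ cong suc h ⟩
    suc (suc (length ws))          ∎))

  reduced-word : ∀ w → ∃ λ ws → evL ws ≡ w × length ws ≡ len w
  reduced-word w = go (len (inv w)) w refl
    where
    go : ∀ k w → len (inv w) ≡ k → ∃ λ ws → evL ws ≡ w × length ws ≡ len w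
    go zero w h = [] , sym w≡e , trans (sym len-e) (cong len (sym w≡e))
      where w≡e = trans (sym (inv-inv w)) (trans (cong inv (len-0 h)) inv-e)
    go (suc k) w h =
      let (i , y , eq , ly) = len-pred (inv w) h
          w≡ : w ≡ s i · inv y
          w≡ = trans (sym (inv-inv w)) (trans (cong inv eq) (trans (inv-· y (s i)) (cong (_· inv y) (inv-s i))))
          (ws , ev , l) = go k (inv y) (trans (cong len (inv-inv y)) ly)
      in i ∷ ws , trans (cong (s i ·_) ev) (sym w≡)
       , trans (cong suc (trans l (trans (len-inv y) ly))) (trans (sym h) (len-inv w))

  module LeftDescents (c : Bool → Fin r) where
    open Parabolic c
    open AlternatingWords c

    record Stripped (w : Fin N) (b : Bool) : Set where
      field
        k       : ℕ
        rest    : Fin N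
        product : w ≡ altWord b (suc k) · rest
        lengths : len w ≡ suc k + len rest
        minimal : JMin (inv rest)

    strip : ∀ w b → η (inv w) (s (c b)) ≡ true → Stripped w b
    strip w b h = go w b (<-wellFounded (len w)) h
      where
      go : ∀ w b → Acc _<_ (len w) → η (inv w) (s (c b)) ≡ true → Stripped w b
      go w b (acc rec) h = extend (η (inv w₁) (s (c (not b)))) refl
        where
        w₁ = s (c b) · w
        w≡ : w ≡ s (c b) · w₁
        w≡ = grp (w ∷ []) (sᴵ (c b) ∷ []) X (P ∙ (P ∙ X)) refl
        lw : len w ≡ suc (len w₁)
        lw = descentˡ (c b) w h
        here : η (inv w₁) (s (c b)) ≡ false
        here = trans (cong (λ z → η z (s (c b))) (inv-s· (c b) w)) (trans (η-·s-self (inv w) (c b)) (cong not h))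
        extend : ∀ x → η (inv w₁) (s (c (not b))) ≡ x → Stripped w b
        extend false h′ = record { k = 0 ; rest = w₁ ; product = trans w≡ (cong (_· w₁) (sym (identityʳ _)))
                                 ; lengths = lw ; minimal = bool-cases b here h′ }
        extend true h′ = record { k = suc R.k ; rest = R.rest
                                ; product = trans w≡ (trans (cong (s (c b) ·_) R.product) (sym (assoc _ _ _)))
                                ; lengths = trans lw (cong suc R.lengths) ; minimal = R.minimal }
          where module R = Stripped (go w₁ (not b) (rec (subst (len w₁ <_) (sym lw) (ℕ.n<1+n _))) h′)

    altWord-InJ : ∀ b k → InJ (altWord b k)
    altWord-InJ b zero = InJ-e
    altWord-InJ b (suc k) = InJ-· (InJ-s b) (altWord-InJ (not b) k)

    record CommonStrip (w : Fin N) : Set where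
      field
        k        : ℕ
        rest     : Fin N
        product  : ∀ b → w ≡ altWord b (suc k) · rest
        relation : altWord false (suc k) ≡ altWord true (suc k)
        lengths  : len w ≡ suc k + len rest

    -- Two left descents are stripped alternately, once starting with each letter. Both remainders
    -- are minimal in the same coset, hence equal, and comparing lengths shows that the two
    -- alternating prefixes form a braid relation.
    common-strip : ∀ w → (∀ b → η (inv w) (s (c b)) ≡ true) → CommonStrip w
    common-strip w h = record { k = F.k ; rest = F.rest ; lengths = F.lengths ; relation = trans words (cong (altWord true ∘ suc) (sym ks))
        ; product = λ { false → F.product ; true → trans F.product (cong (_· F.rest) (trans words (cong (altWord true ∘ suc) (sym ks)))) } }
      where
      module F = Stripped (strip w false (h false))
      module G = Stripped (strip w true (h true))
      aF = altWord false (suc F.k)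
      aG = altWord true (suc G.k)
      d = inv aF · aG
      u≡ : inv G.rest ≡ inv F.rest · d
      u≡ = trans (cong inv (·-cancelˡ aG (trans (sym G.product) (trans F.product
              (grp (aF ∷ F.rest ∷ aG ∷ []) [] (X ∙ Y) (Z ∙ (Z ⁻¹ ∙ X ∙ Y)) refl)))))
            (grp (aF ∷ F.rest ∷ aG ∷ []) [] ((Z ⁻¹ ∙ X ∙ Y) ⁻¹) (Y ⁻¹ ∙ (X ⁻¹ ∙ Z)) refl)
      d≡e : d ≡ e
      d≡e = JMin-coset-unique F.minimal (InJ-· (InJ-inv (altWord-InJ false (suc F.k))) (altWord-InJ true (suc G.k)))
              (subst JMin u≡ G.minimal)
      words : aF ≡ aG
      words = trans (sym (identityʳ aF)) (trans (cong (aF ·_) (sym d≡e)) (grp (aF ∷ aG ∷ []) [] (X ∙ (X ⁻¹ ∙ Y)) Y refl))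
      rests : G.rest ≡ F.rest
      rests = trans (sym (inv-inv G.rest)) (trans (cong inv (trans u≡ (trans (cong (inv F.rest ·_) d≡e) (identityʳ _)))) (inv-inv F.rest))
      ks : F.k ≡ G.k
      ks = ℕ.suc-injective (ℕ.+-cancelʳ-≡ (len F.rest) (suc F.k) (suc G.k)
             (trans (sym F.lengths) (trans G.lengths (cong (λ z → suc G.k + len z) rests))))

  -- The action of T_w and its independence of the reduced word

  module HeckeAction (commute : Commuting) (q : ℕ) where
    open Hecke q public

    Op : List (Fin r) → (Fin N → ℕ) → Fin N → ℕ
    Op [] g = g
    Op (i ∷ ws) g = T i (Op ws g)

    Op-++ : ∀ ws vs g → Op (ws ++ vs) g ≡ Op ws (Op vs g)
    Op-++ [] vs g = refl
    Op-++ (i ∷ ws) vs g = cong (T i) (Op-++ ws vs g)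

    Op-cong : ∀ ws {g h} → (∀ y → ι y → g y ≡ h y) → ∀ y → ι y → Op ws g y ≡ Op ws h y
    Op-cong [] p y iy = p y iy
    Op-cong (i ∷ ws) p y iy = T-cong i (Op-cong ws p y iy) (Op-cong ws p _ (ι-act i iy))

    Op-linear : ∀ ws α β g h x → Op ws (λ y → α * g y + β * h y) x ≡ α * Op ws g x + β * Op ws h x
    Op-linear [] α β g h x = refl
    Op-linear (i ∷ ws) α β g h x = trans (T-cong i (Op-linear ws α β g h x) (Op-linear ws α β g h _)) (T-linear i α β _ _ x)

    module DistinctHeads (i j : Fin r) where
      c : Bool → Fin r
      c false = i
      c true = j
      open AlternatingWords c
      open LeftDescents c
      open Rank2 q c
      open BraidRelation commute q c

      altList : Bool → ℕ → List (Fin r)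
      altList b zero = []
      altList b (suc k) = c b ∷ altList (not b) k

      evL-altList : ∀ b k ws → evL (altList b k ++ ws) ≡ altWord b k · evL ws
      evL-altList b zero ws = sym (identityˡ _)
      evL-altList b (suc k) ws = trans (cong (s (c b) ·_) (evL-altList (not b) k ws)) (sym (assoc _ _ _))

      length-altList : ∀ b k ws → length (altList b k ++ ws) ≡ k + length ws
      length-altList b zero ws = refl
      length-altList b (suc k) ws = cong suc (length-altList (not b) k ws)

      Op-altList : ∀ b k ws g → Op (altList b k ++ ws) g ≡ Alt b k (Op ws g)
      Op-altList b zero ws g = refl
      Op-altList b (suc k) ws g = cong (T (c b)) (Op-altList (not b) k ws g)

      module _ (w : Fin N) (h : ∀ b → η (inv w) (s (c b)) ≡ true) where
        private
          module S = CommonStrip (common-strip w h)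
          restWord = proj₁ (reduced-word S.rest)
          restWord-ev = proj₁ (proj₂ (reduced-word S.rest))
          restWord-length = proj₂ (proj₂ (reduced-word S.rest))

        tailWord : Bool → List (Fin r)
        tailWord b = altList (not b) S.k ++ restWord

        tailWord-ev : ∀ b ws → s (c b) · evL ws ≡ w → evL ws ≡ evL (tailWord b)
        tailWord-ev b ws p = ·-cancelˡ (s (c b)) (trans p (trans (S.product b) (trans (assoc _ _ _)
          (cong (s (c b) ·_) (sym (trans (evL-altList (not b) S.k restWord) (cong (altWord (not b) S.k ·_) restWord-ev)))))))

        tailWord-length : ∀ b → suc (length (tailWord b)) ≡ len w
        tailWord-length b = trans (cong suc (trans (length-altList (not b) S.k restWord) (cong (S.k +_) restWord-length))) (sym S.lengths)

        Op-tailWords : ∀ g y → ι y → T i (Op (tailWord false) g) y ≡ T j (Op (tailWord true) g) y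
        Op-tailWords g y iy = trans (cong (λ f → T i f y) (Op-altList true S.k restWord g))
          (trans (braid-relation (suc S.k) iy S.relation false (Op restWord g))
            (cong (λ f → T j f y) (sym (Op-altList false S.k restWord g))))

    -- The word property by induction on length. If the heads differ, both are left descents, and
    -- `common-strip` provides two further reduced words with these heads that differ by one braid
    -- relation; each given word is compared with the one sharing its head.
    Op-unique : ∀ ws ws′ → Reduced ws → Reduced ws′ → evL ws ≡ evL ws′ → ∀ g y → ι y → Op ws g y ≡ Op ws′ g y
    Op-unique ws ws′ R R′ h = go (length ws) ws ws′ refl (trans (sym R′) (trans (cong len (sym h)) R)) R R′ h
      where
      go : ∀ n ws ws′ → length ws ≡ n → length ws′ ≡ n → Reduced ws → Reduced ws′ → evL ws ≡ evL ws′ →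
           ∀ g y → ι y → Op ws g y ≡ Op ws′ g y
      go zero [] [] _ _ _ _ _ g y iy = refl
      go (suc n) (i ∷ is) (j ∷ js) l l′ R R′ h g y iy = heads (i ≟ j)
        where
        heads : Dec (i ≡ j) → T i (Op is g) y ≡ T j (Op js g) y
        heads (yes i≡j) = trans (T-cong i (tails y iy) (tails _ (ι-act i iy))) (cong (λ k → T k (Op js g) y) i≡j)
          where
          tails : ∀ y → ι y → Op is g y ≡ Op js g y
          tails = go n is js (ℕ.suc-injective l) (ℕ.suc-injective l′) (reduced-tail i is R) (reduced-tail j js R′)
                    (·-cancelˡ (s i) (trans h (cong (λ k → s k · evL js) (sym i≡j)))) g
        heads (no _) = trans (T-cong i (tails false is i-tail (reduced-tail i is R) refl y iy) (tails false is i-tail (reduced-tail i is R) refl _ (ι-act i iy)))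
            (trans (Op-tailWords w descents g y iy)
              (sym (T-cong j (tails true js j-tail (reduced-tail j js R′) (sym h) y iy) (tails true js j-tail (reduced-tail j js R′) (sym h) _ (ι-act j iy)))))
          where
          open DistinctHeads i j
          w = evL (i ∷ is)
          i-tail = ℕ.suc-injective l
          j-tail = ℕ.suc-injective l′
          descents : ∀ b → η (inv w) (s (c b)) ≡ true
          descents false = reduced-head i is R
          descents true = subst (λ z → η (inv z) (s j) ≡ true) (sym h) (reduced-head j js R′)
          lw : len w ≡ suc n
          lw = trans R l
          tails : ∀ b ws → length ws ≡ n → Reduced ws → s (c b) · evL ws ≡ w → ∀ y → ι y → Op ws g y ≡ Op (tailWord w descents b) g y
          tails b ws lws Rws p = go n ws (tailWord w descents b) lws tl Rws
              (trans (cong len (sym ev)) (trans Rws (trans lws (sym tl)))) ev g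
            where
            ev = tailWord-ev w descents b ws p
            tl = ℕ.suc-injective (trans (tailWord-length w descents b) lw)

    -- F w g is the value of the functional g at m_e T_w.
    F : Fin N → (Fin N → ℕ) → ℕ
    F w g = Op (proj₁ (reduced-word w)) g e

    F-word : ∀ ws → Reduced ws → ∀ g → F (evL ws) g ≡ Op ws g e
    F-word ws R g = Op-unique (proj₁ (reduced-word (evL ws))) ws
        (trans (cong len ev) (sym l)) R ev g e ι-e
      where
      ev = proj₁ (proj₂ (reduced-word (evL ws)))
      l = proj₂ (proj₂ (reduced-word (evL ws)))

    F-cong : ∀ w {g h} → (∀ y → ι y → g y ≡ h y) → F w g ≡ F w h
    F-cong w p = Op-cong (proj₁ (reduced-word w)) p e ι-e

    F-linear : ∀ w α β g h → F w (λ y → α * g y + β * h y) ≡ α * F w g + β * F w h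
    F-linear w α β g h = Op-linear (proj₁ (reduced-word w)) α β g h e

    F-e : ∀ g → F e g ≡ g e
    F-e g = F-word [] len-e g

    evL-++ : ∀ ws vs → evL (ws ++ vs) ≡ evL ws · evL vs
    evL-++ [] vs = sym (identityˡ _)
    evL-++ (i ∷ ws) vs = trans (cong (s i ·_) (evL-++ ws vs)) (sym (assoc _ _ _))

    F-ascent : ∀ w i g → η w (s i) ≡ false → F (w · s i) g ≡ F w (T i g)
    F-ascent w i g h = begin
      F (w · s i) g ≡⟨ cong (λ z → F z g) (sym ev′) ⟩
      F (evL (ws ++ i ∷ [])) g
        ≡⟨ F-word (ws ++ i ∷ []) (trans (cong len ev′) (trans (ascent w i h) (trans (cong suc (sym l))
             (sym (trans (Lₚ.length-++ ws) (ℕ.+-comm (length ws) 1)))))) g ⟩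
      Op (ws ++ i ∷ []) g e ≡⟨ cong (λ f → f e) (Op-++ ws (i ∷ []) g) ⟩
      F w (T i g) ∎
      where
      ws = proj₁ (reduced-word w)
      ev = proj₁ (proj₂ (reduced-word w))
      l = proj₂ (proj₂ (reduced-word w))
      ev′ : evL (ws ++ i ∷ []) ≡ w · s i
      ev′ = trans (evL-++ ws (i ∷ [])) (cong₂ _·_ ev (identityʳ (s i)))

    F-descent : ∀ w i g → η w (s i) ≡ true → F w g ≡ F (w · s i) (T i g)
    F-descent w i g h = trans (cong (λ z → F z g) (sym (len-s-self w i)))
      (F-ascent (w · s i) i g (trans (η-·s-self w i) (cong not h)))

  -- The eigenvector and the generating function of lengths

  inι⁻ : ∀ {x} → inι C θ x ≡ true → ι x
  inι⁻ {x} h = let (w , p) = anyFin⁻ (λ w → ⌊ θ (inv w) · w ≟ x ⌋) h in w , sym (⌊⌋-true⁻ p)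

  inι⁺ : ∀ {x} → ι x → inι C θ x ≡ true
  inι⁺ {x} (w , p) = anyFin⁺ (λ w → ⌊ θ (inv w) · w ≟ x ⌋) w (⌊⌋-true (sym p))

  ι-descent : ∀ {x} → ι x → ¬ x ≡ e → ∃ λ i → Down x i
  ι-descent {x} ix ne = let (i , d) = has-descent x ne in i , (λ f → true≢false d (ι-fixed-ascent i ix f)) , d

  ι-induction : (A : Fin N → Set) → A e → (∀ x i → ι x → Down x i → A (act x i) → A x) → ∀ {x} → ι x → A x
  ι-induction A base extend {x} ix = go x (<-wellFounded (len x)) ix
    where
    go : ∀ x → Acc _<_ (len x) → ι x → A x
    go x (acc rec) ix with x ≟ e
    ... | yes x≡e = subst A (sym x≡e) base
    ... | no ne = let (i , d) = ι-descent ix ne in extend x i ix d (go (act x i) (rec (act-shorter ix d)) (ι-act i ix))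

  descent-induction : (A : Fin N → Set) → A e → (∀ w i → η w (s i) ≡ true → A (w · s i) → A w) → ∀ w → A w
  descent-induction A base extend w = go w (<-wellFounded (len w))
    where
    go : ∀ w → Acc _<_ (len w) → A w
    go w (acc rec) with w ≟ e
    ... | yes w≡e = subst A (sym w≡e) base
    ... | no ne = let (i , d) = has-descent w ne in extend w i d (go (w · s i) (rec (exchange w (s i) d)))

  half : Fin N → ℕ
  half x = ℕ.⌊ len x /2⌋

  half-up : ∀ {x i} → ι x → Up x i → half (act x i) ≡ suc (half x)
  half-up {x} {i} ix u = cong ℕ.⌊_/2⌋ (len-act-ascent i ix (proj₁ u) (proj₂ u))

  half-down : ∀ {x i} → ι x → Down x i → half x ≡ suc (half (act x i))
  half-down {x} {i} ix d = cong ℕ.⌊_/2⌋ (len-act-descent i ix (proj₁ d) (proj₂ d))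

  module HeckeSums (commute : Commuting) (q : ℕ) where
    open HeckeAction commute q public

    t : ℕ
    t = suc q

    T-sum : ∀ i {n} (a : Fin n → ℕ) (h : Fin n → Fin N → ℕ) y →
            T i (λ z → sum (λ x → a x * h x z)) y ≡ sum (λ x → a x * T i (h x) y)
    T-sum i a h y = let (α , β , T≡) = T-coefficients y i in begin
      T i (λ z → sum (λ x → a x * h x z)) y ≡⟨ T≡ _ ⟩
      α * sum (λ x → a x * h x (act y i)) + β * sum (λ x → a x * h x y)
        ≡⟨ cong₂ _+_ (*-distribˡ-sum α (λ x → a x * h x (act y i))) (*-distribˡ-sum β (λ x → a x * h x y)) ⟩
      sum (λ x → α * (a x * h x (act y i))) + sum (λ x → β * (a x * h x y))
        ≡⟨ sym (∑-distrib-+ (λ x → α * (a x * h x (act y i))) (λ x → β * (a x * h x y))) ⟩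
      sum (λ x → α * (a x * h x (act y i)) + β * (a x * h x y))
        ≡⟨ sum-cong-≗ (λ x → trans
             (solve 5 (λ α β a u v → α :* (a :* u) :+ β :* (a :* v) := a :* (α :* u :+ β :* v)) refl α β (a x) (h x (act y i)) (h x y))
             (cong (a x *_) (sym (T≡ (h x))))) ⟩
      sum (λ x → a x * T i (h x) y) ∎

    Op-sum : ∀ ws {n} (a : Fin n → ℕ) (h : Fin n → Fin N → ℕ) y →
             Op ws (λ z → sum (λ x → a x * h x z)) y ≡ sum (λ x → a x * Op ws (h x) y)
    Op-sum [] a h y = refl
    Op-sum (i ∷ ws) a h y = trans (T-cong i (Op-sum ws a h y) (Op-sum ws a h _)) (T-sum i a (λ x → Op ws (h x)) y)

    δ-expansion : ∀ {n} (g : Fin n → ℕ) y → g y ≡ sum (λ x → g x * δ x y)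
    δ-expansion g y = sym (trans (sum-single (λ x → g x * δ x y) y (λ x ne → trans (cong (g x *_) (δ-distinct ne)) (ℕ.*-zeroʳ (g x))))
      (trans (cong (g y *_) (δ-same {x = y} refl)) (ℕ.*-identityʳ _)))

    F-expansion : ∀ w g → F w g ≡ sum (λ x → g x * F w (δ x))
    F-expansion w g = trans (F-cong w (λ y _ → δ-expansion g y)) (Op-sum (proj₁ (reduced-word w)) g δ e)

    F-scale : ∀ w α g → F w (λ y → α * g y) ≡ α * F w g
    F-scale w α g = trans (F-cong w (λ y _ → sym (ℕ.+-identityʳ (α * g y))))
      (trans (F-linear w α 0 g g) (ℕ.+-identityʳ _))

    total : (Fin N → ℕ) → ℕ
    total g = sum (λ w → F w g)

    ·s-permutation : Fin r → Permutation N N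
    ·s-permutation i = permutation (_· s i) (_· s i) (λ w → len-s-self w i) (λ w → len-s-self w i)

    -- The sum of all T_w is an eigenvector of T_s with eigenvalue t. The terms are split into `A`
    -- and `B` according to whether s is a descent of w, and w is replaced by ws where T_w T_s
    -- produces T_{ws}.
    total-T : ∀ i g → total (T i g) ≡ t * total g
    total-T i g = begin
      sum (λ w → F w (T i g)) ≡⟨ sum-cong-≗ pointwise ⟩
      sum (λ w → (t * B (w · s i) + q * A w) + A (w · s i))
        ≡⟨ trans (∑-distrib-+ (λ w → t * B (w · s i) + q * A w) (λ w → A (w · s i)))
             (cong (_+ sum (λ w → A (w · s i))) (∑-distrib-+ (λ w → t * B (w · s i)) (λ w → q * A w))) ⟩
      (sum (λ w → t * B (w · s i)) + sum (λ w → q * A w)) + sum (λ w → A (w · s i))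
        ≡⟨ cong₂ _+_ (cong₂ _+_ (trans (sym (*-distribˡ-sum t (λ w → B (w · s i)))) (cong (t *_) (sym (sum-permute B (·s-permutation i)))))
             (sym (*-distribˡ-sum q A))) (sym (sum-permute A (·s-permutation i))) ⟩
      (t * sum B + q * sum A) + sum A
        ≡⟨ solve 3 (λ q a b → (con 1 :+ q) :* b :+ q :* a :+ a := (con 1 :+ q) :* (a :+ b)) refl q (sum A) (sum B) ⟩
      t * (sum A + sum B) ≡⟨ cong (t *_) (trans (sym (∑-distrib-+ A B)) (sum-cong-≗ A+B)) ⟩
      t * total g ∎
      where
      A B : Fin N → ℕ
      A w = if η w (s i) then F w g else 0
      B w = if η w (s i) then 0 else F w g
      A+B : ∀ w → A w + B w ≡ F w g
      A+B w with η w (s i)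
      ... | true = ℕ.+-identityʳ _
      ... | false = refl
      pointwise : ∀ w → F w (T i g) ≡ (t * B (w · s i) + q * A w) + A (w · s i)
      pointwise w = by (η w (s i)) refl
        where
        by : ∀ b → η w (s i) ≡ b → F w (T i g) ≡ (t * B (w · s i) + q * A w) + A (w · s i)
        by b h rewrite trans (η-·s-self w i) (cong not h) | h with b
        ... | false = trans (sym (F-ascent w i g h)) (cong (_+ F (w · s i) g) (sym (cong₂ _+_ (ℕ.*-zeroʳ t) (ℕ.*-zeroʳ q))))
        ... | true = trans (F-descent w i (T i g) h) (trans (F-cong (w · s i) (λ y _ → T-quadratic i g y))
                (trans (F-linear (w · s i) t q g (T i g)) (trans (cong (λ z → t * F (w · s i) g + q * z) (sym (F-descent w i g h)))
                  (sym (ℕ.+-identityʳ _)))))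

    T-δ-far : ∀ {x i y} → ¬ x ≡ y → ¬ x ≡ act y i → T i (δ x) y ≡ 0
    T-δ-far {x} {i} {y} ne ne′ = let (α , β , T≡) = T-coefficients y i in trans (T≡ (δ x))
      (trans (cong₂ (λ a b → α * a + β * b) (δ-distinct ne′) (δ-distinct ne)) (cong₂ _+_ (ℕ.*-zeroʳ α) (ℕ.*-zeroʳ β)))

    t*δ-distinct : ∀ {x y : Fin N} → ¬ x ≡ y → t * δ x y ≡ 0
    t*δ-distinct ne = trans (cong (t *_) (δ-distinct ne)) (ℕ.*-zeroʳ t)

    T-δ-up : ∀ {x i} → Up x i → ∀ y → T i (δ x) y ≡ t * δ (act x i) y
    T-δ-up {x} {i} u y = by (act x i ≟ y) (x ≟ y)
      where
      by : Dec (act x i ≡ y) → Dec (x ≡ y) → T i (δ x) y ≡ t * δ (act x i) y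
      by (yes refl) _ = trans (T-down (δ x) (Up⇒Down u)) (trans
        (cong₂ (λ a b → t * a + q * b) (δ-same (sym (act-act x i))) (δ-distinct (proj₁ u ∘ sym)))
        (trans (cong (t * 1 +_) (ℕ.*-zeroʳ q)) (trans (ℕ.+-identityʳ _) (cong (t *_) (sym (δ-same {x = act x i} refl))))))
      by (no _) (yes refl) = trans (T-up (δ x) u) (trans (δ-distinct (proj₁ u ∘ sym)) (sym (t*δ-distinct (proj₁ u))))
      by (no ne) (no ne′) = trans (T-δ-far ne′ (λ h → ne (trans (cong (λ z → act z i) h) (act-act y i)))) (sym (t*δ-distinct ne))

    -- Up to the factor t, `δ x` is the image under `T i` of the delta of the lower element, so the
    -- quadratic relation gives the value; t is cancelled at the end.
    T-δ-down : ∀ {x i} → Down x i → ∀ y → T i (δ x) y ≡ 1 * δ (act x i) y + q * δ x y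
    T-δ-down {x} {i} d y = ℕ.*-cancelˡ-≡ _ _ t (begin
      t * T i (δ x) y ≡⟨ sym (trans (T-linear i t 0 (δ x) (δ x) y) (ℕ.+-identityʳ _)) ⟩
      T i (λ z → t * δ x z + 0) y ≡⟨ T-cong i (from-below y) (from-below (act y i)) ⟩
      T i (T i (δ x₁)) y ≡⟨ T-quadratic i (δ x₁) y ⟩
      t * δ x₁ y + q * T i (δ x₁) y
        ≡⟨ cong (λ u → t * δ x₁ y + q * u) (sym (trans (sym (ℕ.+-identityʳ _)) (from-below y))) ⟩
      t * δ x₁ y + q * (t * δ x y)
        ≡⟨ solve 3 (λ q a b → (con 1 :+ q) :* a :+ q :* ((con 1 :+ q) :* b) := (con 1 :+ q) :* (con 1 :* a :+ q :* b)) refl q (δ x₁ y) (δ x y) ⟩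
      t * (1 * δ x₁ y + q * δ x y) ∎)
      where
      x₁ = act x i
      from-below : ∀ z → t * δ x z + 0 ≡ T i (δ x₁) z
      from-below z = sym (trans (T-δ-up (Down⇒Up d) z) (trans (cong (λ u → t * δ u z) (act-act x i)) (sym (ℕ.+-identityʳ _))))

    T-δ-fixed : ∀ {x i} → act x i ≡ x → ∀ y → T i (δ x) y ≡ t * δ x y
    T-δ-fixed {x} {i} f y = by (x ≟ y)
      where
      by : Dec (x ≡ y) → T i (δ x) y ≡ t * δ x y
      by (yes refl) = T-fixed (δ x) f
      by (no ne) = trans (T-δ-far ne (λ h → ne (trans (sym f) (trans (cong (λ z → act z i) h) (act-act y i))))) (sym (t*δ-distinct ne))

    -- All coefficients of the eigenvector agree: `T i` sends the delta below x to t times that of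
    -- x, while `total-T` also multiplies by t.
    total-δ : ∀ {x} → ι x → total (δ x) ≡ total (δ e)
    total-δ = ι-induction (λ x → total (δ x) ≡ total (δ e)) refl (λ x i ix d ih → trans (ℕ.*-cancelˡ-≡ _ _ t (begin
      t * total (δ x) ≡⟨ *-distribˡ-sum t (λ w → F w (δ x)) ⟩
      sum (λ w → t * F w (δ x))
        ≡⟨ sum-cong-≗ (λ w → sym (trans (F-cong w (λ y _ → trans (T-δ-up (Down⇒Up d) y)
             (cong (λ z → t * δ z y) (act-act x i)))) (F-scale w t (δ x)))) ⟩
      total (T i (δ (act x i))) ≡⟨ total-T i (δ (act x i)) ⟩
      t * total (δ (act x i)) ∎)) ih)

    -- The functional m_x ↦ t^ρ(x), as `half` equals ρ on ι(θ) by `dist-ι`. The value 0 elsewhere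
    -- lets sums run over all of W.
    weight : Fin N → ℕ
    weight x = if inι C θ x then t ^ half x else 0

    weight-ι : ∀ {x} → ι x → weight x ≡ t ^ half x
    weight-ι ix = if-true (inι⁺ ix)

    T-weight : ∀ i y → ι y → T i weight y ≡ t * weight y
    T-weight i y iy with kind y i
    ... | inj₁ f = T-fixed weight f
    ... | inj₂ (inj₁ u) = trans (T-up weight u) (trans (weight-ι (ι-act i iy))
            (trans (cong (t ^_) (half-up iy u)) (cong (t *_) (sym (weight-ι iy)))))
    ... | inj₂ (inj₂ d) = trans (T-down weight d) (trans
            (cong (_+ q * weight y) (trans (cong (t *_) (weight-ι (ι-act i iy))) (sym (trans (weight-ι iy) (cong (t ^_) (half-down iy d))))))
            refl)

    F-weight : ∀ w → F w weight ≡ t ^ len w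
    F-weight = descent-induction (λ w → F w weight ≡ t ^ len w)
      (trans (F-e weight) (trans (weight-ι ι-e) (trans (cong (λ n → t ^ ℕ.⌊ n /2⌋) len-e) (cong (t ^_) (sym len-e)))))
      (λ w i d ih → trans (F-descent w i weight d) (trans (F-cong (w · s i) (T-weight i)) (trans (F-scale (w · s i) t weight)
        (trans (cong (t *_) ih) (cong (t ^_) (sym (descent w i d)))))))

    length-generating-function : sum (λ w → t ^ len w) ≡ sum weight * total (δ e)
    length-generating-function = begin
      sum (λ w → t ^ len w) ≡⟨ sum-cong-≗ (λ w → trans (sym (F-weight w)) (F-expansion w weight)) ⟩
      sum (λ w → sum (λ x → weight x * F w (δ x))) ≡⟨ ∑-comm (λ w x → weight x * F w (δ x)) ⟩
      sum (λ x → sum (λ w → weight x * F w (δ x)))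
        ≡⟨ sum-cong-≗ (λ x → trans (sym (*-distribˡ-sum (weight x) (λ w → F w (δ x)))) (on-ι x (inι C θ x) refl)) ⟩
      sum (λ x → weight x * total (δ e)) ≡⟨ sym (*-distribʳ-sum (total (δ e)) weight) ⟩
      sum weight * total (δ e) ∎
      where
      on-ι : ∀ x b → inι C θ x ≡ b → weight x * total (δ x) ≡ weight x * total (δ e)
      on-ι x true h = cong (weight x *_) (total-δ (inι⁻ h))
      on-ι x false h = trans (cong (_* total (δ x)) w0) (sym (cong (_* total (δ e)) w0))
        where
        w0 : weight x ≡ 0
        w0 = if-false h

  -- The coefficient of m_e in m_e T_w

  -- The supports of T_{s i} acting on the group algebra from the right and from the left.
  RightStep LeftStep : Fin r → Fin N → Fin N → Set
  RightStep i z z′ = z′ ≡ z · s i ⊎ (z′ ≡ z × η z (s i) ≡ true)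
  LeftStep k z z′ = z′ ≡ s k · z ⊎ (z′ ≡ z × η (inv z) (s k) ≡ true)

  -- The shadow, on supports, of the commuting left and right multiplications of the Hecke algebra.
  -- Moving and staying keep their sides except when `s k · z` equals `z · s i`; then they may have
  -- to trade places.
  steps-commute : ∀ k i {z z₁ z₂} → LeftStep k z z₁ → RightStep i z₁ z₂ → ∃ λ z′ → RightStep i z z′ × LeftStep k z′ z₂
  steps-commute k i {z} (inj₁ refl) (inj₁ refl) = z · s i , inj₁ refl , inj₁ (assoc _ _ _)
  steps-commute k i {z} (inj₁ refl) (inj₂ (refl , d)) = by (η z (s i)) refl
    where
    by : ∀ b → η z (s i) ≡ b → ∃ λ z′ → RightStep i z z′ × LeftStep k z′ (s k · z)
    by true h = z , inj₂ (refl , h) , inj₁ refl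
    by false h = z · s i , inj₁ refl , inj₂ (sym same , trans (cong (λ u → η u (s k)) (trans (cong inv same) (inv-s· k z)))
        (trans (η-·s-self (inv z) k) (cong not ascends)))
      where
      same : z · s i ≡ s k · z
      same = trans (grp (z ∷ s i ∷ []) [] (X ∙ Y) (X ∙ Y ∙ X ⁻¹ ∙ X) refl)
        (cong (_· z) (⌊⌋-true⁻ (trans (sym (trans (cong (⌊ z · s i · inv z ≟ s k ⌋ xor_) h) (Bₚ.xor-identityʳ _))) (trans (sym (η-s· k z (s i))) d))))
      ascends : η (inv z) (s k) ≡ false
      ascends = not-true (λ h′ → ℕ.m≢1+n+m (len z) {1} (trans (descentˡ k z h′) (cong suc (trans (cong len (sym same)) (ascent z i h)))))
  steps-commute k i {z} (inj₂ (refl , d)) (inj₁ refl) = by (s k · z ≟ z · s i)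
    where
    by : Dec (s k · z ≡ z · s i) → ∃ λ z′ → RightStep i z z′ × LeftStep k z′ (z · s i)
    by (yes p) = z , inj₂ (refl , not-false (λ h → ℕ.m≢1+n+m (len z) {1}
          (trans (descentˡ k z d) (cong suc (trans (cong len p) (ascent z i h)))))) , inj₁ (sym p)
    by (no ¬p) = z · s i , inj₁ refl , inj₂ (refl , trans (cong (λ u → η u (s k)) (trans (inv-· z (s i)) (cong (_· inv z) (inv-s i))))
        (trans (η-s· i (inv z) (s k)) (cong₂ _xor_ (⌊⌋-false (λ h → ¬p
          (trans (grp (z ∷ s k ∷ []) [] (Y ∙ X) (X ∙ (X ⁻¹ ∙ Y ∙ X ⁻¹ ⁻¹)) refl) (cong (z ·_) h)))) d)))
  steps-commute k i {z} (inj₂ (refl , d)) (inj₂ (refl , d′)) = z , inj₂ (refl , d′) , inj₂ (refl , d)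

  data LeftPath : List (Fin r) → Fin N → Fin N → Set where
    []  : ∀ {z} → LeftPath [] z z
    _∷_ : ∀ {i ws z z₁ z′} → LeftStep (θi i) z z₁ → LeftPath ws z₁ z′ → LeftPath (i ∷ ws) z z′

  leftPath-snoc : ∀ {ws z z₁ z′ i} → LeftPath ws z z₁ → LeftStep (θi i) z₁ z′ → LeftPath (ws ++ i ∷ []) z z′
  leftPath-snoc [] l = l ∷ []
  leftPath-snoc (l′ ∷ ls) l = l′ ∷ leftPath-snoc ls l

  leftPath-commute : ∀ i {ws z z₁ z₂} → LeftPath ws z z₁ → RightStep i z₁ z₂ → ∃ λ z′ → RightStep i z z′ × LeftPath ws z′ z₂
  leftPath-commute i [] ρ = _ , ρ , []
  leftPath-commute i (l ∷ ls) ρ =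
    let (_ , ρ₁ , ls′) = leftPath-commute i ls ρ
        (_ , ρ₂ , l′) = steps-commute _ i l ρ₁
    in _ , ρ₂ , l′ ∷ ls′

  leftStep-len : ∀ k {z z′} → LeftStep k z z′ → len z ≤ suc (len z′)
  leftStep-len k {z} (inj₁ refl) = subst (λ u → len u ≤ suc (len (s k · z))) (grp (z ∷ []) (sᴵ k ∷ []) (P ∙ (P ∙ X)) X refl) (len-s· k (s k · z))
  leftStep-len k (inj₂ (refl , _)) = ℕ.n≤1+n _

  leftPath-len : ∀ {ws z z′} → LeftPath ws z z′ → len z ≤ length ws + len z′
  leftPath-len [] = ℕ.≤-refl
  leftPath-len (l ∷ ls) = ℕ.≤-trans (leftStep-len _ l) (s≤s (leftPath-len ls))

  -- A step shortens by at most one, so no step of such a path can stay, and the path multiplies by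
  -- every letter.
  leftPath-tight : ∀ {ws z z′} → LeftPath ws z z′ → len z ≡ length ws + len z′ → z ≡ θ (evL ws) · z′
  leftPath-tight {z′ = z′} [] _ = sym (trans (cong (_· z′) θ-e) (identityˡ z′))
  leftPath-tight {i ∷ ws} {z} {z′} (inj₁ refl ∷ ls) h = begin
    z ≡⟨ grp (z ∷ []) (sᴵ (θi i) ∷ []) X (P ∙ (P ∙ X)) refl ⟩
    s (θi i) · (s (θi i) · z)
      ≡⟨ cong (s (θi i) ·_) (leftPath-tight ls (ℕ.≤-antisym (leftPath-len ls) (ℕ.≤-pred (subst (_≤ suc (len (s (θi i) · z))) h (leftStep-len (θi i) {z} (inj₁ refl)))))) ⟩
    s (θi i) · (θ (evL ws) · z′)
      ≡⟨ trans (sym (assoc _ _ _)) (cong (_· z′) (trans (cong (_· θ (evL ws)) (s-θi i)) (sym (hom _ _)))) ⟩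
    θ (evL (i ∷ ws)) · z′ ∎
  leftPath-tight (inj₂ (refl , _) ∷ ls) h = ⊥-elim (ℕ.<-irrefl h (s≤s (leftPath-len ls)))

  module FixedElements (commute : Commuting) (q : ℕ) where
    open HeckeSums commute q public

    -- Ways in which m_z can occur in m_y T_ws: each letter moves the element or, at a descent, may
    -- leave it in place.
    data ModulePath : List (Fin r) → Fin N → Fin N → Set where
      []   : ∀ {y} → ModulePath [] y y
      move : ∀ {i ws y z} → ModulePath ws (act y i) z → ModulePath (i ∷ ws) y z
      stay : ∀ {i ws y z} → η y (s i) ≡ true → ModulePath ws y z → ModulePath (i ∷ ws) y z

    module-path : ∀ ws {x y} → ι y → ¬ Op ws (δ x) y ≡ 0 → ModulePath ws y x
    module-path [] {x} {y} iy h with x ≟ y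
    ... | yes refl = []
    ... | no _ = ⊥-elim (h refl)
    module-path (i ∷ ws) {x} {y} iy h = by (kind y i) (Op ws (δ x) (act y i) ℕ.≟ 0) (Op ws (δ x) y ℕ.≟ 0)
      where
      g = Op ws (δ x)
      by : act y i ≡ y ⊎ Up y i ⊎ Down y i → Dec (g (act y i) ≡ 0) → Dec (g y ≡ 0) → ModulePath (i ∷ ws) y x
      by _ (no ne) _ = move (module-path ws (ι-act i iy) ne)
      by (inj₁ f) (yes z) _ = ⊥-elim (h (trans (T-fixed g f) (trans (cong (λ u → t * g u) (sym f)) (trans (cong (t *_) z) (ℕ.*-zeroʳ t)))))
      by (inj₂ (inj₁ u)) (yes z) _ = ⊥-elim (h (trans (T-up g u) z))
      by (inj₂ (inj₂ d)) (yes z) (yes z′) = ⊥-elim (h (trans (T-down g d) (trans (cong₂ (λ a b → t * a + q * b) z z′) (cong₂ _+_ (ℕ.*-zeroʳ t) (ℕ.*-zeroʳ q)))))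
      by (inj₂ (inj₂ d)) (yes z) (no ne) = stay (proj₂ d) (module-path ws iy ne)

    -- Each step in the module refines a left step by θ s followed by a right step by s; the right steps are moved
    -- to the front, where they are forced to be ascents because the word is reduced.
    separate : ∀ us ws {w y z} → ι y → ModulePath ws y z → LeftPath us w y → len (w · evL ws) ≡ len w + length ws →
               LeftPath (us ++ ws) (w · evL ws) z
    separate us [] {w} {y} iy [] ls R = subst₂ (λ vs v → LeftPath vs v y) (sym (Lₚ.++-identityʳ us)) (sym (identityʳ w)) ls
    separate us (i ∷ ws) {w} {y} {z} iy path ls R = step path
      where
      shift : w · s i · evL ws ≡ w · evL (i ∷ ws)
      shift = assoc _ _ _
      ascends : η w (s i) ≡ false
      ascends = not-true (λ d → ℕ.<⇒≱ (ℕ.+-mono-< (exchange w (s i) d) (ℕ.n<1+n (length ws)))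
        (subst (_≤ len (w · s i) + length ws) (trans (cong len shift) R) (ℕ.≤-trans (len-· (w · s i) (evL ws)) (ℕ.+-monoʳ-≤ (len (w · s i)) (len-evL ws)))))
      R′ : len (w · s i · evL ws) ≡ len (w · s i) + length ws
      R′ = trans (cong len shift) (trans R (trans (ℕ.+-suc _ _) (cong (_+ length ws) (sym (ascent w i ascends)))))
      continue : ∀ {y₁ y₂} → ι y₂ → ModulePath ws y₂ z → LeftStep (θi i) y y₁ → RightStep i y₁ y₂ → LeftPath (us ++ i ∷ ws) (w · evL (i ∷ ws)) z
      continue iy₂ path′ l ρ with leftPath-commute i (leftPath-snoc ls l) ρ
      ... | _ , inj₂ (_ , d) , _ = ⊥-elim (true≢false d ascends)
      ... | _ , inj₁ refl , ls′ = subst₂ (λ vs v → LeftPath vs v z) (Lₚ.++-assoc us (i ∷ []) ws) shift (separate (us ++ i ∷ []) ws iy₂ path′ ls′ R′)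
      step : ModulePath (i ∷ ws) y z → LeftPath (us ++ i ∷ ws) (w · evL (i ∷ ws)) z
      step (move path′) = continue (ι-act i iy) path′ (inj₁ refl) (inj₁ (act≡ y i))
      step (stay d path′) = continue iy path′ (inj₂ (refl , trans (ι-balanced i iy) d)) (inj₂ (refl , d))

    φ : Fin N → ℕ
    φ w = F w (δ e)

    -- A nonzero coefficient provides a module path from e to e. Separated, it becomes a left path
    -- from w to e with ℓ(w) steps, which is tight and forces w = θ(w).
    φ-unfixed : ∀ {w} → ¬ θ w ≡ w → φ w ≡ 0
    φ-unfixed {w} ne with φ w ℕ.≟ 0
    ... | yes p = p
    ... | no p = ⊥-elim (ne (trans (cong θ (sym ev)) (trans (sym (identityʳ _)) (trans (sym tight) ev))))
      where
      ws = proj₁ (reduced-word w)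
      ev = proj₁ (proj₂ (reduced-word w))
      l = proj₂ (proj₂ (reduced-word w))
      path : LeftPath ws (e · evL ws) e
      path = separate [] ws ι-e (module-path ws ι-e p) []
        (trans (cong len (trans (identityˡ _) ev)) (trans (sym l) (cong (_+ length ws) (sym len-e))))
      tight : evL ws ≡ θ (evL ws) · e
      tight = trans (sym (identityˡ _)) (leftPath-tight path (trans (cong len (trans (identityˡ _) ev))
        (trans (sym l) (sym (trans (cong (length ws +_) len-e) (ℕ.+-identityʳ _))))))

    act-e-θi : ∀ i → act e (θi i) ≡ act e i
    act-e-θi i = trans (act-e (θi i)) (trans (cong₂ _·_ (cong s (θi-θi i)) (s-θi i))
      (trans (commute i) (trans (cong (_· s i) (sym (s-θi i))) (sym (act-e i)))))

    fixed-simple⇒act-e : ∀ {i} → θ (s i) ≡ s i → act e i ≡ e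
    fixed-simple⇒act-e {i} h = trans (act-e i) (trans (cong (_· s i) (trans (s-θi i) h)) (s-invol i))

    φ-fixed-simple : ∀ f i → θ (s i) ≡ s i → η f (s i) ≡ false → φ (f · s i) ≡ t * φ f
    φ-fixed-simple f i θs h = trans (F-ascent f i (δ e) h)
      (trans (F-cong f (λ y _ → T-δ-fixed (fixed-simple⇒act-e θs) y)) (F-scale f t (δ e)))

    -- The two letters of w_J contribute a single factor t: read back from e, one of them rises to
    -- θ(s)s with factor t and the other returns to e with factor 1.
    φ-commuting-pair : ∀ f i → ¬ θ (s i) ≡ s i → θ f ≡ f → η f (s i) ≡ false → φ (f · s i · θ (s i)) ≡ t * φ f
    φ-commuting-pair f i θs≢ θf h = begin
      φ (f · s i · θ (s i)) ≡⟨ cong (λ z → φ (f · s i · z)) (sym (s-θi i)) ⟩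
      F (f · s i · s j) (δ e) ≡⟨ F-ascent (f · s i) j (δ e) hⱼ′ ⟩
      F (f · s i) (T j (δ e)) ≡⟨ F-cong (f · s i) (λ y _ → T-δ-up eⱼ y) ⟩
      F (f · s i) (λ y → t * δ (act e j) y) ≡⟨ F-scale (f · s i) t (δ (act e j)) ⟩
      t * F (f · s i) (δ (act e j)) ≡⟨ cong (t *_) (F-ascent f i (δ (act e j)) h) ⟩
      t * F f (T i (δ (act e j))) ≡⟨ cong (t *_) (F-cong f (λ y _ → T-δ-down down y)) ⟩
      t * F f (λ y → 1 * δ (act (act e j) i) y + q * δ (act e j) y)
        ≡⟨ cong (t *_) (F-linear f 1 q (δ (act (act e j) i)) (δ (act e j))) ⟩
      t * (1 * F f (δ (act (act e j) i)) + q * F f (δ (act e j)))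
        ≡⟨ cong (t *_) (cong₂ _+_ (trans (ℕ.*-identityˡ _) (cong (F f ∘ δ) back)) (trans (cong (q *_) vanishes) (ℕ.*-zeroʳ q))) ⟩
      t * (φ f + 0) ≡⟨ cong (t *_) (ℕ.+-identityʳ _) ⟩
      t * φ f ∎
      where
      j = θi i
      eⱼ : Up e j
      eⱼ = act-e-up (λ p → θs≢ (trans (sym (s-θi i)) (cong s (trans (sym p) (θi-θi i)))))
      hⱼ : η f (s j) ≡ false
      hⱼ = trans (cong₂ η (sym θf) (s-θi i)) (trans (η-θ f (s i)) h)
      hⱼ′ : η (f · s i) (s j) ≡ false
      hⱼ′ = trans (η-·s f i (s j)) (cong₂ _xor_ (trans (cong (η f) (trans (cong (λ z → s i · z · s i) (s-θi i))
              (trans (cong (_· s i) (commute i)) (trans (len-s-self (θ (s i)) i) (sym (s-θi i)))))) hⱼ)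
              (⌊⌋-false (λ p → θs≢ (trans (sym (s-θi i)) p))))
      down : Down (act e j) i
      down = subst (λ z → Down z i) (sym (act-e-θi i)) (Up⇒Down (act-e-up (λ p → θs≢ (trans (sym (s-θi i)) (cong s p)))))
      back : act (act e j) i ≡ e
      back = trans (cong (λ z → act z i) (act-e-θi i)) (act-act e i)
      -- Multiplied by t this is the coefficient `φ (f · s j)`, and `f · s j` is not θ-fixed.
      vanishes : F f (δ (act e j)) ≡ 0
      vanishes = ℕ.*-cancelˡ-≡ _ _ t (trans (sym (trans (F-cong f (λ y _ → T-δ-up eⱼ y)) (F-scale f t (δ (act e j)))))
        (trans (sym (F-ascent f j (δ e) hⱼ)) (trans (φ-unfixed (λ p → θs≢ (·-cancelˡ f
          (trans (cong (_· θ (s i)) (sym θf)) (trans (sym (hom f (s i))) (unfix p)))))) (sym (ℕ.*-zeroʳ t)))))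
        where
        unfix : θ (f · s j) ≡ f · s j → θ (f · s i) ≡ f · s i
        unfix p = trans (hom f (s i)) (trans (cong₂ _·_ θf (sym (s-θi i))) (trans (sym p)
          (trans (hom f (s j)) (cong₂ _·_ θf (θ-s-θi i)))))

  -- Longest elements and the three distance functions

  pair : Fin r → Bool → Fin r
  pair i false = i
  pair i true = θi i

  module Pair (i : Fin r) where
    open Parabolic (pair i) public
    private
      module DJ = DistProperties (stepJ C θ i) e
      reachJ = Dist.reach (stepJ C θ i) e

    reach⇒InJ : ∀ k {g} → reachJ k g ≡ true → InJ g
    reach⇒InJ = DJ.reach-induction (λ _ → InJ) InJ-e (λ _ _ h → h) (λ _ x g h st → letter h (∨-true⁻ {⌊ g ≟ x · s i ⌋} st))
      where
      letter : ∀ {x g} → InJ x → ⌊ g ≟ x · s i ⌋ ≡ true ⊎ ⌊ g ≟ x · θ (s i) ⌋ ≡ true → InJ g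
      letter h (inj₁ p) = subst InJ (sym (⌊⌋-true⁻ p)) (InJ-· h (InJ-s false))
      letter {x} h (inj₂ p) = subst InJ (sym (trans (⌊⌋-true⁻ p) (cong (x ·_) (sym (s-θi i))))) (InJ-· h (InJ-s true))

    inWJ⁻ : ∀ {g} → inWJ C θ i g ≡ true → InJ g
    inWJ⁻ = reach⇒InJ N

    inWJ⁺ : ∀ {g} → InJ g → inWJ C θ i g ≡ true
    inWJ⁺ {g} (bs , refl) = DJ.reach⇒reach-N (length bs) (go bs)
      where
      go : ∀ bs → reachJ (length bs) (evJ bs) ≡ true
      go [] = ⌊⌋-true refl
      go (false ∷ bs) = DJ.reach-step (length bs) (go bs) (∨-true⁺ˡ (⌊⌋-true {a = evJ bs · s i} refl))
      go (true ∷ bs) = DJ.reach-step (length bs) (go bs)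
        (∨-true⁺ʳ {⌊ evJ bs · s (θi i) ≟ evJ bs · s i ⌋} (⌊⌋-true (cong (evJ bs ·_) (s-θi i))))

    Longest : Fin N → Set
    Longest g = InJ g × (∀ h → InJ h → len h ≤ len g)

    isLongest⁻ : ∀ {g} → isLongest C θ i g ≡ true → Longest g
    isLongest⁻ {g} h = inWJ⁻ (proj₁ (∧-true⁻ h)) , λ d D → bound d (inWJ⁺ D)
        (allFin?⁻ (λ h → not (inWJ C θ i h) ∨ (ℓ C θ h ≤ᵇ ℓ C θ g)) (proj₂ (∧-true⁻ {inWJ C θ i g} h)) d)
      where
      bound : ∀ d → inWJ C θ i d ≡ true → (not (inWJ C θ i d) ∨ (ℓ C θ d ≤ᵇ ℓ C θ g)) ≡ true → len d ≤ len g
      bound d D p = subst₂ _≤_ (sym (len≡ d)) (sym (len≡ g)) (ℕ.≤ᵇ⇒≤ _ _ (subst Bool.T (sym (trans (sym (cong (λ b → not b ∨ (ℓ C θ d ≤ᵇ ℓ C θ g)) D)) p)) tt))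

    isLongest⁺ : ∀ {g} → Longest g → isLongest C θ i g ≡ true
    isLongest⁺ {g} (D , h) = ∧-true⁺ (inWJ⁺ D) (allFin?⁺ _ (λ d → bound d (inWJ C θ i d) refl))
      where
      T⇒≡ : ∀ {b} → Bool.T b → b ≡ true
      T⇒≡ {true} _ = refl
      bound : ∀ d b → inWJ C θ i d ≡ b → (not (inWJ C θ i d) ∨ (ℓ C θ d ≤ᵇ ℓ C θ g)) ≡ true
      bound d false p = ∨-true⁺ˡ (cong not p)
      bound d true p = ∨-true⁺ʳ {not (inWJ C θ i d)} (T⇒≡ (ℕ.≤⇒≤ᵇ (subst₂ _≤_ (len≡ d) (len≡ g) (h d (inWJ⁻ p)))))

    InJ? : ∀ g → Dec (InJ g)
    InJ? g = by (inWJ C θ i g) refl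
      where
      by : ∀ b → inWJ C θ i g ≡ b → Dec (InJ g)
      by true p = yes (inWJ⁻ p)
      by false p = no (λ D → true≢false (inWJ⁺ D) p)

    longest : ∃ Longest
    -- The fuel k keeps N below k + 1 + ℓ(g): each improvement costs one unit and gains at least one
    -- in length, and no length reaches N.
    longest = go N e InJ-e (subst (N <_) (sym (ℕ.+-comm N (suc (len e)))) (s≤s (ℕ.m≤n+m N (len e))))
      where
      go : ∀ k g → InJ g → N < k + suc (len g) → ∃ Longest
      go zero g D h = ⊥-elim (ℕ.<⇒≱ h (len-<N g))
      go (suc k) g D h = by (Fₚ.any? (λ d → InJ? d ×-dec (len g <? len d)))
        where
        by : Dec (∃ λ d → InJ d × len g < len d) → ∃ Longest
        by (yes (d , D′ , g<d)) = go k d D′ (ℕ.<-≤-trans h (subst (_≤ k + suc (len d)) (ℕ.+-suc k (suc (len g))) (ℕ.+-monoʳ-≤ k (s≤s g<d))))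
        by (no ¬p) = g , D , λ d D′ → ℕ.≮⇒≥ (λ g<d → ¬p (d , D′ , g<d))

    -- Otherwise t would be an inversion of `g · t`, and exchange would make `g · t` longer than g
    -- inside W_J.
    longest-inversions : ∀ {g t} → Longest g → TJ t → η g t ≡ true
    longest-inversions {g} {t} (D , h) T = not-false (λ p → ℕ.<⇒≱ (subst (λ z → len z < len (g · t))
        (grp (g ∷ []) ((t , reflection-involutive R) ∷ []) (X ∙ P ∙ P) X refl)
        (exchange (g · t) t (trans (η-· g t t) (cong₂ _xor_ (trans (cong (η g) conj-self) p) η-self))))
        (h (g · t) (InJ-· D (TJ⇒InJ T))))
      where
      R = TJ-reflection T
      conj-self : t · t · inv t ≡ t
      conj-self = grp (t ∷ []) [] (X ∙ X ∙ X ⁻¹) X refl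
      η-self : η t t ≡ true
      η-self = subst (λ u → η u u ≡ true) (sym (proj₂ (proj₂ R))) (η-conj-self (proj₁ R) (proj₁ (proj₂ R)))

    -- In d = g x the factor g inverts every reflection of J, so x has no J-descent and is trivial.
    full⇒longest : ∀ {g d} → Longest g → InJ d → (∀ b → η d (s (pair i b)) ≡ true) → d ≡ g
    full⇒longest {g} {d} L D full = trans d≡ (trans (cong (g ·_) (InJ-JMin X-J minimal)) (identityʳ g))
      where
      x = inv g · d
      X-J = InJ-· (InJ-inv (proj₁ L)) D
      d≡ : d ≡ g · x
      d≡ = grp (g ∷ d ∷ []) [] Y (X ∙ (X ⁻¹ ∙ Y)) refl
      minimal : JMin x
      minimal b = xor-cancelˡ (begin
        true ≡⟨ sym (full b) ⟩
        η d (s (pair i b)) ≡⟨ trans (cong (λ z → η z (s (pair i b))) d≡) (η-· g x _) ⟩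
        η g (x · s (pair i b) · inv x) xor η x (s (pair i b))
          ≡⟨ cong (_xor η x (s (pair i b))) (longest-inversions L (TJ-conj X-J (base b))) ⟩
        true xor η x (s (pair i b)) ∎)

    longest-unique : ∀ {g g′} → Longest g → Longest g′ → g′ ≡ g
    longest-unique L L′ = full⇒longest L (proj₁ L′) (λ b → longest-inversions L′ (base b))

  isFixGen⁻ : ∀ {g} → isFixGen C θ g ≡ true → ∃ λ i → Pair.Longest i g
  isFixGen⁻ {g} h = let (i , p) = anyFin⁻ (λ i → isLongest C θ i g) h in i , Pair.isLongest⁻ i p

  isFixGen⁺ : ∀ {g} i → Pair.Longest i g → isFixGen C θ g ≡ true
  isFixGen⁺ {g} i L = anyFin⁺ (λ i → isLongest C θ i g) i (Pair.isLongest⁺ i L)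

  stepF⁺ : ∀ x {g} → isFixGen C θ g ≡ true → stepF C θ x (x · g) ≡ true
  stepF⁺ x {g} h = anyFin⁺ (λ g′ → isFixGen C θ g′ ∧ ⌊ x · g ≟ x · g′ ⌋) g (∧-true⁺ h (⌊⌋-true refl))

  stepF⁻ : ∀ x y → stepF C θ x y ≡ true → ∃ λ g → isFixGen C θ g ≡ true × y ≡ x · g
  stepF⁻ x y h =
    let (g , p) = anyFin⁻ (λ g → isFixGen C θ g ∧ ⌊ y ≟ x · g ⌋) h
        (p₁ , p₂) = ∧-true⁻ {isFixGen C θ g} p
    in g , p₁ , ⌊⌋-true⁻ p₂

  reachι reachF : ℕ → Fin N → Bool
  reachι = Dist.reach (stepι C θ) e
  reachF = Dist.reach (stepF C θ) e

  distι distF : Fin N → ℕ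
  distι = Dist.dist (stepι C θ) e
  distF = Dist.dist (stepF C θ) e

  private
    module DF = DistProperties (stepF C θ) e
    module DI = DistProperties (stepι C θ) e

  ⋆-fixed : ∀ {x i} → act x i ≡ x → _⋆_ C θ x (s i) ≡ x · s i
  ⋆-fixed {x} {i} f with θ (s i) · x · s i ≟ x
  ... | yes _ = refl
  ... | no ¬p = ⊥-elim (¬p f)

  ⋆-moved : ∀ {x i} → ¬ act x i ≡ x → _⋆_ C θ x (s i) ≡ act x i
  ⋆-moved {x} {i} ne with θ (s i) · x · s i ≟ x
  ... | yes p = ⊥-elim (ne p)
  ... | no _ = refl

  len-⋆ : ∀ x i → len (_⋆_ C θ x (s i)) ≤ 2 + len x
  len-⋆ x i = by (act x i ≟ x)
    where
    by : Dec (act x i ≡ x) → len (_⋆_ C θ x (s i)) ≤ 2 + len x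
    by (yes p) = subst (λ z → len z ≤ 2 + len x) (sym (⋆-fixed p)) (ℕ.≤-trans (len-·s x i) (ℕ.n≤1+n _))
    by (no ¬p) = subst (λ z → len z ≤ 2 + len x) (sym (trans (⋆-moved ¬p) (act≡ x i)))
          (ℕ.≤-trans (len-·s (s (θi i) · x) i) (s≤s (len-s· (θi i) x)))

  -- Holds along every path of `⋆`-steps, including those that leave ι(θ) by multiplying on the
  -- right only.
  reachι-len : ∀ k {y} → reachι k y ≡ true → len y ≤ k + k
  reachι-len = DI.reach-induction (λ k y → len y ≤ k + k) (ℕ.≤-reflexive len-e)
    (λ k y h → ℕ.≤-trans h (ℕ.+-mono-≤ (ℕ.n≤1+n k) (ℕ.n≤1+n k)))
    (λ k x y h st → let (i , p) = anyFin⁻ (λ i → ⌊ y ≟ _⋆_ C θ x (s i) ⌋) st in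
      ℕ.≤-trans (subst (λ z → len z ≤ 2 + len x) (sym (⌊⌋-true⁻ p)) (len-⋆ x i))
        (subst (2 + len x ≤_) (cong suc (sym (ℕ.+-suc k k))) (s≤s (s≤s h))))

  ι-reach : ∀ {x} → ι x → reachι (half x) x ≡ true × len x ≡ half x + half x
  ι-reach = ι-induction (λ x → reachι (half x) x ≡ true × len x ≡ half x + half x)
      (subst (λ k → reachι k e ≡ true) (sym half-e) (⌊⌋-true refl) , trans len-e (sym (cong₂ _+_ half-e half-e))) extend
    where
    half-e : half e ≡ 0
    half-e = cong ℕ.⌊_/2⌋ len-e
    extend : ∀ x i → ι x → Down x i → reachι (half (act x i)) (act x i) ≡ true × len (act x i) ≡ half (act x i) + half (act x i) →
             reachι (half x) x ≡ true × len x ≡ half x + half x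
    extend x i ix d (h , l) = subst (λ k → reachι k x ≡ true) (sym hx) (DI.reach-step (half x₁) {x₁} {x} h step)
        , trans (len-act-descent i ix (proj₁ d) (proj₂ d))
            (trans (cong (2 +_) l) (trans (cong suc (sym (ℕ.+-suc (half x₁) (half x₁)))) (sym (cong₂ _+_ hx hx))))
      where
      x₁ = act x i
      hx = half-down ix d
      step : stepι C θ x₁ x ≡ true
      step = anyFin⁺ (λ i → ⌊ x ≟ _⋆_ C θ x₁ (s i) ⌋) i (⌊⌋-true (sym (trans (⋆-moved (act-moves (proj₁ d))) (act-act x i))))

  -- Descending by twisted conjugation reaches e in ℓ(x)/2 steps, and no step can remove more than
  -- two from the length.
  dist-ι : ∀ {x} → ι x → distι x ≡ half x
  dist-ι {x} ix = ℕ.≤-antisym (DI.least-≤ {x} least (proj₁ (ι-reach ix)))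
      (ℕ.≮⇒≥ (λ d<h → ℕ.<⇒≱ (ℕ.+-mono-< d<h d<h) (subst (_≤ d + d) (proj₂ (ι-reach ix)) (reachι-len d (proj₁ least)))))
    where
    d = distι x
    least : DI.Least x d
    least = DI.reach⇒least (half x) {x} (proj₁ (ι-reach ix))

  -- The longest element of W_J in closed form, valid when s and θ(s) commute; `wJ-longest`
  -- identifies it.
  wJ : Fin r → Fin N
  wJ i = if ⌊ θ (s i) ≟ s i ⌋ then s i else s i · θ (s i)

  wJ-fixed : ∀ {i} → θ (s i) ≡ s i → wJ i ≡ s i
  wJ-fixed h = if-true (⌊⌋-true h)

  wJ-pair : ∀ {i} → ¬ θ (s i) ≡ s i → wJ i ≡ s i · s (θi i)
  wJ-pair {i} h = trans (if-false (⌊⌋-false h)) (cong (s i ·_) (sym (s-θi i)))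

  module FixDistance (commute : Commuting) (p : ℕ) where
    -- Here t = p + 2 is at least 2, so that a power of t determines its exponent.
    open FixedElements commute (suc p) public

    conj-partner : ∀ i → s (θi i) · s i · s (θi i) ≡ s i
    conj-partner i = trans (cong (λ z → z · s i · z) (s-θi i)) (trans (cong (_· θ (s i)) (sym (commute i)))
      (grp [] (sᴵ i ∷ θsᴵ i ∷ []) (P ∙ Q ∙ Q) P refl))

    conj-partner′ : ∀ i → s i · s (θi i) · s i ≡ s (θi i)
    conj-partner′ i = trans (cong (λ z → s i · z · s i) (s-θi i)) (trans (cong (_· s i) (commute i))
      (trans (len-s-self (θ (s i)) i) (sym (s-θi i))))

    wJ-longest : ∀ i → Pair.Longest i (wJ i)
    wJ-longest i = subst (Pair.Longest i) (sym (Pair.full⇒longest i (proj₂ (Pair.longest i)) in-J full)) (proj₂ (Pair.longest i))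
      where
      by : Dec (θ (s i) ≡ s i) → Pair.InJ i (wJ i) × (∀ b → η (wJ i) (s (pair i b)) ≡ true)
      by (yes h) = subst (Pair.InJ i) (sym (wJ-fixed h)) (Pair.InJ-s i false)
        , λ { false → trans (cong (λ z → η z (s i)) (wJ-fixed h)) (trans (η-s i (s i)) (⌊⌋-true refl))
            ; true → trans (cong (λ z → η z (s (θi i))) (wJ-fixed h)) (trans (η-s i (s (θi i))) (⌊⌋-true (trans (s-θi i) h))) }
      by (no ne) = subst (Pair.InJ i) (sym (wJ-pair ne)) (Pair.InJ-· i (Pair.InJ-s i false) (Pair.InJ-s i true))
        , λ { false → trans (cong (λ z → η z (s i)) (wJ-pair ne)) (trans (η-·s (s i) (θi i) (s i)) (cong₂ _xor_
                 (trans (cong (η (s i)) (conj-partner i)) (trans (η-s i (s i)) (⌊⌋-true refl))) (⌊⌋-false (λ h → ne (trans (sym (s-θi i)) (sym h))))))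
            ; true → trans (cong (λ z → η z (s (θi i))) (wJ-pair ne)) (trans (η-·s-self (s i) (θi i))
                 (cong not (trans (η-s i (s (θi i))) (⌊⌋-false (λ h → ne (trans (sym (s-θi i)) h)))))) }
      in-J = proj₁ (by (θ (s i) ≟ s i))
      full = proj₂ (by (θ (s i) ≟ s i))

    generator⇒wJ : ∀ {g} → isFixGen C θ g ≡ true → ∃ λ i → g ≡ wJ i
    generator⇒wJ h = let (i , L) = isFixGen⁻ h in i , Pair.longest-unique i (wJ-longest i) L

    wJ-involutive : ∀ i → wJ i · wJ i ≡ e
    wJ-involutive i with θ (s i) ≟ s i
    ... | yes h = s-invol i
    ... | no _ = trans (cong ((s i · θ (s i)) ·_) (commute i)) (grp [] (sᴵ i ∷ θsᴵ i ∷ []) ((P ∙ Q) ∙ (Q ∙ P)) ε refl)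

    θ-wJ : ∀ i → θ (wJ i) ≡ wJ i
    θ-wJ i with θ (s i) ≟ s i
    ... | yes h = h
    ... | no _ = trans (hom _ _) (trans (cong (θ (s i) ·_) (involutive (s i))) (sym (commute i)))

    θ-·wJ : ∀ {f} i → θ f ≡ f → θ (f · wJ i) ≡ f · wJ i
    θ-·wJ i h = trans (hom _ _) (cong₂ _·_ h (θ-wJ i))

    φ-wJ-up : ∀ f i → θ f ≡ f → η f (s i) ≡ false → φ (f · wJ i) ≡ t * φ f
    φ-wJ-up f i θf h with θ (s i) ≟ s i
    ... | yes q = φ-fixed-simple f i q h
    ... | no ne = trans (cong φ (sym (assoc _ _ _))) (φ-commuting-pair f i ne θf h)

    descent-partner : ∀ f i → θ f ≡ f → η f (s i) ≡ true → η f (s (θi i)) ≡ true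
    descent-partner f i θf h = trans (cong₂ η (sym θf) (s-θi i)) (trans (η-θ f (s i)) h)

    wJ-down : ∀ f i → θ f ≡ f → η f (s i) ≡ true → η (f · wJ i) (s i) ≡ false × len (f · wJ i) < len f
    wJ-down f i θf h = by (θ (s i) ≟ s i)
      where
      by : Dec (θ (s i) ≡ s i) → η (f · wJ i) (s i) ≡ false × len (f · wJ i) < len f
      by (yes q) = trans (cong (λ z → η (f · z) (s i)) (wJ-fixed q)) (trans (η-·s-self f i) (cong not h))
        , subst (λ z → len (f · z) < len f) (sym (wJ-fixed q)) (exchange f (s i) h)
      by (no ne) = trans (cong (λ z → η z (s i)) fw) (trans (η-·s (f · s i) (θi i) (s i)) (cong₂ _xor_
             (trans (cong (η (f · s i)) (conj-partner i)) (trans (η-·s-self f i) (cong not h))) (⌊⌋-false (λ p → ne (trans (sym (s-θi i)) (sym p))))))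
        , subst (λ z → len z < len f) (sym fw) (ℕ.<-trans (exchange (f · s i) (s (θi i)) next) (exchange f (s i) h))
        where
        fw : f · wJ i ≡ f · s i · s (θi i)
        fw = trans (cong (f ·_) (wJ-pair ne)) (sym (assoc _ _ _))
        next : η (f · s i) (s (θi i)) ≡ true
        next = trans (η-·s f i (s (θi i))) (cong₂ _xor_ (trans (cong (η f) (conj-partner′ i)) (descent-partner f i θf h))
          (⌊⌋-false (λ p → ne (trans (sym (s-θi i)) p))))

    ·wJ-wJ : ∀ f i → f · wJ i · wJ i ≡ f
    ·wJ-wJ f i = trans (assoc _ _ _) (trans (cong (f ·_) (wJ-involutive i)) (identityʳ f))

    φ-wJ-down : ∀ f i → θ f ≡ f → η f (s i) ≡ true → φ f ≡ t * φ (f · wJ i)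
    φ-wJ-down f i θf h = trans (cong φ (sym (·wJ-wJ f i))) (φ-wJ-up (f · wJ i) i (θ-·wJ i θf) (proj₁ (wJ-down f i θf h)))

    φ-e : φ e ≡ 1
    φ-e = trans (F-e (δ e)) (δ-same {x = e} refl)

    -- Each generator of Fix(θ) changes the exponent of φ by exactly one, up or down, so the
    -- exponent is at most the number of steps.
    reachF-φ : ∀ k {f} → reachF k f ≡ true → θ f ≡ f × ∃ λ j → j ≤ k × φ f ≡ t ^ j
    reachF-φ = DF.reach-induction (λ k f → θ f ≡ f × ∃ λ j → j ≤ k × φ f ≡ t ^ j) (θ-e , 0 , z≤n , φ-e)
        (λ k f (θf , j , j≤k , eq) → θf , j , ℕ.m≤n⇒m≤1+n j≤k , eq)
        (λ k x f (θx , j , j≤k , eq) st →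
          let (g , gen , f≡) = stepF⁻ x f st
              (i , g≡) = generator⇒wJ gen
          in subst (λ f → θ f ≡ f × ∃ λ j → j ≤ suc k × φ f ≡ t ^ j) (sym (trans f≡ (cong (x ·_) g≡)))
               (θ-·wJ i θx , next i θx j j≤k eq (η x (s i)) refl))
      where
      next : ∀ {k x} i → θ x ≡ x → ∀ j → j ≤ k → φ x ≡ t ^ j → ∀ b → η x (s i) ≡ b → ∃ λ j → j ≤ suc k × φ (x · wJ i) ≡ t ^ j
      next {x = x} i θx j j≤k eq false d = suc j , s≤s j≤k , trans (φ-wJ-up x i θx d) (cong (t *_) eq)
      -- The exponent 0 cannot drop, because t would then divide 1.
      next {x = x} i θx zero j≤k eq true d = ⊥-elim (case ℕ.m*n≡1⇒m≡1 t (φ (x · wJ i)) (trans (sym (φ-wJ-down x i θx d)) eq) of λ ())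
      next {x = x} i θx (suc j) j≤k eq true d = j , ℕ.m≤n⇒m≤1+n (ℕ.<⇒≤ j≤k) , ℕ.*-cancelˡ-≡ _ _ t (trans (sym (φ-wJ-down x i θx d)) eq)

    fixed-reachF : ∀ {f} → θ f ≡ f → ∃ λ k → reachF k f ≡ true × φ f ≡ t ^ k
    fixed-reachF {f} θf = go f (<-wellFounded (len f)) θf
      where
      go : ∀ f → Acc _<_ (len f) → θ f ≡ f → ∃ λ k → reachF k f ≡ true × φ f ≡ t ^ k
      go f (acc rec) θf = by (f ≟ e)
        where
        by : Dec (f ≡ e) → ∃ λ k → reachF k f ≡ true × φ f ≡ t ^ k
        by (yes f≡e) = 0 , ⌊⌋-true f≡e , trans (cong φ f≡e) φ-e
        by (no ne) =
          let (i , d) = has-descent f ne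
              (k , h , eq) = go (f · wJ i) (rec (proj₂ (wJ-down f i θf d))) (θ-·wJ i θf)
          in suc k , DF.reach-step k {f · wJ i} {f} h (subst (λ z → stepF C θ (f · wJ i) z ≡ true) (·wJ-wJ f i)
                       (stepF⁺ (f · wJ i) (isFixGen⁺ i (wJ-longest i))))
           , trans (φ-wJ-down f i θf d) (cong (t *_) eq)

    ^-injective : ∀ {a b} → t ^ a ≡ t ^ b → a ≡ b
    ^-injective {a} {b} h = ℕ.≤-antisym (ℕ.≮⇒≥ (λ b<a → ℕ.<⇒≢ (ℕ.^-monoʳ-< t (s≤s (s≤s z≤n)) b<a) (sym h)))
                                         (ℕ.≮⇒≥ (λ a<b → ℕ.<⇒≢ (ℕ.^-monoʳ-< t (s≤s (s≤s z≤n)) a<b) h))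

    -- The exponent of φ bounds the distance from below by `reachF-φ`, and a path down through
    -- descents has exactly that many steps by `fixed-reachF`.
    φ-dist : ∀ {f} → θ f ≡ f → φ f ≡ t ^ distF f
    φ-dist {f} θf =
      let (k , h , eq) = fixed-reachF θf
          least = DF.reach⇒least k {f} h
          (_ , j , j≤d , eq′) = reachF-φ (distF f) (proj₁ least)
          k≡j = ^-injective {k} {j} (trans (sym eq) eq′)
          d≡k = ℕ.≤-antisym (DF.least-≤ {f} least h) (subst (_≤ distF f) (sym k≡j) j≤d)
      in trans eq (cong (t ^_) (sym d≡k))

  -- Comparison of coefficients

  private
    module PW = DistPolynomial (stepW C θ) e
    module PI = DistPolynomial (stepι C θ) e
    module PF = DistPolynomial (stepF C θ) e

  module Factorisation (commute : Commuting) where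

    product : Poly
    product = Poinι C θ ⊛ PoinFix C θ

    eval-factorisation : ∀ p → eval N (PoinW C θ) (suc (suc p)) ≡ eval N (Poinι C θ) (suc (suc p)) * eval N (PoinFix C θ) (suc (suc p))
    eval-factorisation p = begin
      eval N (PoinW C θ) t ≡⟨ trans (PW.eval-poin (λ _ → true) t) (sum-cong-≗ (λ w → cong (t ^_) (sym (len≡ w)))) ⟩
      sum (λ w → t ^ len w) ≡⟨ length-generating-function ⟩
      sum weight * total (δ e)
        ≡⟨ cong₂ _*_ (sum-cong-≗ (λ x → ι-term x (inι C θ x) refl)) (sum-cong-≗ (λ f → fix-term f (θ f ≟ f))) ⟩
      sum (λ x → if inι C θ x then t ^ distι x else 0) * sum (λ f → if inFix C θ f then t ^ distF f else 0)
        ≡⟨ sym (cong₂ _*_ (PI.eval-poin (inι C θ) t) (PF.eval-poin (inFix C θ) t)) ⟩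
      eval N (Poinι C θ) t * eval N (PoinFix C θ) t ∎
      where
      open FixDistance commute p
      ι-term : ∀ x b → inι C θ x ≡ b → weight x ≡ (if inι C θ x then t ^ distι x else 0)
      ι-term x false h = trans (if-false h) (sym (if-false h))
      ι-term x true h = cong (λ d → if inι C θ x then t ^ d else 0) (sym (dist-ι (inι⁻ h)))
      fix-term : ∀ f → Dec (θ f ≡ f) → φ f ≡ (if inFix C θ f then t ^ distF f else 0)
      fix-term f (yes h) = trans (φ-dist h) (sym (if-true (⌊⌋-true h)))
      fix-term f (no h) = trans (φ-unfixed h) (sym (if-false (⌊⌋-false h)))

    factorisation : ∀ k → PoinW C θ k ≡ product k
    factorisation k with k ≤? N + N
    ... | yes k≤ = eval-injective (N + N) (PoinW C θ) product t (λ k k≤ → bound (PoinW C θ) k k≤ (ℕ.m≤m+n _ _))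
            (λ k k≤ → bound product k k≤ (ℕ.m≤n+m _ (sumUpTo (N + N) (PoinW C θ))))
            (trans (sumUpTo-tail N (N + N) _ (ℕ.m≤m+n N N) (λ k N<k → cong (_* t ^ k) (PW.poin-vanishes (λ _ → true) k N<k)))
              (trans (eval-factorisation p) (sym (eval-⊛ N (Poinι C θ) (PoinFix C θ) t (PI.poin-vanishes (inι C θ)) (PF.poin-vanishes (inFix C θ))))))
            k k≤
      where
      -- The sum of all relevant coefficients of both sides: every single coefficient is at most p,
      -- hence a digit in base t.
      p = sumUpTo (N + N) (PoinW C θ) + sumUpTo (N + N) product
      t = suc (suc p)
      bound : ∀ f k → k ≤ N + N → sumUpTo (N + N) f ≤ p → f k < t
      bound f k k≤ h = ℕ.≤-trans (s≤s (ℕ.≤-trans (term≤sumUpTo (N + N) f k k≤) h)) (ℕ.n≤1+n _)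
    ... | no k≰ = trans (PW.poin-vanishes (λ _ → true) k (ℕ.≤-<-trans (ℕ.m≤m+n N N) (ℕ.≰⇒> k≰)))
            (sym (sumUpTo-zero k _ (λ i i≤k → term i i≤k (i ≤? N))))
      where
      term : ∀ i → i ≤ k → Dec (i ≤ N) → Poinι C θ i * PoinFix C θ (k ∸ i) ≡ 0
      term i i≤k (yes i≤N) = trans (cong (Poinι C θ i *_) (PF.poin-vanishes (inFix C θ) (k ∸ i)
        (ℕ.+-cancelˡ-< i N (k ∸ i) (ℕ.≤-<-trans (ℕ.+-monoˡ-≤ N i≤N) (subst (N + N <_) (sym (ℕ.m+[n∸m]≡n i≤k)) (ℕ.≰⇒> k≰)))))) (ℕ.*-zeroʳ (Poinι C θ i))
      term i i≤k (no i≰N) = cong (_* PoinFix C θ (k ∸ i)) (PI.poin-vanishes (inι C θ) i (ℕ.≰⇒> i≰N))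

  -- Coefficients of degree one

  dist-start : ∀ (step : Fin N → Fin N → Bool) → Dist.dist step e e ≡ 0
  dist-start step = DistProperties.dist-least step e {e} {0} (⌊⌋-true refl , λ j ())

  dist-one : ∀ (step : Fin N → Fin N → Bool) y → step e y ≡ true → ¬ y ≡ e → Dist.dist step e y ≡ 1
  dist-one step y h ne = DistProperties.dist-least step e {y} {1}
    (DistProperties.reach-step step e 0 {e} {y} (⌊⌋-true refl) h , λ { zero _ → ⌊⌋-false ne ; (suc j) (s≤s ()) })

  θ-InJ : ∀ i {d} → Pair.InJ i d → Pair.InJ i (θ d)
  θ-InJ i (bs , refl) = go bs
    where
    letter : ∀ b → Pair.InJ i (θ (s (pair i b)))
    letter false = subst (Pair.InJ i) (s-θi i) (Pair.InJ-s i true)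
    letter true = subst (Pair.InJ i) (sym (θ-s-θi i)) (Pair.InJ-s i false)
    go : ∀ bs → Pair.InJ i (θ (Pair.evJ i bs))
    go [] = subst (Pair.InJ i) (sym θ-e) (Pair.InJ-e i)
    go (b ∷ bs) = subst (Pair.InJ i) (sym (hom _ _)) (Pair.InJ-· i (go bs) (letter b))

  longest-θ-fixed : ∀ i {g} → Pair.Longest i g → θ g ≡ g
  longest-θ-fixed i {g} L = Pair.longest-unique i L (θ-InJ i (proj₁ L) , λ h H → subst (len h ≤_) (sym (len-θ g)) (proj₂ L h H))

  longest≢e : ∀ i {g} → Pair.Longest i g → ¬ g ≡ e
  longest≢e i L g≡e = true≢false (Pair.longest-inversions i L (Pair.base false)) (trans (cong (λ z → η z (s i)) g≡e) (η-e (s i)))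

  -- `s i` is an inversion of g and so lies in the parabolic subgroup of j. It then has a descent
  -- among the generators of that subgroup, and the only descent of `s i` is itself.
  longest-meet : ∀ {i j g} → Pair.Longest i g → Pair.Longest j g → i ≡ j ⊎ θi j ≡ i
  longest-meet {i} {j} L L′ =
    let J = Pair.TJ⇒InJ j (Pair.inversion-TJ j (proj₁ L′) (Pair.longest-inversions i L (Pair.base false)))
        (b , d) = Pair.InJ-descent j J (s-nontriv i)
    in by b (s-inj _ _ (sym (⌊⌋-true⁻ (trans (sym (η-s i (s (pair j b)))) d))))
    where
    by : ∀ b → i ≡ pair j b → i ≡ j ⊎ θi j ≡ i
    by false h = inj₁ h
    by true h = inj₂ (sym h)

  -- The element θ(s_j)s_j has length two. A last letter other than s_j forces its two factors to
  -- commute, and that letter is then θ(s_j).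
  act-e-meet : ∀ {i j} → ¬ θi j ≡ j → act e i ≡ act e j → i ≡ j ⊎ (i ≡ θi j × CommutesAt j)
  act-e-meet {i} {j} ne h = by (s i ≟ s j)
    where
    by : Dec (s i ≡ s j) → i ≡ j ⊎ (i ≡ θi j × CommutesAt j)
    by (yes p) = inj₁ (s-inj i j p)
    by (no i≢j) = inj₂ (i≡ , trans (cong (s j ·_) (trans (sym (s-θi j)) (cong s (sym i≡)))) (trans (sym y≡) (trans (act-e j) (cong (_· s j) (s-θi j)))))
      where
      descends : η (s (θi j) · s j) (s i) ≡ true
      descends = trans (cong (λ z → η z (s i)) (trans (sym (act-e j)) (sym h)))
        (proj₂ (Up⇒Down (act-e-up (λ p → i≢j (fixed-case p)))))
        where
        fixed-case : θi i ≡ i → s i ≡ s j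
        fixed-case p = ⊥-elim (proj₁ (act-e-up ne) (trans (sym h) (trans (act-e i) (trans (cong (λ k → s k · s i) p) (s-invol i)))))
      conj-eq : s j · s i · s j ≡ s (θi j)
      conj-eq = ⌊⌋-true⁻ (trans (sym (η-s (θi j) (s j · s i · s j))) (trans (sym (Bₚ.xor-identityʳ _))
        (trans (cong (η (s (θi j)) (s j · s i · s j) xor_) (sym (⌊⌋-false i≢j))) (trans (sym (η-·s (s (θi j)) j (s i))) descends))))
      y≡ : act e j ≡ s j · s i
      y≡ = trans (act-e j) (trans (cong (_· s j) (sym conj-eq)) (len-s-self (s j · s i) j))
      i≡ : i ≡ θi j
      i≡ = trans (sym (θi-θi i)) (cong θi (s-inj _ _ (·-cancelʳ (s i) (trans (sym (act-e i)) (trans h y≡)))))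

  module Converse (identity : ∀ k → PoinW C θ k ≡ (Poinι C θ ⊛ PoinFix C θ) k) where

    degree-one : (step : Fin N → Fin N → Bool) → (Fin N → Bool) → Fin N → Bool
    degree-one step P y = P y ∧ (Dist.dist step e y ≡ᵇ 1)

    W-degree-one : PoinW C θ 1 ≤ r
    W-degree-one = countᵇ-image-≤ (degree-one (stepW C θ) (λ _ → true)) s (λ y h →
      let (i , x , y≡ , lx) = len-pred y {0} (trans (len≡ y) (≡ᵇ-true⁻ h))
      in i , trans y≡ (trans (cong (_· s i) (len-0 lx)) (identityˡ (s i))))

    constant-term : ∀ (step : Fin N → Fin N → Bool) P → P e ≡ true → 1 ≤ Dist.poin step e P 0
    constant-term step P h = positive (countᵇ-index (λ y → P y ∧ (Dist.dist step e y ≡ᵇ 0)) id e (∧-true⁺ h (≡ᵇ-true (dist-start step))))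
      where
      positive : ∀ {n} → Fin n → 1 ≤ n
      positive zero = s≤s z≤n
      positive (suc _) = s≤s z≤n

    fix-degree-one : ∀ i {g} → Pair.Longest i g → degree-one (stepF C θ) (inFix C θ) g ≡ true
    fix-degree-one i {g} L = ∧-true⁺ (⌊⌋-true (longest-θ-fixed i L)) (≡ᵇ-true (dist-one (stepF C θ) g
      (subst (λ z → stepF C θ e z ≡ true) (identityˡ g) (stepF⁺ e (isFixGen⁺ i L))) (longest≢e i L)))

    ι-degree-one : ∀ i → ¬ θi i ≡ i → degree-one (stepι C θ) (inι C θ) (act e i) ≡ true
    ι-degree-one i ne = ∧-true⁺ (inι⁺ (ι-act i ι-e)) (≡ᵇ-true (trans (dist-ι (ι-act i ι-e))
      (trans (half-up ι-e (act-e-up ne)) (cong (λ n → suc ℕ.⌊ n /2⌋) len-e))))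

    -- The degree one coefficient of the product pairs each linear coefficient with a constant term,
    -- and both constant terms are at least 1 because of e.
    degree-one-bound : PoinFix C θ 1 + Poinι C θ 1 ≤ r
    degree-one-bound = ℕ.≤-trans (ℕ.+-mono-≤
        (subst (_≤ Poinι C θ 0 * PoinFix C θ 1) (ℕ.*-identityˡ _) (ℕ.*-monoˡ-≤ (PoinFix C θ 1) (constant-term (stepι C θ) (inι C θ) (inι⁺ ι-e))))
        (subst (_≤ Poinι C θ 1 * PoinFix C θ 0) (ℕ.*-identityʳ _) (ℕ.*-monoʳ-≤ (Poinι C θ 1) (constant-term (stepF C θ) (inFix C θ) (⌊⌋-true θ-e)))))
      (ℕ.≤-trans (ℕ.≤-reflexive (sym (identity 1))) W-degree-one)

    -- If s a and θ(s a) do not commute, then θ(s a) s a and s a θ(s a) are distinct elements of ι of rank one,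
    -- so the right hand side has at least r + 1 terms of degree one.
    module Excess (a : Fin r) (a<θa : toℕ a < toℕ (θi a)) (ne : ¬ CommutesAt a) where
      Target : Set
      Target = Fin (PoinFix C θ 1) ⊎ Fin (Poinι C θ 1)

      longestOf : ∀ j → ∃ (Pair.Longest j)
      longestOf j = Pair.longest j

      toFix : Fin r → Target
      toFix j = inj₁ (countᵇ-index (degree-one (stepF C θ) (inFix C θ)) id (proj₁ (longestOf j)) (fix-degree-one j (proj₂ (longestOf j))))

      toι : ∀ j → ¬ θi j ≡ j → Target
      toι j ne = inj₂ (countᵇ-index (degree-one (stepι C θ) (inι C θ)) id (act e j) (ι-degree-one j ne))

      moves> : ∀ {j} → toℕ (θi j) < toℕ j → ¬ θi j ≡ j
      moves> h eq = ℕ.<⇒≢ h (cong toℕ eq)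

      moves< : ∀ {j} → toℕ j < toℕ (θi j) → ¬ θi j ≡ j
      moves< h eq = ℕ.<⇒≢ h (cong toℕ (sym eq))

      -- The order of indices splits each orbit of θ on S: the smaller index accounts for the
      -- generator w_J of Fix(θ), the larger one for the element θ(s)s of ι(θ). For the smaller
      -- index `a` of a non-commuting pair, its own element of ι(θ) is left over.
      target : ∀ j → toℕ j ≤ toℕ (θi j) ⊎ toℕ (θi j) < toℕ j → Target
      target j (inj₁ _) = toFix j
      target j (inj₂ h) = toι j (moves> h)

      toFix-injective : ∀ {i j} → toℕ i ≤ toℕ (θi i) → toℕ j ≤ toℕ (θi j) → toFix i ≡ toFix j → i ≡ j
      toFix-injective {i} {j} hi hj eq = by (longest-meet {i} {j} (proj₂ (longestOf i))
          (subst (Pair.Longest j) (sym (countᵇ-index-injective (degree-one (stepF C θ) (inFix C θ)) id _ _ _ _ (inj₁-injective eq))) (proj₂ (longestOf j))))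
        where
        by : i ≡ j ⊎ θi j ≡ i → i ≡ j
        by (inj₁ p) = p
        by (inj₂ p) = Fₚ.toℕ-injective (ℕ.≤-antisym (subst (λ k → toℕ i ≤ toℕ k) (trans (cong θi (sym p)) (θi-θi j)) hi)
                                                    (subst (λ k → toℕ j ≤ toℕ k) p hj))

      toι-meet : ∀ {i j} ni nj → toι i ni ≡ toι j nj → i ≡ j ⊎ (i ≡ θi j × CommutesAt j)
      toι-meet {i} {j} ni nj eq = act-e-meet nj
          (countᵇ-index-injective (degree-one (stepι C θ) (inι C θ)) id (act e i) (act e j) (ι-degree-one i ni) (ι-degree-one j nj) (inj₂-injective eq))

      target-injective : ∀ i j ci cj → target i ci ≡ target j cj → i ≡ j
      target-injective i j (inj₁ hi) (inj₁ hj) eq = toFix-injective hi hj eq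
      target-injective i j (inj₁ hi) (inj₂ hj) ()
      target-injective i j (inj₂ hi) (inj₁ hj) ()
      target-injective i j (inj₂ hi) (inj₂ hj) eq = by (toι-meet {i} {j} (moves> hi) (moves> hj) eq)
        where
        by : i ≡ j ⊎ (i ≡ θi j × CommutesAt j) → i ≡ j
        by (inj₁ p) = p
        by (inj₂ (p , _)) = ⊥-elim (ℕ.<-asym (subst (λ k → toℕ k < toℕ j) (sym p) hj)
          (subst (λ k → toℕ k < toℕ i) (trans (cong θi p) (θi-θi j)) hi))

      extra-distinct : ∀ j cj → ¬ toι a (moves< a<θa) ≡ target j cj
      extra-distinct j (inj₁ _) ()
      extra-distinct j (inj₂ hj) eq = by (toι-meet {j} {a} (moves> hj) (moves< a<θa) (sym eq))
        where
        by : j ≡ a ⊎ (j ≡ θi a × CommutesAt a) → ⊥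
        by (inj₁ p) = ℕ.<-asym a<θa (subst (λ k → toℕ (θi k) < toℕ k) p hj)
        by (inj₂ (_ , c)) = ne c

      all-targets : Fin (suc r) → Target
      all-targets zero = toι a (moves< a<θa)
      all-targets (suc j) = target j (ℕ.≤-<-connex (toℕ j) (toℕ (θi j)))

      all-targets-injective : ∀ i j → all-targets i ≡ all-targets j → i ≡ j
      all-targets-injective zero zero eq = refl
      all-targets-injective zero (suc j) eq = ⊥-elim (extra-distinct j (ℕ.≤-<-connex (toℕ j) (toℕ (θi j))) eq)
      all-targets-injective (suc i) zero eq = ⊥-elim (extra-distinct i (ℕ.≤-<-connex (toℕ i) (toℕ (θi i))) (sym eq))
      all-targets-injective (suc i) (suc j) eq = cong suc (target-injective i j (ℕ.≤-<-connex (toℕ i) (toℕ (θi i))) (ℕ.≤-<-connex (toℕ j) (toℕ (θi j))) eq)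

      excess : ⊥
      excess = ℕ.<⇒≱ (Fₚ.injective⇒≤ {f = join a′ b′ ∘ all-targets} (λ {i} {j} eq → all-targets-injective i j
          (trans (sym (Fₚ.splitAt-join a′ b′ (all-targets i))) (trans (cong (splitAt a′) eq) (Fₚ.splitAt-join a′ b′ (all-targets j)))))) degree-one-bound
        where
        a′ = PoinFix C θ 1
        b′ = Poinι C θ 1

    commutes : Commuting
    commutes i = by (s i · θ (s i) ≟ θ (s i) · s i)
      where
      by : Dec (CommutesAt i) → CommutesAt i
      by (yes p) = p
      by (no ne) = order (ℕ.<-cmp (toℕ i) (toℕ (θi i)))
        where
        order : Tri (toℕ i < toℕ (θi i)) (toℕ i ≡ toℕ (θi i)) (toℕ (θi i) < toℕ i) → CommutesAt i
        order (tri< lt _ _) = ⊥-elim (Excess.excess i lt ne)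
        order (tri≈ _ eq _) = let θs = trans (sym (s-θi i)) (cong s (sym (Fₚ.toℕ-injective eq))) in cong₂ _·_ (sym θs) θs
        order (tri> _ _ gt) = ⊥-elim (Excess.excess (θi i) (subst (λ k → toℕ (θi i) < toℕ k) (sym (θi-θi i)) gt)
          (λ c → ne (sym (trans (cong₂ _·_ (sym (s-θi i)) (sym (θ-s-θi i)))
            (trans c (cong₂ _·_ (θ-s-θi i) (s-θi i)))))))

  -- Commutation and orders at most two

  order⇒commute : (∀ i → ∃ λ m → IsOrder (s i · θ (s i)) m × (m ≡ 1 ⊎ m ≡ 2)) → Commuting
  order⇒commute h i with h i
  ... | .1 , (_ , p , _) , inj₁ refl = trans p′ (sym (trans (grp [] (sᴵ i ∷ θsᴵ i ∷ []) (Q ∙ P) ((P ∙ Q) ⁻¹) refl) (trans (cong inv p′) inv-e)))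
    where p′ = trans (sym (identityʳ _)) p
  ... | .2 , (_ , p , _) , inj₂ refl = trans (grp [] (sᴵ i ∷ θsᴵ i ∷ []) (P ∙ Q) ((P ∙ Q) ∙ ((P ∙ Q) ∙ ε) ∙ (Q ∙ P)) refl)
      (trans (cong (_· (θ (s i) · s i)) p) (identityˡ _))

  commute⇒order : Commuting → ∀ i → ∃ λ m → IsOrder (s i · θ (s i)) m × (m ≡ 1 ⊎ m ≡ 2)
  commute⇒order commute i = by (s i · θ (s i) ≟ e)
    where
    by : Dec (s i · θ (s i) ≡ e) → ∃ λ m → IsOrder (s i · θ (s i)) m × (m ≡ 1 ⊎ m ≡ 2)
    by (yes p) = 1 , (s≤s z≤n , trans (identityʳ _) p , λ { (suc k) _ (s≤s ()) }) , inj₁ refl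
    by (no ne) = 2 , (s≤s z≤n
      , trans (cong (λ z → s i · θ (s i) · (z · e)) (commute i)) (grp [] (sᴵ i ∷ θsᴵ i ∷ []) ((P ∙ Q) ∙ ((Q ∙ P) ∙ ε)) ε refl)
      , λ { (suc zero) _ _ h → ne (trans (sym (identityʳ _)) h) ; (suc (suc k)) _ (s≤s (s≤s ())) }) , inj₂ refl

theorem5p2 : (C : CoxeterSystem)
    → (θ : Fin (CoxeterSystem.N C) → Fin (CoxeterSystem.N C))
    → IsInvolutiveAut C θ
    → ((∀ k → PoinW C θ k ≡ (Poinι C θ ⊛ PoinFix C θ) k)
    → (∀ i → ∃ λ m → CoxeterSystem.IsOrder C (CoxeterSystem._·_ C (CoxeterSystem.s C i) (θ (CoxeterSystem.s C i))) m × (m ≡ 1 ⊎ m ≡ 2)))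
    × ((∀ i → ∃ λ m → CoxeterSystem.IsOrder C (CoxeterSystem._·_ C (CoxeterSystem.s C i) (θ (CoxeterSystem.s C i))) m × (m ≡ 1 ⊎ m ≡ 2))
    → (∀ k → PoinW C θ k ≡ (Poinι C θ ⊛ PoinFix C θ) k))
theorem5p2 C θ aut =
    (λ identity → commute⇒order (Converse.commutes identity))
  , (λ orders → Factorisation.factorisation (order⇒commute orders))
  where open Twisted C θ aut
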